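{- For all partitions $\lambda,\mu\in\mathbb{N}^n$, the coefficient $a_{\lambda,\mu}(\alpha)$ defined by the expansion $J_\lambda^{r\delta}=\sum_{\mu}\alpha^{|\mu|-|\lambda|}\,a_{\lambda,\mu}(\alpha)\,m_\mu$ is a polynomial in $\mathbb{N}[\alpha]$.
   Context: Fix $n\ge 1$. Let $r$ be an indeterminate, $\alpha=1/r$, and work in $\mathbb{Q}(r)[x_1,\dots,x_n]$. A partition is $\lambda\in\mathbb{N}^n$ ($\mathbb{N}$ includes $0$) with $\lambda_1\ge\cdots\ge\lambda_n\ge 0$; $|\lambda|=\sum_i\lambda_i$; $m_\mu$ is the monomial symmetric polynomial. Let $\delta=(n-1,n-2,\dots,1,0)$. It is known that there is a unique symmetric polynomial $P_\lambda^{r\delta}(x)$ of total degree $|\lambda|$ such that $P_\lambda^{r\delta}(\mu+r\delta)=0$ for all partitions $\mu\neq\lambda$ with $|\mu|\le|\lambda|$, and the coefficient of $m_\lambda$ in $P_\lambda^{r\delta}$ is $1$ (the symmetric interpolation polynomial). For a box $(i,j)$ of the Ferrers diagram of $\lambda$ (i.e. $1\le j\le\lambda_i$) let $a_\lambda(i,j)=\lambda_i-j$ and $l_\lambda(i,j)=\#\{k>i:\lambda_k\ge j\}$, and set $c_\lambda(\alpha)=\prod_{s}(\alpha a_\lambda(s)+l_\lambda(s)+1)$, the product over all boxes $s$ of $\lambda$. Define $J_\lambda^{r\delta}(x)=(-1)^{|\lambda|}c_\lambda(\alpha)P_\lambda^{r\delta}(-x)$, and define $a_{\lambda,\mu}(\alpha)\in\mathbb{Q}(\alpha)$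 by $J_\lambda^{r\delta}=\sum_\mu\alpha^{|\mu|-|\lambda|}a_{\lambda,\mu}(\alpha)m_\mu$. -}

module Defs where

open import Data.Nat as ℕ using (ℕ; zero; suc; _∸_)
open import Data.Integer as ℤ using (ℤ; +_)
open import Data.Rational as ℚ using (ℚ; 0ℚ; 1ℚ)
open import Data.Fin as Fin using (Fin; toℕ)
open import Data.Fin.Permutation using (Permutation′; _⟨$⟩ʳ_)
open import Data.Vec as Vec using (Vec; lookup; tabulate)
open import Data.Vec.Properties using (≡-dec)
open import Data.List as List using (List; []; _∷_; map; foldr; allFin; upTo)
open import Data.Product using (_×_; _,_; proj₁; proj₂)
open import Relation.Binary.PropositionalEquality using (_≡_)
open import Relation.Nullary using (¬_; yes; no)
open import Relation.Nullary.Decidable using (_×-dec_)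

-- ℚ[r] : univariate polynomials over ℚ as coefficient lists
-- (index k = coefficient of r^k; trailing zeros allowed)

Polyℚ : Set
Polyℚ = List ℚ

coeffℚ : Polyℚ → ℕ → ℚ
coeffℚ []       _       = 0ℚ
coeffℚ (a ∷ p)  zero    = a
coeffℚ (a ∷ p)  (suc k) = coeffℚ p k

_≈ₚ_ : Polyℚ → Polyℚ → Set
p ≈ₚ q = ∀ k → coeffℚ p k ≡ coeffℚ q k

_+ₚ_ : Polyℚ → Polyℚ → Polyℚ
[]      +ₚ q       = q
p       +ₚ []      = p
(a ∷ p) +ₚ (b ∷ q) = (a ℚ.+ b) ∷ (p +ₚ q)

scaleₚ : ℚ → Polyℚ → Polyℚ
scaleₚ c = map (c ℚ.*_)

_*ₚ_ : Polyℚ → Polyℚ → Polyℚ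
[]      *ₚ q = []
(a ∷ p) *ₚ q = scaleₚ a q +ₚ (0ℚ ∷ (p *ₚ q))

-- ℚ(r) : rational functions in r, as (numerator , denominator) pairs.
-- Arithmetic is on raw pairs; equality is cross-multiplication.
-- Meaningful whenever denominators are nonzero (see NonzeroDen).

ℚ⟨r⟩ : Set
ℚ⟨r⟩ = Polyℚ × Polyℚ

NonzeroDen : ℚ⟨r⟩ → Set
NonzeroDen f = ¬ (proj₂ f ≈ₚ [])

_≈_ : ℚ⟨r⟩ → ℚ⟨r⟩ → Set
(a , b) ≈ (c , d) = (a *ₚ d) ≈ₚ (c *ₚ b)

infix 4 _≈_ _≈ₚ_
infixl 6 _+ᶠ_
infixl 7 _*ᶠ_

_+ᶠ_ : ℚ⟨r⟩ → ℚ⟨r⟩ → ℚ⟨r⟩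
(a , b) +ᶠ (c , d) = ((a *ₚ d) +ₚ (c *ₚ b)) , (b *ₚ d)

_*ᶠ_ : ℚ⟨r⟩ → ℚ⟨r⟩ → ℚ⟨r⟩
(a , b) *ᶠ (c , d) = (a *ₚ c) , (b *ₚ d)

-ᶠ_ : ℚ⟨r⟩ → ℚ⟨r⟩
-ᶠ (a , b) = scaleₚ (ℚ.- 1ℚ) a , b

0ᶠ 1ᶠ : ℚ⟨r⟩
0ᶠ = [] , (1ℚ ∷ [])
1ᶠ = (1ℚ ∷ []) , (1ℚ ∷ [])

fromℕᶠ : ℕ → ℚ⟨r⟩
fromℕᶠ k = ((+ k) ℚ./ 1 ∷ []) , (1ℚ ∷ [])

rᶠ αᶠ : ℚ⟨r⟩
rᶠ = (0ℚ ∷ 1ℚ ∷ []) , (1ℚ ∷ [])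
αᶠ = (1ℚ ∷ []) , (0ℚ ∷ 1ℚ ∷ [])

_^ᶠ_ : ℚ⟨r⟩ → ℕ → ℚ⟨r⟩
f ^ᶠ zero  = 1ᶠ
f ^ᶠ suc k = f *ᶠ (f ^ᶠ k)

sgnᶠ : ℕ → ℚ⟨r⟩
sgnᶠ k = (-ᶠ 1ᶠ) ^ᶠ k

sumᶠ : List ℚ⟨r⟩ → ℚ⟨r⟩
sumᶠ = foldr _+ᶠ_ 0ᶠ

prodᶠ : List ℚ⟨r⟩ → ℚ⟨r⟩
prodᶠ = foldr _*ᶠ_ 1ᶠ

ℕ[α]→ℚ⟨r⟩ : List ℕ → ℚ⟨r⟩
ℕ[α]→ℚ⟨r⟩ []      = 0ᶠ
ℕ[α]→ℚ⟨r⟩ (c ∷ p) = fromℕᶠ c +ᶠ αᶠ *ᶠ ℕ[α]→ℚ⟨r⟩ p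

MPoly : ℕ → Set
MPoly n = List (ℚ⟨r⟩ × Vec ℕ n)

coeff : ∀ {n} → MPoly n → Vec ℕ n → ℚ⟨r⟩
coeff []             e = 0ᶠ
coeff ((c , e′) ∷ P) e with ≡-dec ℕ._≟_ e′ e
... | yes _ = c +ᶠ coeff P e
... | no  _ = coeff P e

WellFormed : ∀ {n} → MPoly n → Set
WellFormed P = ∀ e → NonzeroDen (coeff P e)

∣_∣ : ∀ {n} → Vec ℕ n → ℕ
∣ e ∣ = Vec.sum e

permute : ∀ {n} → Permutation′ n → Vec ℕ n → Vec ℕ n
permute σ e = tabulate (λ i → lookup e (σ ⟨$⟩ʳ i))

IsSymmetric : ∀ {n} → MPoly n → Set
IsSymmetric {n} P = ∀ (σ : Permutation′ n) e → coeff P (permute σ e) ≈ coeff P e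

DegreeAtMost : ∀ {n} → ℕ → MPoly n → Set
DegreeAtMost d P = ∀ e → d ℕ.< ∣ e ∣ → coeff P e ≈ 0ᶠ

monomial : ∀ {n} → Vec ℚ⟨r⟩ n → Vec ℕ n → ℚ⟨r⟩
monomial x e = prodᶠ (map (λ i → lookup x i ^ᶠ lookup e i) (allFin _))

eval : ∀ {n} → MPoly n → Vec ℚ⟨r⟩ n → ℚ⟨r⟩
eval P x = sumᶠ (map (λ t → proj₁ t *ᶠ monomial x (proj₂ t)) P)

negArg : ∀ {n} → MPoly n → MPoly n
negArg = map (λ t → (sgnᶠ ∣ proj₂ t ∣ *ᶠ proj₁ t) , proj₂ t)

scale : ∀ {n} → ℚ⟨r⟩ → MPoly n → MPoly n
scale c = map (λ t → (c *ᶠ proj₁ t) , proj₂ t)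

IsPartition : ∀ {n} → Vec ℕ n → Set
IsPartition {n} λ′ = ∀ (i j : Fin n) → toℕ i ℕ.≤ toℕ j → lookup λ′ j ℕ.≤ lookup λ′ i

δ : (n : ℕ) → Vec ℕ n
δ n = tabulate (λ i → n ∸ suc (toℕ i))

shiftPoint : ∀ {n} → Vec ℕ n → Vec ℚ⟨r⟩ n
shiftPoint {n} μ = tabulate (λ i → fromℕᶠ (lookup μ i) +ᶠ fromℕᶠ (lookup (δ n) i) *ᶠ rᶠ)

-- arm and leg of the box (i , j) (1 ≤ j ≤ λᵢ)
arm : ∀ {n} → Vec ℕ n → Fin n → ℕ → ℕ
arm λ′ i j = lookup λ′ i ∸ j

leg : ∀ {n} → Vec ℕ n → Fin n → ℕ → ℕ
leg λ′ i j = List.length (List.filter (λ k → (toℕ i ℕ.<? toℕ k) ×-dec (j ℕ.≤? lookup λ′ k)) (allFin _))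

cλ : ∀ {n} → Vec ℕ n → ℚ⟨r⟩
cλ λ′ = prodᶠ (List.concatMap
          (λ i → map (λ t → αᶠ *ᶠ fromℕᶠ (arm λ′ i (suc t)) +ᶠ fromℕᶠ (leg λ′ i (suc t)) +ᶠ 1ᶠ)
                     (upTo (lookup λ′ i)))
          (allFin _))

IsInterpolationPoly : ∀ {n} → Vec ℕ n → MPoly n → Set
IsInterpolationPoly {n} λ′ P =
  WellFormed P × IsSymmetric P × DegreeAtMost ∣ λ′ ∣ P
  × (∀ (μ : Vec ℕ n) → IsPartition μ → ¬ (μ ≡ λ′) → ∣ μ ∣ ℕ.≤ ∣ λ′ ∣
       → eval P (shiftPoint μ) ≈ 0ᶠ)
  × (coeff P λ′ ≈ 1ᶠ)

Jpoly : ∀ {n} → Vec ℕ n → MPoly n → MPoly n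
Jpoly λ′ P = scale (sgnᶠ ∣ λ′ ∣ *ᶠ cλ λ′) (negArg P)

-- a_{λ,μ}(α) = α^{|λ|-|μ|} · [m_μ] J  (written with α^k and r^k = α^{-k})
aCoeff : ∀ {n} → Vec ℕ n → MPoly n → Vec ℕ n → ℚ⟨r⟩
aCoeff λ′ P μ = (αᶠ ^ᶠ (∣ λ′ ∣ ∸ ∣ μ ∣)) *ᶠ (rᶠ ^ᶠ (∣ μ ∣ ∸ ∣ λ′ ∣)) *ᶠ coeff (Jpoly λ′ P) μ

{-# OPTIONS --safe #-}
module Submission where

-- Put y = −x/r, so that the interpolation nodes become the points bar ν with entries −(α ν_i + rank_i ν).  We use the
-- basis of bar monomials of ℚ(α)[y] on which y_i acts as inc i minus an operator Ξ i of Cherednik type.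
-- Everything is phrased dually: a polynomial is a functional on functions of exponents (type Fun), y_i is dual to Y i,
-- evaluation at a point p is the joint eigenfunction β p of the Y i, and taking the coefficient of y^e is the function
-- barCoeff e.  The recursion for barCoeff along the rightmost maximal entry has no signs, so barCoeff e takes values
-- in ℕ[α].
--
-- Reading λ as a sequence of rotations and insertions with weights in ℕ[α] (the weights of the hook type
-- α a + l + 1) produces a functional F.  By the exchange relations between β p and β (s_k p) it vanishes on the node
-- of every ν that is not a permutation of λ, and it is symmetric.  A functional of bounded degree is determined by
-- its values on the nodes, hence F is proportional to the functional of the interpolation polynomial.  Its leading
-- coefficient is computed column by column to be c_λ, so F is exactly J_λ, and the coefficient of J_λ at e is
-- F (barCoeff e), which lies in ℕ[α].
--
-- Exponents are lists in the order opposite to the usual one: partitions are weakly increasing.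

open import Algebra using (CommutativeRing)
import Algebra.Solver.Ring as RingSolver
import Algebra.Solver.Ring.AlmostCommutativeRing as ACR
open import Level using (0ℓ)
open import Data.Bool using (Bool; true; false; if_then_else_)
open import Data.Empty using (⊥-elim)
open import Data.Integer as ℤ using (ℤ; +_; -[1+_])
import Data.Integer.Properties as ℤₚ
open import Data.List using (List; []; _∷_; _++_; length; replicate; map; reverse; initLast; _∷ʳ′_; upTo; concatMap; foldr; tabulate; allFin; filter)
import Data.List.Properties as Listₚ
open import Data.Maybe using (Maybe; just; nothing)
open import Data.Nat as ℕ using (ℕ; zero; suc; _<_; _≤_; z≤n; s≤s; _⊔_; pred; _≤?_; _∸_)
import Data.Nat.Properties as ℕₚ
import Data.Nat.Solver
open import Data.Product using (_×_; _,_; proj₁; proj₂; Σ; ∃)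
open import Data.Sum using (_⊎_; inj₁; inj₂; map₂)
open import Data.Unit using (⊤; tt)
open import Function using (id; _∘_)
open import Relation.Binary.Definitions using (tri<; tri≈; tri>)
import Relation.Binary.PropositionalEquality as ≡
open ≡ using (_≡_; _≢_)
open import Relation.Nullary using (¬_; Dec; yes; no; does)
open import Relation.Nullary.Decidable using (_×-dec_)
open import Relation.Unary using (Decidable)

-- Moving an inserted entry past a zero by the exchange relation costs a division by the gap between
-- two nodes. Carrying all these divisions out at once leaves a plain sum over the positions of the
-- entry, with weight one everywhere except at the last position, where the weight is a gap α(c + 1)
-- + 1 + ...; this is why the weights lie in ℕ[α]. The last rotation of all rows uses weights one
-- only, and the leading coefficient is then c_λ without multiplicities.
--
-- Signs disappear at the rightmost maximal entry m because the entries to its left are at most m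
-- and those to its right are smaller: exactly then the divided differences in Ξ have nonnegative
-- coefficients. But the recursion imposes only one relation per exponent. The remaining ones follow
-- from the commutativity of the Y i, which is proved for the explicit operators: it spreads from
-- the zero exponent to all others along swaps and rotations.
--
-- In the functional calculus over K only cancellation is available, no division: proportionality is
-- stated by cross-multiplication, and factors are cancelled because α p + s does not vanish for
-- natural p, s that are not both zero.

module ℕS = Data.Nat.Solver.+-*-Solver

-- Ring solver with integer coefficients

module IntegerSolver (R : CommutativeRing 0ℓ 0ℓ) where
  open CommutativeRing R renaming (Carrier to K)
  open import Algebra.Properties.Ring ring
    using (-‿involutive; -‿distribˡ-*; -‿distribʳ-*; -‿+-comm; -0#≈0#)
  open import Relation.Binary.Reasoning.Setoid setoid

  -- Here `nat 1` is 1# + 0#, not 1# itself; for this reason a 1# in a goal is handed to the solver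
  -- as a variable.
  nat : ℕ → K
  nat zero    = 0#
  nat (suc n) = 1# + nat n

  nat-+ : ∀ m n → nat (m ℕ.+ n) ≈ nat m + nat n
  nat-+ zero    n = sym (+-identityˡ _)
  nat-+ (suc m) n = trans (+-congˡ (nat-+ m n)) (sym (+-assoc _ _ _))

  nat-* : ∀ m n → nat (m ℕ.* n) ≈ nat m * nat n
  nat-* zero    n = sym (zeroˡ _)
  nat-* (suc m) n = begin
    nat (n ℕ.+ m ℕ.* n)        ≈⟨ nat-+ n (m ℕ.* n) ⟩
    nat n + nat (m ℕ.* n)      ≈⟨ +-cong (sym (*-identityˡ _)) (nat-* m n) ⟩
    1# * nat n + nat m * nat n ≈⟨ distribʳ _ _ _ ⟨
    (1# + nat m) * nat n       ∎

  int : ℤ → K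
  int (+ n)    = nat n
  int -[1+ n ] = - nat (suc n)

  int-neg : ∀ i → int (ℤ.- i) ≈ - int i
  int-neg (+ zero)   = sym -0#≈0#
  int-neg (+ suc n)  = refl
  int-neg -[1+ n ]   = sym (-‿involutive _)

  cancel-suc : ∀ a b → (1# + a) + - (1# + b) ≈ a + - b
  cancel-suc a b = begin
    (1# + a) + - (1# + b)     ≈⟨ +-cong (+-comm _ _) (sym (-‿+-comm _ _)) ⟩
    (a + 1#) + (- 1# + - b)   ≈⟨ +-assoc _ _ _ ⟩
    a + (1# + (- 1# + - b))   ≈⟨ +-congˡ (sym (+-assoc _ _ _)) ⟩
    a + ((1# + - 1#) + - b)   ≈⟨ +-congˡ (+-congʳ (-‿inverseʳ _)) ⟩
    a + (0# + - b)            ≈⟨ +-congˡ (+-identityˡ _) ⟩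
    a + - b                   ∎

  int-⊖ : ∀ m n → int (m ℤ.⊖ n) ≈ nat m + - nat n
  int-⊖ zero    zero    = sym (-‿inverseʳ _)
  int-⊖ zero    (suc n) = sym (+-identityˡ _)
  int-⊖ (suc m) zero    = sym (trans (+-congˡ -0#≈0#) (+-identityʳ _))
  int-⊖ (suc m) (suc n) = begin
    int (suc m ℤ.⊖ suc n)   ≡⟨ ≡.cong int (ℤₚ.[1+m]⊖[1+n]≡m⊖n m n) ⟩
    int (m ℤ.⊖ n)           ≈⟨ int-⊖ m n ⟩
    nat m + - nat n         ≈⟨ cancel-suc _ _ ⟨
    nat (suc m) + - nat (suc n) ∎

  int-+ : ∀ i j → int (i ℤ.+ j) ≈ int i + int j
  int-+ (+ m)    (+ n)    = nat-+ m n
  int-+ (+ m)    -[1+ n ] = int-⊖ m (suc n)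
  int-+ -[1+ m ] (+ n)    = trans (int-⊖ n (suc m)) (+-comm _ _)
  int-+ -[1+ m ] -[1+ n ] = begin
    - nat (suc (suc (m ℕ.+ n)))     ≡⟨ ≡.cong (λ k → - nat (suc k)) (ℕₚ.+-suc m n) ⟨
    - nat (suc m ℕ.+ suc n)         ≈⟨ -‿cong (nat-+ (suc m) (suc n)) ⟩
    - (nat (suc m) + nat (suc n))   ≈⟨ -‿+-comm _ _ ⟨
    - nat (suc m) + - nat (suc n)   ∎

  int-*⁺ : ∀ m j → int (+ m ℤ.* j) ≈ nat m * int j
  int-*⁺ m (+ n)    = trans (reflexive (≡.cong int (≡.sym (ℤₚ.pos-* m n)))) (nat-* m n)
  int-*⁺ m -[1+ n ] = begin
    int (+ m ℤ.* -[1+ n ])       ≡⟨ ≡.cong int (ℤₚ.neg-distribʳ-* (+ m) (+ suc n)) ⟨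
    int (ℤ.- (+ m ℤ.* + suc n))  ≈⟨ int-neg (+ m ℤ.* + suc n) ⟩
    - int (+ m ℤ.* + suc n)      ≈⟨ -‿cong (int-*⁺ m (+ suc n)) ⟩
    - (nat m * nat (suc n))      ≈⟨ -‿distribʳ-* _ _ ⟩
    nat m * - nat (suc n)        ∎

  int-* : ∀ i j → int (i ℤ.* j) ≈ int i * int j
  int-* (+ m)    j = int-*⁺ m j
  int-* -[1+ m ] j = begin
    int (-[1+ m ] ℤ.* j)        ≡⟨ ≡.cong int (ℤₚ.neg-distribˡ-* (+ suc m) j) ⟨
    int (ℤ.- (+ suc m ℤ.* j))   ≈⟨ int-neg (+ suc m ℤ.* j) ⟩
    - int (+ suc m ℤ.* j)       ≈⟨ -‿cong (int-*⁺ (suc m) j) ⟩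
    - (nat (suc m) * int j)     ≈⟨ -‿distribˡ-* _ _ ⟩
    - nat (suc m) * int j       ∎

  acr : ACR.AlmostCommutativeRing 0ℓ 0ℓ
  acr = ACR.fromCommutativeRing R

  morphism : ℤ.+-*-rawRing ACR.-Raw-AlmostCommutative⟶ acr
  morphism = record
    { ⟦_⟧    = int
    ; +-homo = int-+
    ; *-homo = int-*
    ; -‿homo = int-neg
    ; 0-homo = refl
    ; 1-homo = +-identityʳ 1#
    }

  -- Equality in K need not be decidable, so coefficients are compared as integers before they are
  -- mapped to K.
  int≟ : (i j : ℤ) → Maybe (int i ≈ int j)
  int≟ i j with i ℤ.≟ j
  ... | yes eq = just (reflexive (≡.cong int eq))
  ... | no _   = nothing

  open RingSolver ℤ.+-*-rawRing acr morphism int≟ public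
    using (solve; _:=_; _:+_; _:*_; _:-_; :-_; con)

-- Domains and their fractions

module _ (P : CommutativeRing 0ℓ 0ℓ) where
  open CommutativeRing P

  NoZeroDivisors : Set
  NoZeroDivisors = ∀ a b → ¬ (a ≈ 0#) → a * b ≈ 0# → b ≈ 0#

  Nontrivial : Set
  Nontrivial = ¬ (1# ≈ 0#)

module Fractions (P : CommutativeRing 0ℓ 0ℓ) (domain : NoZeroDivisors P) (1≉0 : Nontrivial P) where
  open CommutativeRing P renaming (Carrier to C)
  open IntegerSolver P
  open import Relation.Binary.Reasoning.Setoid setoid

  Frac : Set
  Frac = Σ (C × C) (λ f → ¬ (proj₂ f ≈ 0#))

  _≋_ : Frac → Frac → Set
  ((a , b) , _) ≋ ((c , d) , _) = a * d ≈ c * b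

  ≉0-* : ∀ {a b} → ¬ (a ≈ 0#) → ¬ (b ≈ 0#) → ¬ (a * b ≈ 0#)
  ≉0-* na nb h = nb (domain _ _ na h)

  x-y≈0 : ∀ {x y} → x - y ≈ 0# → x ≈ y
  x-y≈0 {x} {y} h = trans (solve 2 (λ x y → x := (x :- y) :+ y) refl x y) (trans (+-congʳ h) (+-identityˡ y))

  ≋-trans : ∀ {x y z} → x ≋ y → y ≋ z → x ≋ z
  ≋-trans {(a , b) , _} {(c , d) , nd} {(e , f) , _} h g = x-y≈0 (domain d _ nd (begin
    d * (a * f - e * b) ≈⟨ solve 5 (λ a b d e f → d :* (a :* f :- e :* b) := f :* (a :* d) :- b :* (e :* d)) refl a b d e f ⟩
    f * (a * d) - b * (e * d) ≈⟨ +-cong (*-congˡ h) (-‿cong (*-congˡ (sym g))) ⟩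
    f * (c * b) - b * (c * f) ≈⟨ solve 3 (λ b c f → f :* (c :* b) :- b :* (c :* f) := con (+ 0)) refl b c f ⟩
    0# ∎))

  -- The formulas on pairs are literally those of the raw arithmetic on `ℚ⟨r⟩`, so that forgetting
  -- the proof of a nonzero denominator commutes with every operation by computation.
  field′ : CommutativeRing 0ℓ 0ℓ
  field′ = record
    { Carrier = Frac ; _≈_ = _≋_
    ; _+_ = λ { ((a , b) , nb) ((c , d) , nd) → (a * d + c * b , b * d) , ≉0-* nb nd }
    ; _*_ = λ { ((a , b) , nb) ((c , d) , nd) → (a * c , b * d) , ≉0-* nb nd }
    ; -_ = λ { ((a , b) , nb) → (- a , b) , nb }
    ; 0# = (0# , 1#) , 1≉0 ; 1# = (1# , 1#) , 1≉0
    ; isCommutativeRing = record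
      { isRing = record
        { +-isAbelianGroup = record
          { isGroup = record
            { isMonoid = record
              { isSemigroup = record
                { isMagma = record
                  { isEquivalence = record { refl = refl ; sym = sym ; trans = λ {x} {y} {z} → ≋-trans {x} {y} {z} }
                  ; ∙-cong = λ { {(a , b) , _} {(a′ , b′) , _} {(c , d) , _} {(c′ , d′) , _} h g → begin
                      (a * d + c * b) * (b′ * d′) ≈⟨ solve 6 (λ a b c d b′ d′ → (a :* d :+ c :* b) :* (b′ :* d′) := a :* b′ :* (d :* d′) :+ c :* d′ :* (b :* b′)) refl a b c d b′ d′ ⟩
                      a * b′ * (d * d′) + c * d′ * (b * b′) ≈⟨ +-cong (*-congʳ h) (*-congʳ g) ⟩
                      a′ * b * (d * d′) + c′ * d * (b * b′) ≈⟨ solve 6 (λ a b c d b′ d′ → a :* b :* (d :* d′) :+ c :* d :* (b :* b′) := (a :* d′ :+ c :* b′) :* (b :* d)) refl a′ b c′ d b′ d′ ⟩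
                      (a′ * d′ + c′ * b′) * (b * d) ∎ } }
                ; assoc = λ { ((a , b) , _) ((c , d) , _) ((e , f) , _) →
                    solve 6 (λ a b c d e f → ((a :* d :+ c :* b) :* f :+ e :* (b :* d)) :* (b :* (d :* f)) := (a :* (d :* f) :+ (c :* f :+ e :* d) :* b) :* (b :* d :* f)) refl a b c d e f } }
              ; identity = (λ { ((a , b) , _) → solve 3 (λ a b o → (con (+ 0) :* b :+ a :* o) :* b := a :* (o :* b)) refl a b 1# })
                         , (λ { ((a , b) , _) → solve 3 (λ a b o → (a :* o :+ con (+ 0) :* b) :* b := a :* (b :* o)) refl a b 1# }) }
            ; inverse = (λ { ((a , b) , _) → solve 3 (λ a b o → (:- a :* b :+ a :* b) :* o := con (+ 0) :* (b :* b)) refl a b 1# })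
                      , (λ { ((a , b) , _) → solve 3 (λ a b o → (a :* b :+ :- a :* b) :* o := con (+ 0) :* (b :* b)) refl a b 1# })
            ; ⁻¹-cong = λ { {(a , b) , _} {(c , d) , _} h → trans (solve 2 (λ a d → :- a :* d := :- (a :* d)) refl a d) (trans (-‿cong h) (solve 2 (λ c b → :- (c :* b) := :- c :* b) refl c b)) } }
          ; comm = λ { ((a , b) , _) ((c , d) , _) → solve 4 (λ a b c d → (a :* d :+ c :* b) :* (d :* b) := (c :* b :+ a :* d) :* (b :* d)) refl a b c d } }
        ; *-cong = λ { {(a , b) , _} {(a′ , b′) , _} {(c , d) , _} {(c′ , d′) , _} h g →
            trans (solve 4 (λ a c b′ d′ → a :* c :* (b′ :* d′) := a :* b′ :* (c :* d′)) refl a c b′ d′) (trans (*-cong h g)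
              (solve 4 (λ a b c d → a :* b :* (c :* d) := a :* c :* (b :* d)) refl a′ b c′ d)) }
        ; *-assoc = λ { ((a , b) , _) ((c , d) , _) ((e , f) , _) → solve 6 (λ a b c d e f → a :* c :* e :* (b :* (d :* f)) := a :* (c :* e) :* (b :* d :* f)) refl a b c d e f }
        ; *-identity = (λ { ((a , b) , _) → solve 3 (λ a b o → o :* a :* b := a :* (o :* b)) refl a b 1# })
                     , (λ { ((a , b) , _) → solve 3 (λ a b o → a :* o :* b := a :* (b :* o)) refl a b 1# })
        ; distrib = (λ { ((a , b) , _) ((c , d) , _) ((e , f) , _) →
              solve 6 (λ a b c d e f → a :* (c :* f :+ e :* d) :* (b :* d :* (b :* f)) := (a :* c :* (b :* f) :+ a :* e :* (b :* d)) :* (b :* (d :* f))) refl a b c d e f })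
                  , (λ { ((a , b) , _) ((c , d) , _) ((e , f) , _) →
              solve 6 (λ a b c d e f → (c :* f :+ e :* d) :* a :* (d :* b :* (f :* b)) := (c :* a :* (f :* b) :+ e :* a :* (d :* b)) :* (d :* f :* b)) refl a b c d e f })
        }
      ; *-comm = λ { ((a , b) , _) ((c , d) , _) → solve 4 (λ a b c d → a :* c :* (d :* b) := c :* a :* (b :* d)) refl a b c d }
      }
    }

  frac-domain : NoZeroDivisors field′
  frac-domain ((a , b) , _) ((c , d) , _) nx h = trans (*-identityʳ c) (trans (domain a c na (trans (sym (*-identityʳ _)) (trans h (zeroˡ _)))) (sym (zeroˡ d)))
    where
    na : ¬ (a ≈ 0#)
    na a≈0 = nx (trans (*-congʳ a≈0) (trans (zeroˡ 1#) (sym (zeroˡ b))))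

-- Bar monomials and multiplication by the variables

module Interpolation (R : CommutativeRing 0ℓ 0ℓ) (α : CommutativeRing.Carrier R) where
  open CommutativeRing R renaming (Carrier to K) hiding (zero)
  open IntegerSolver R
  open import Algebra.Properties.Ring ring using (-0#≈0#)
  open import Relation.Binary.Reasoning.Setoid setoid

  Fun : Set
  Fun = List ℕ → K

  size : List ℕ → ℕ
  size []      = 0
  size (a ∷ l) = a ℕ.+ size l

  inc : ℕ → List ℕ → List ℕ
  inc _       []      = []
  inc zero    (a ∷ l) = suc a ∷ l
  inc (suc i) (a ∷ l) = a ∷ inc i l

  at : ℕ → List ℕ → ℕ
  at _       []      = 0
  at zero    (a ∷ l) = a
  at (suc i) (a ∷ l) = at i l

  put : ℕ → ℕ → List ℕ → List ℕ
  put _       _ []      = []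
  put zero    u (a ∷ l) = u ∷ l
  put (suc i) u (a ∷ l) = a ∷ put i u l

  swap : {A : Set} → ℕ → List A → List A
  swap _       []          = []
  swap zero    (a ∷ [])    = a ∷ []
  swap zero    (a ∷ b ∷ l) = b ∷ a ∷ l
  swap (suc k) (a ∷ l)     = a ∷ swap k l

  -- K⁺ a b f and K⁻ a b f are the signed sums of f u v over the monomials x^u y^v of
  -- (x^(a+1) y^b − x^b y^(a+1)) / (x − y) and x (x^a y^b − x^b y^a) / (x − y).

  T N : ℕ → (ℕ → ℕ → K) → K
  T zero    f = f 0 0
  T (suc a) f = f 0 (suc a) + T a (λ u v → f (suc u) v)
  N zero    f = 0#
  N (suc b) f = N b (λ u v → f u (suc v)) + f (suc b) 0

  K⁺ K⁻ : ℕ → ℕ → (ℕ → ℕ → K) → K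
  K⁺ a zero    f = T a f
  K⁺ a (suc k) f = K⁻ a k (λ u v → f u (suc v))
  K⁻ zero    b f = - N b f
  K⁻ (suc k) b f = K⁺ k b (λ u v → f (suc u) v)

  S : ℕ → List ℕ → (ℕ → Fun) → K
  S a []       φ = 0#
  S a (b ∷ ys) φ = K⁻ a b (λ u v → φ u (v ∷ ys)) + S a ys (λ u l → φ u (b ∷ l))

  -- The Euler operator α y_i ∂_i plus one divided difference for every other position: `K⁻` with
  -- the positions to the right (collected in `S`), `K⁺` with those to the left.
  Ξ : ℕ → List ℕ → Fun → K
  Ξ _       []       φ = 0#
  Ξ zero    (a ∷ ys) φ = α * nat a * φ (a ∷ ys) + S a ys (λ u l → φ (u ∷ l))
  Ξ (suc i) (b ∷ ys) φ =
    Ξ i ys (λ l → φ (b ∷ l)) + K⁺ (at i ys) b (λ u v → φ (v ∷ put i u ys))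

  -- A function φ is read as the linear form with value φ l on the bar monomial of exponent l; then
  -- `Y i φ` is φ after multiplication by y_i.
  Y : ℕ → Fun → Fun
  Y i φ η = φ (inc i η) - Ξ i η φ

  T-cong : ∀ a {f g} → (∀ u v → u ℕ.+ v ≡ a → f u v ≈ g u v) → T a f ≈ T a g
  T-cong zero    h = h 0 0 ≡.refl
  T-cong (suc a) h = +-cong (h 0 (suc a) ≡.refl) (T-cong a (λ u v e → h (suc u) v (≡.cong suc e)))

  N-cong : ∀ b {f g} → (∀ u v → u ℕ.+ v ≡ b → f u v ≈ g u v) → N b f ≈ N b g
  N-cong zero    h = refl
  N-cong (suc b) h = +-cong (N-cong b (λ u v e → h u (suc v) (≡.trans (ℕₚ.+-suc u v) (≡.cong suc e))))
                            (h (suc b) 0 (ℕₚ.+-identityʳ _))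

  K⁺-cong : ∀ a b {f g} → (∀ u v → u ℕ.+ v ≡ a ℕ.+ b → f u v ≈ g u v) → K⁺ a b f ≈ K⁺ a b g
  K⁻-cong : ∀ a b {f g} → (∀ u v → u ℕ.+ v ≡ a ℕ.+ b → f u v ≈ g u v) → K⁻ a b f ≈ K⁻ a b g
  K⁺-cong a zero    h = T-cong a (λ u v e → h u v (≡.trans e (≡.sym (ℕₚ.+-identityʳ a))))
  K⁺-cong a (suc k) h = K⁻-cong a k (λ u v e → h u (suc v)
    (≡.trans (ℕₚ.+-suc u v) (≡.trans (≡.cong suc e) (≡.sym (ℕₚ.+-suc a k)))))
  K⁻-cong zero    b h = -‿cong (N-cong b h)
  K⁻-cong (suc k) b h = K⁺-cong k b (λ u v e → h (suc u) v (≡.cong suc e))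

  K⁺-ext : ∀ a b {f g} → (∀ u v → f u v ≈ g u v) → K⁺ a b f ≈ K⁺ a b g
  K⁺-ext a b h = K⁺-cong a b (λ u v _ → h u v)
  K⁻-ext : ∀ a b {f g} → (∀ u v → f u v ≈ g u v) → K⁻ a b f ≈ K⁻ a b g
  K⁻-ext a b h = K⁻-cong a b (λ u v _ → h u v)

  T-lin : ∀ a c d f g → T a (λ u v → c * f u v + d * g u v) ≈ c * T a f + d * T a g
  T-lin zero    c d f g = refl
  T-lin (suc a) c d f g = trans (+-congˡ (T-lin a c d _ _))
    (solve 6 (λ c d p q x y → (c :* p :+ d :* q) :+ (c :* x :+ d :* y)
                            := c :* (p :+ x) :+ d :* (q :+ y)) refl c d _ _ _ _)

  N-lin : ∀ a c d f g → N a (λ u v → c * f u v + d * g u v) ≈ c * N a f + d * N a g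
  N-lin zero    c d f g = solve 2 (λ c d → con (+ 0) := c :* con (+ 0) :+ d :* con (+ 0)) refl c d
  N-lin (suc a) c d f g = trans (+-congʳ (N-lin a c d _ _))
    (solve 6 (λ c d p q x y → (c :* p :+ d :* q) :+ (c :* x :+ d :* y)
                            := c :* (p :+ x) :+ d :* (q :+ y)) refl c d _ _ _ _)

  K⁺-lin : ∀ a b c d f g → K⁺ a b (λ u v → c * f u v + d * g u v) ≈ c * K⁺ a b f + d * K⁺ a b g
  K⁻-lin : ∀ a b c d f g → K⁻ a b (λ u v → c * f u v + d * g u v) ≈ c * K⁻ a b f + d * K⁻ a b g
  K⁺-lin a zero    c d f g = T-lin a c d f g
  K⁺-lin a (suc k) c d f g = K⁻-lin a k c d _ _
  K⁻-lin zero    b c d f g = trans (-‿cong (N-lin b c d f g))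
    (solve 4 (λ c d x y → :- (c :* x :+ d :* y) := c :* (:- x) :+ d :* (:- y)) refl c d _ _)
  K⁻-lin (suc k) b c d f g = K⁺-lin k b c d _ _

  S-cong : ∀ a ys {φ ψ : ℕ → Fun} →
    (∀ u l → length l ≡ length ys → u ℕ.+ size l ≡ a ℕ.+ size ys → φ u l ≈ ψ u l) →
    S a ys φ ≈ S a ys ψ
  S-cong a []       h = refl
  S-cong a (b ∷ ys) h = +-cong
    (K⁻-cong a b (λ u v e → h u (v ∷ ys) ≡.refl
      (≡.trans (≡.sym (ℕₚ.+-assoc u v _)) (≡.trans (≡.cong (ℕ._+ size ys) e) (ℕₚ.+-assoc a b _)))))
    (S-cong a ys (λ u l e₁ e₂ → h u (b ∷ l) (≡.cong suc e₁)
      (≡.trans (x∙yz≡y∙xz u b (size l)) (≡.trans (≡.cong (b ℕ.+_) e₂) (x∙yz≡y∙xz b a (size ys))))))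
    where open import Algebra.Properties.CommutativeSemigroup ℕₚ.+-commutativeSemigroup
            using () renaming (x∙yz≈y∙xz to x∙yz≡y∙xz)

  S-lin : ∀ a ys c d (φ ψ : ℕ → Fun) →
    S a ys (λ u l → c * φ u l + d * ψ u l) ≈ c * S a ys φ + d * S a ys ψ
  S-lin a []       c d φ ψ = solve 2 (λ c d → con (+ 0) := c :* con (+ 0) :+ d :* con (+ 0)) refl c d
  S-lin a (b ∷ ys) c d φ ψ = trans (+-cong (K⁻-lin a b c d _ _) (S-lin a ys c d _ _))
    (solve 6 (λ c d p q x y → (c :* p :+ d :* q) :+ (c :* x :+ d :* y)
                            := c :* (p :+ x) :+ d :* (q :+ y)) refl c d _ _ _ _)

  length-put : ∀ i u l → length (put i u l) ≡ length l
  length-put i       u []      = ≡.refl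
  length-put zero    u (a ∷ l) = ≡.refl
  length-put (suc i) u (a ∷ l) = ≡.cong suc (length-put i u l)

  size-put : ∀ i u l → i < length l → size (put i u l) ℕ.+ at i l ≡ size l ℕ.+ u
  size-put zero    u (a ∷ l) _       =
    ≡.trans (ℕₚ.+-comm (u ℕ.+ size l) a) (≡.trans (≡.cong (a ℕ.+_) (ℕₚ.+-comm u _)) (≡.sym (ℕₚ.+-assoc a _ u)))
  size-put (suc i) u (a ∷ l) (s≤s h) =
    ≡.trans (ℕₚ.+-assoc a _ _) (≡.trans (≡.cong (a ℕ.+_) (size-put i u l h)) (≡.sym (ℕₚ.+-assoc a _ u)))

  size-move : ∀ i u v b l → i < length l → u ℕ.+ v ≡ at i l ℕ.+ b →
    v ℕ.+ size (put i u l) ≡ b ℕ.+ size l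
  size-move i u v b l h e = ℕₚ.+-cancelʳ-≡ (at i l) _ _
    (≡.trans (ℕₚ.+-assoc v _ _) (≡.trans (≡.cong (v ℕ.+_) (size-put i u l h))
      (≡.trans (ℕS.solve 3 (λ v s u → v ℕS.:+ (s ℕS.:+ u) ℕS.:= (u ℕS.:+ v) ℕS.:+ s) ≡.refl v (size l) u)
        (≡.trans (≡.cong (ℕ._+ size l) e)
          (ℕS.solve 3 (λ x b s → (x ℕS.:+ b) ℕS.:+ s ℕS.:= (b ℕS.:+ s) ℕS.:+ x) ≡.refl (at i l) b (size l))))))

  -- Ξ is homogeneous: it visits only exponents of the same length and size as η. All later
  -- inductions on size rest on this.
  Ξ-cong : ∀ i η {φ ψ} → i < length η →
    (∀ l → length l ≡ length η → size l ≡ size η → φ l ≈ ψ l) → Ξ i η φ ≈ Ξ i η ψ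
  Ξ-cong zero    (a ∷ ys) _ h = +-cong (*-congˡ (h _ ≡.refl ≡.refl))
    (S-cong a ys (λ u l e₁ e₂ → h (u ∷ l) (≡.cong suc e₁) e₂))
  Ξ-cong (suc i) (b ∷ ys) (s≤s p) h = +-cong
    (Ξ-cong i ys p (λ l e₁ e₂ → h (b ∷ l) (≡.cong suc e₁) (≡.cong (b ℕ.+_) e₂)))
    (K⁺-cong (at i ys) b (λ u v e → h (v ∷ put i u ys) (≡.cong suc (length-put i u ys)) (size-move i u v b ys p e)))

  Ξ-ext : ∀ i η {φ ψ : Fun} → (∀ l → φ l ≈ ψ l) → Ξ i η φ ≈ Ξ i η ψ
  Ξ-ext _       []       h = refl
  Ξ-ext zero    (a ∷ ys) h = +-cong (*-congˡ (h _)) (S-cong a ys (λ u l _ _ → h _))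
  Ξ-ext (suc i) (b ∷ ys) h = +-cong (Ξ-ext i ys (λ l → h _)) (K⁺-ext (at i ys) b (λ u v → h _))

  Ξ-lin : ∀ i η c d φ ψ → Ξ i η (λ l → c * φ l + d * ψ l) ≈ c * Ξ i η φ + d * Ξ i η ψ
  Ξ-lin i       []       c d φ ψ = solve 2 (λ c d → con (+ 0) := c :* con (+ 0) :+ d :* con (+ 0)) refl c d
  Ξ-lin zero    (a ∷ ys) c d φ ψ = trans (+-congˡ (S-lin a ys c d _ _))
    (solve 7 (λ e c d p q x y → e :* (c :* p :+ d :* q) :+ (c :* x :+ d :* y)
                            := c :* (e :* p :+ x) :+ d :* (e :* q :+ y)) refl _ c d _ _ _ _)
  Ξ-lin (suc i) (b ∷ ys) c d φ ψ = trans (+-cong (Ξ-lin i ys c d _ _) (K⁺-lin (at i ys) b c d _ _))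
    (solve 6 (λ c d p q x y → (c :* p :+ d :* q) :+ (c :* x :+ d :* y)
                            := c :* (p :+ x) :+ d :* (q :+ y)) refl c d _ _ _ _)

  Y-ext : ∀ i {φ ψ : Fun} → (∀ l → φ l ≈ ψ l) → ∀ η → Y i φ η ≈ Y i ψ η
  Y-ext i h η = +-cong (h _) (-‿cong (Ξ-ext i η h))

  length-inc : ∀ i l → length (inc i l) ≡ length l
  length-inc i       []      = ≡.refl
  length-inc zero    (a ∷ l) = ≡.refl
  length-inc (suc i) (a ∷ l) = ≡.cong suc (length-inc i l)

  size-inc : ∀ i l → i < length l → size (inc i l) ≡ suc (size l)
  size-inc zero    (a ∷ l) _       = ≡.refl
  size-inc (suc i) (a ∷ l) (s≤s p) = ≡.trans (≡.cong (a ℕ.+_) (size-inc i l p)) (ℕₚ.+-suc a _)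

  Y-lin : ∀ i c d φ ψ η → Y i (λ l → c * φ l + d * ψ l) η ≈ c * Y i φ η + d * Y i ψ η
  Y-lin i c d φ ψ η = trans (+-congˡ (-‿cong (Ξ-lin i η c d φ ψ)))
    (solve 6 (λ c d p q x y → (c :* p :+ d :* q) :- (c :* x :+ d :* y)
                            := c :* (p :- x) :+ d :* (q :- y)) refl c d _ _ _ _)

  -- exchange of two adjacent entries

  -- The two numerators differ by x^b y^a (x - y), hence the quotients by one monomial. This
  -- monomial is the source of the constant term in the exchange relations.
  K⁺≈K⁻ : ∀ a b f → K⁺ a b f ≈ K⁻ a b f + f b a
  K⁺≈K⁻ zero    zero    f = solve 1 (λ x → x := (:- con (+ 0)) :+ x) refl _
  K⁺≈K⁻ (suc a) zero    f = +-comm _ _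
  K⁺≈K⁻ zero    (suc b) f = solve 2 (λ x y → :- x := :- (x :+ y) :+ y) refl _ _
  K⁺≈K⁻ (suc a) (suc b) f = K⁺≈K⁻ a b (λ u v → f (suc u) (suc v))

  S-swap : ∀ k a ys φ → S a ys (λ u l → φ u (swap k l)) ≈ S a (swap k ys) φ
  S-swap k       a []           φ = refl
  S-swap zero    a (b ∷ [])     φ = refl
  S-swap zero    a (b ∷ c ∷ ys) φ = solve 3 (λ x y z → x :+ (y :+ z) := y :+ (x :+ z)) refl _ _ _
  S-swap (suc k) a (b ∷ ys)     φ = +-cong refl (S-swap k a ys (λ u l → φ u (b ∷ l)))

  at-swap : ∀ i k l → i ≢ k → i ≢ suc k → at i (swap k l) ≡ at i l
  at-swap i             k       []          _ _ = ≡.refl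
  at-swap i             zero    (a ∷ [])    _ _ = ≡.refl
  at-swap zero          zero    (a ∷ b ∷ l) p q = ⊥-elim (p ≡.refl)
  at-swap (suc zero)    zero    (a ∷ b ∷ l) p q = ⊥-elim (q ≡.refl)
  at-swap (suc (suc i)) zero    (a ∷ b ∷ l) p q = ≡.refl
  at-swap zero          (suc k) (a ∷ l)     p q = ≡.refl
  at-swap (suc i)       (suc k) (a ∷ l)     p q = at-swap i k l (λ e → p (≡.cong suc e)) (λ e → q (≡.cong suc e))

  put-swap : ∀ i k u l → i ≢ k → i ≢ suc k → put i u (swap k l) ≡ swap k (put i u l)
  put-swap i             k       u []          _ _ = ≡.refl
  put-swap zero          zero    u (a ∷ [])    p q = ≡.refl
  put-swap (suc i)       zero    u (a ∷ [])    p q = ≡.refl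
  put-swap zero          zero    u (a ∷ b ∷ l) p q = ⊥-elim (p ≡.refl)
  put-swap (suc zero)    zero    u (a ∷ b ∷ l) p q = ⊥-elim (q ≡.refl)
  put-swap (suc (suc i)) zero    u (a ∷ b ∷ l) p q = ≡.refl
  put-swap zero          (suc k) u (a ∷ l)     p q = ≡.refl
  put-swap (suc i)       (suc k) u (a ∷ l)     p q = ≡.cong (a ∷_) (put-swap i k u l (λ e → p (≡.cong suc e)) (λ e → q (≡.cong suc e)))

  inc-swap : ∀ i k l → i ≢ k → i ≢ suc k → swap k (inc i l) ≡ inc i (swap k l)
  inc-swap i             k       []          _ _ = ≡.refl
  inc-swap zero          zero    (a ∷ [])    p q = ≡.refl
  inc-swap (suc i)       zero    (a ∷ [])    p q = ≡.refl
  inc-swap zero          zero    (a ∷ b ∷ l) p q = ⊥-elim (p ≡.refl)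
  inc-swap (suc zero)    zero    (a ∷ b ∷ l) p q = ⊥-elim (q ≡.refl)
  inc-swap (suc (suc i)) zero    (a ∷ b ∷ l) p q = ≡.refl
  inc-swap zero          (suc k) (a ∷ l)     p q = ≡.refl
  inc-swap (suc i)       (suc k) (a ∷ l)     p q = ≡.cong (a ∷_) (inc-swap i k l (λ e → p (≡.cong suc e)) (λ e → q (≡.cong suc e)))

  inc-swapˡ : ∀ k l → suc k < length l → swap k (inc k l) ≡ inc (suc k) (swap k l)
  inc-swapˡ zero    (a ∷ b ∷ l) _       = ≡.refl
  inc-swapˡ (suc k) (a ∷ l)     (s≤s p) = ≡.cong (a ∷_) (inc-swapˡ k l p)
  inc-swapˡ zero    (a ∷ [])    (s≤s ())

  Ξ-swap : ∀ i k η φ → i ≢ k → i ≢ suc k → Ξ i η (λ l → φ (swap k l)) ≈ Ξ i (swap k η) φ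
  Ξ-swap i             k       []           φ p q = refl
  Ξ-swap zero          zero    (a ∷ [])     φ p q = refl
  Ξ-swap (suc i)       zero    (a ∷ [])     φ p q = +-congˡ (K⁺-ext 0 a (λ u v → refl))
  Ξ-swap zero          zero    (a ∷ b ∷ ys) φ p q = ⊥-elim (p ≡.refl)
  Ξ-swap (suc zero)    zero    (a ∷ b ∷ ys) φ p q = ⊥-elim (q ≡.refl)
  Ξ-swap (suc (suc i)) zero    (a ∷ b ∷ ys) φ p q =
    solve 3 (λ x y z → x :+ y :+ z := x :+ z :+ y) refl _ _ _
  Ξ-swap zero          (suc k) (a ∷ ys)     φ p q = +-cong refl (S-swap k a ys (λ u l → φ (u ∷ l)))
  Ξ-swap (suc i)       (suc k) (b ∷ ys)     φ p q = +-cong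
    (Ξ-swap i k ys (λ l → φ (b ∷ l)) p′ q′)
    (trans (K⁺-ext (at i ys) b (λ u v → reflexive (≡.cong (λ l → φ (v ∷ l)) (≡.sym (put-swap i k u ys p′ q′)))))
           (reflexive (≡.cong (λ a → K⁺ a b (λ u v → φ (v ∷ put i u (swap k ys)))) (≡.sym (at-swap i k ys p′ q′)))))
    where p′ = λ e → p (≡.cong suc e)
          q′ = λ e → q (≡.cong suc e)

  Y-swap : ∀ i k η φ → i ≢ k → i ≢ suc k → Y i (λ l → φ (swap k l)) η ≈ Y i φ (swap k η)
  Y-swap i k η φ p q = +-cong (reflexive (≡.cong φ (inc-swap i k η p q))) (-‿cong (Ξ-swap i k η φ p q))

  at-swapʳ : ∀ k l → suc k < length l → at (suc k) (swap k l) ≡ at k l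
  at-swapʳ zero    (a ∷ b ∷ l) _       = ≡.refl
  at-swapʳ (suc k) (a ∷ l)     (s≤s p) = at-swapʳ k l p
  at-swapʳ zero    (a ∷ [])    (s≤s ())

  put-swapʳ : ∀ k u l → suc k < length l → put (suc k) u (swap k l) ≡ swap k (put k u l)
  put-swapʳ zero    u (a ∷ b ∷ l) _       = ≡.refl
  put-swapʳ (suc k) u (a ∷ l)     (s≤s p) = ≡.cong (a ∷_) (put-swapʳ k u l p)
  put-swapʳ zero    u (a ∷ [])    (s≤s ())

  Ξ-swapˡ : ∀ k η φ → suc k < length η →
    Ξ k η (λ l → φ (swap k l)) ≈ Ξ (suc k) (swap k η) φ - φ η
  Ξ-swapˡ zero (a ∷ []) φ (s≤s ())
  Ξ-swapˡ zero (a ∷ b ∷ ys) φ _ = begin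
    α * nat a * φ (b ∷ a ∷ ys) + (K⁻ a b f + s)
      ≈⟨ solve 4 (λ x k s y → x :+ (k :+ s) := x :+ s :+ (k :+ y) :- y) refl _ _ _ _ ⟩
    α * nat a * φ (b ∷ a ∷ ys) + s + (K⁻ a b f + φ (a ∷ b ∷ ys)) - φ (a ∷ b ∷ ys)
      ≈⟨ +-congʳ (+-congˡ (sym (K⁺≈K⁻ a b f))) ⟩
    α * nat a * φ (b ∷ a ∷ ys) + s + K⁺ a b f - φ (a ∷ b ∷ ys) ∎
    where f = λ u v → φ (v ∷ u ∷ ys)
          s = S a ys (λ u l → φ (b ∷ u ∷ l))
  Ξ-swapˡ (suc k) (b ∷ ys) φ (s≤s p) = begin
    Ξ k ys (λ l → φ (b ∷ swap k l)) + K⁺ (at k ys) b (λ u v → φ (v ∷ swap k (put k u ys)))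
      ≈⟨ +-cong (Ξ-swapˡ k ys (λ l → φ (b ∷ l)) p)
          (trans (K⁺-ext (at k ys) b (λ u v → reflexive (≡.cong (λ l → φ (v ∷ l)) (≡.sym (put-swapʳ k u ys p)))))
                 (reflexive (≡.cong (λ a → K⁺ a b (λ u v → φ (v ∷ put (suc k) u (swap k ys)))) (≡.sym (at-swapʳ k ys p))))) ⟩
    (x - φ (b ∷ ys)) + y ≈⟨ solve 3 (λ x y z → (x :- z) :+ y := x :+ y :- z) refl x y _ ⟩
    x + y - φ (b ∷ ys) ∎
    where x = Ξ (suc k) (swap k ys) (λ l → φ (b ∷ l))
          y = K⁺ (at (suc k) (swap k ys)) b (λ u v → φ (v ∷ put (suc k) u (swap k ys)))

  -- A relation of the degenerate affine Hecke algebra. Under the swap the neighbour passes from the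
  -- right of the distinguished entry to its left, so its contribution turns from `K⁻` into `K⁺`,
  -- which leaves the extra φ η.
  Y-swapˡ : ∀ k η φ → suc k < length η →
    Y k (λ l → φ (swap k l)) η ≈ Y (suc k) φ (swap k η) + φ η
  Y-swapˡ k η φ p = trans
    (+-cong (reflexive (≡.cong φ (inc-swapˡ k η p))) (-‿cong (Ξ-swapˡ k η φ p)))
    (solve 3 (λ x y z → x :- (y :- z) := x :- y :+ z) refl _ _ _)

  swap-invol : {A : Set} (k : ℕ) (l : List A) → swap k (swap k l) ≡ l
  swap-invol k       []          = ≡.refl
  swap-invol zero    (a ∷ [])    = ≡.refl
  swap-invol zero    (a ∷ b ∷ l) = ≡.refl
  swap-invol (suc k) (a ∷ l)     = ≡.cong (a ∷_) (swap-invol k l)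

  length-swap : {A : Set} (k : ℕ) (l : List A) → length (swap k l) ≡ length l
  length-swap k       []          = ≡.refl
  length-swap zero    (a ∷ [])    = ≡.refl
  length-swap zero    (a ∷ b ∷ l) = ≡.refl
  length-swap (suc k) (a ∷ l)     = ≡.cong suc (length-swap k l)

  size-swap : ∀ k l → size (swap k l) ≡ size l
  size-swap k       []          = ≡.refl
  size-swap zero    (a ∷ [])    = ≡.refl
  size-swap zero    (a ∷ b ∷ l) = ≡.trans (≡.sym (ℕₚ.+-assoc b a _))
    (≡.trans (≡.cong (ℕ._+ size l) (ℕₚ.+-comm b a)) (ℕₚ.+-assoc a b _))
  size-swap (suc k) (a ∷ l)     = ≡.cong (a ℕ.+_) (size-swap k l)

  Y-swapʳ : ∀ k η φ → suc k < length η →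
    Y (suc k) (λ l → φ (swap k l)) η ≈ Y k φ (swap k η) - φ (swap k (swap k η))
  Y-swapʳ k η φ p = begin
    Y (suc k) ψ η                           ≡⟨ ≡.cong (Y (suc k) ψ) (swap-invol k η) ⟨
    Y (suc k) ψ (swap k (swap k η))         ≈⟨ solve 2 (λ x y → x := x :+ y :- y) refl _ (ψ (swap k η)) ⟩
    Y (suc k) ψ (swap k (swap k η)) + ψ (swap k η) - ψ (swap k η)
      ≈⟨ +-congʳ (Y-swapˡ k (swap k η) ψ (≡.subst (suc k <_) (≡.sym (length-swap k η)) p)) ⟨
    Y k (λ l → ψ (swap k l)) (swap k η) - ψ (swap k η)
      ≈⟨ +-congʳ (Y-ext k (λ l → reflexive (≡.cong φ (swap-invol k l))) (swap k η)) ⟩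
    Y k φ (swap k η) - ψ (swap k η) ∎
    where ψ = λ l → φ (swap k l)

  -- cyclic rotation

  S-∷ʳ : ∀ a ys k φ → S a (ys ++ k ∷ []) φ ≈
    S a ys (λ u l → φ u (l ++ k ∷ [])) + K⁻ a k (λ u v → φ u (ys ++ v ∷ []))
  S-∷ʳ a []       k φ = +-comm _ _
  S-∷ʳ a (b ∷ ys) k φ = trans (+-congˡ (S-∷ʳ a ys k (λ u l → φ u (b ∷ l)))) (sym (+-assoc _ _ _))

  at-∷ʳ : ∀ j t k → j < length t → at j (t ++ k ∷ []) ≡ at j t
  at-∷ʳ zero    (a ∷ t) k _       = ≡.refl
  at-∷ʳ (suc j) (a ∷ t) k (s≤s p) = at-∷ʳ j t k p

  put-∷ʳ : ∀ j u t k → j < length t → put j u (t ++ k ∷ []) ≡ put j u t ++ k ∷ []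
  put-∷ʳ zero    u (a ∷ t) k _       = ≡.refl
  put-∷ʳ (suc j) u (a ∷ t) k (s≤s p) = ≡.cong (a ∷_) (put-∷ʳ j u t k p)

  inc-∷ʳ : ∀ j t k → j < length t → inc j (t ++ k ∷ []) ≡ inc j t ++ k ∷ []
  inc-∷ʳ zero    (a ∷ t) k _       = ≡.refl
  inc-∷ʳ (suc j) (a ∷ t) k (s≤s p) = ≡.cong (a ∷_) (inc-∷ʳ j t k p)

  Ξ-∷ʳ : ∀ j t k φ → j < length t → Ξ j (t ++ k ∷ []) φ ≈
    Ξ j t (λ l → φ (l ++ k ∷ [])) + K⁻ (at j t) k (λ u v → φ (put j u t ++ v ∷ []))
  Ξ-∷ʳ zero    (a ∷ t) k φ _       = trans (+-congˡ (S-∷ʳ a t k _)) (sym (+-assoc _ _ _))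
  Ξ-∷ʳ (suc j) (b ∷ t) k φ (s≤s p) = begin
    Ξ j (t ++ k ∷ []) (λ l → φ (b ∷ l)) + K⁺ (at j (t ++ k ∷ [])) b (λ u v → φ (v ∷ put j u (t ++ k ∷ [])))
      ≈⟨ +-cong (Ξ-∷ʳ j t k _ p)
         (trans (reflexive (≡.cong (λ a → K⁺ a b (λ u v → φ (v ∷ put j u (t ++ k ∷ [])))) (at-∷ʳ j t k p)))
                (K⁺-ext (at j t) b (λ u v → reflexive (≡.cong (λ l → φ (v ∷ l)) (put-∷ʳ j u t k p))))) ⟩
    x + y + z ≈⟨ solve 3 (λ x y z → x :+ y :+ z := x :+ z :+ y) refl x y z ⟩
    x + z + y ∎
    where x = Ξ j t (λ l → φ (b ∷ l ++ k ∷ []))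
          y = K⁻ (at j t) k (λ u v → φ (b ∷ put j u t ++ v ∷ []))
          z = K⁺ (at j t) b (λ u v → φ (v ∷ put j u t ++ k ∷ []))

  at-last : ∀ t k → at (length t) (t ++ k ∷ []) ≡ k
  at-last []      k = ≡.refl
  at-last (a ∷ t) k = at-last t k

  put-last : ∀ u t k → put (length t) u (t ++ k ∷ []) ≡ t ++ u ∷ []
  put-last u []      k = ≡.refl
  put-last u (a ∷ t) k = ≡.cong (a ∷_) (put-last u t k)

  inc-last : ∀ t k → inc (length t) (t ++ k ∷ []) ≡ t ++ suc k ∷ []
  inc-last []      k = ≡.refl
  inc-last (a ∷ t) k = ≡.cong (a ∷_) (inc-last t k)

  -- A relation, not composition with `rot`, so that it also applies to pairs such as `Y (suc j) φ`
  -- and `Y j φ′`, which match only on lists of the right length.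
  Rotated : ℕ → Fun → Fun → Set
  Rotated n φ φ′ = ∀ t k → length t ≡ n → φ′ (t ++ k ∷ []) ≈ φ (suc k ∷ t)

  -- For the last entry k every other entry b lies on the left and contributes `K⁺ k b`. After the
  -- rotation it lies to the right of a first entry suc k and contributes `K⁻ (suc k) b`, which is
  -- the same sum by definition.
  Ξ-last : ∀ t k (φ φ′ : Fun) → Rotated (length t) φ φ′ →
    Ξ (length t) (t ++ k ∷ []) φ′ ≈ α * nat k * φ (suc k ∷ t) + S (suc k) t (λ u l → φ (u ∷ l))
  Ξ-last []      k φ φ′ h = +-congʳ (*-congˡ (h [] k ≡.refl))
  Ξ-last (b ∷ t) k φ φ′ h = begin
    Ξ (length t) (t ++ k ∷ []) (λ l → φ′ (b ∷ l))
      + K⁺ (at (length t) (t ++ k ∷ [])) b (λ u v → φ′ (v ∷ put (length t) u (t ++ k ∷ [])))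
      ≈⟨ +-cong (Ξ-last t k (λ { [] → φ [] ; (x ∷ l) → φ (x ∷ b ∷ l) }) (λ l → φ′ (b ∷ l)) (λ t k e → h (b ∷ t) k (≡.cong suc e)))
          (trans (reflexive (≡.cong (λ a → K⁺ a b (λ u v → φ′ (v ∷ put (length t) u (t ++ k ∷ [])))) (at-last t k)))
            (K⁺-ext k b (λ u v → trans (reflexive (≡.cong (λ l → φ′ (v ∷ l)) (put-last u t k))) (h (v ∷ t) u ≡.refl)))) ⟩
    x + y + z ≈⟨ solve 3 (λ x y z → x :+ y :+ z := x :+ (z :+ y)) refl x y z ⟩
    x + (z + y) ∎
    where x = α * nat k * φ (suc k ∷ b ∷ t)
          y = S (suc k) t (λ u l → φ (u ∷ b ∷ l))
          z = K⁺ k b (λ u v → φ (suc u ∷ v ∷ t))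

  Y-rot : ∀ j t k (φ φ′ : Fun) → Rotated (length t) φ φ′ → j < length t →
    Y (suc j) φ (suc k ∷ t) ≈ Y j φ′ (t ++ k ∷ [])
  Y-rot j t k φ φ′ h p = sym (+-cong
    (trans (reflexive (≡.cong φ′ (inc-∷ʳ j t k p))) (h _ _ (length-inc j t)))
    (-‿cong (trans (Ξ-∷ʳ j t k φ′ p)
      (+-cong (Ξ-cong j t p (λ l e _ → h l k e)) (K⁻-ext (at j t) k (λ u v → h _ _ (length-put j u t)))))))

  -- The Euler term of the first entry suc k exceeds that of the last entry k by α; everything else
  -- matches by `Ξ-last`.
  Y-rot₀ : ∀ t k (φ φ′ : Fun) → Rotated (length t) φ φ′ →
    Y 0 φ (suc k ∷ t) ≈ Y (length t) φ′ (t ++ k ∷ []) - α * φ (suc k ∷ t)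
  Y-rot₀ t k φ φ′ h = begin
    φ (suc (suc k) ∷ t) - (α * (1# + nat k) * c + s)
      ≈⟨ solve 6 (λ o x a n c s → x :- (a :* (o :+ n) :* c :+ s) := x :- (a :* n :* c :+ s) :- a :* (o :* c)) refl 1# _ α (nat k) c s ⟩
    φ (suc (suc k) ∷ t) - (α * nat k * c + s) - α * (1# * c)
      ≈⟨ +-cong (+-cong (trans (sym (h t (suc k) ≡.refl)) (reflexive (≡.cong φ′ (≡.sym (inc-last t k)))))
                        (-‿cong (sym (Ξ-last t k φ φ′ h))))
                (-‿cong (*-congˡ (*-identityˡ c))) ⟩
    Y (length t) φ′ (t ++ k ∷ []) - α * c ∎
    where c = φ (suc k ∷ t)
          s = S (suc k) t (λ u l → φ (u ∷ l))

  Y-cong : ∀ i η {φ ψ : Fun} → i < length η → (∀ l → length l ≡ length η → φ l ≈ ψ l) → Y i φ η ≈ Y i ψ η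
  Y-cong i η p h = +-cong (h _ (length-inc i η)) (-‿cong (Ξ-cong i η p (λ l e _ → h l e)))

  Y-+ : ∀ i φ ψ η → Y i (λ l → φ l + ψ l) η ≈ Y i φ η + Y i ψ η
  Y-+ i φ ψ η = begin
    Y i (λ l → φ l + ψ l) η           ≈⟨ Y-ext i (λ l → +-cong (sym (*-identityˡ _)) (sym (*-identityˡ _))) η ⟩
    Y i (λ l → 1# * φ l + 1# * ψ l) η ≈⟨ Y-lin i 1# 1# φ ψ η ⟩
    1# * Y i φ η + 1# * Y i ψ η       ≈⟨ +-cong (*-identityˡ _) (*-identityˡ _) ⟩
    Y i φ η + Y i ψ η                 ∎

  Y-minus : ∀ i φ ψ η → Y i (λ l → φ l - ψ l) η ≈ Y i φ η - Y i ψ η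
  Y-minus i φ ψ η = begin
    Y i (λ l → φ l - ψ l) η             ≈⟨ Y-ext i (λ l → +-cong (sym (*-identityˡ _)) (neg _)) η ⟩
    Y i (λ l → 1# * φ l + - 1# * ψ l) η ≈⟨ Y-lin i 1# (- 1#) φ ψ η ⟩
    1# * Y i φ η + - 1# * Y i ψ η       ≈⟨ +-cong (*-identityˡ _) (sym (neg _)) ⟩
    Y i φ η - Y i ψ η                   ∎
    where neg : ∀ x → - x ≈ - 1# * x
          neg x = trans (-‿cong (sym (*-identityˡ x))) (solve 2 (λ o x → :- (o :* x) := :- o :* x) refl 1# x)

  Ξ-* : ∀ i η c φ → Ξ i η (λ l → c * φ l) ≈ c * Ξ i η φ
  Ξ-* i η c φ = begin
    Ξ i η (λ l → c * φ l)            ≈⟨ Ξ-ext i η (λ l → solve 2 (λ c x → c :* x := c :* x :+ con (+ 0) :* x) refl c (φ l)) ⟩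
    Ξ i η (λ l → c * φ l + 0# * φ l) ≈⟨ Ξ-lin i η c 0# φ φ ⟩
    c * Ξ i η φ + 0# * Ξ i η φ       ≈⟨ solve 2 (λ c x → c :* x :+ con (+ 0) :* x := c :* x) refl c _ ⟩
    c * Ξ i η φ                      ∎

  Y-* : ∀ i c φ η → Y i (λ l → c * φ l) η ≈ c * Y i φ η
  Y-* i c φ η = trans (+-congˡ (-‿cong (Ξ-* i η c φ))) (solve 3 (λ c x y → c :* x :- c :* y := c :* (x :- y)) refl c _ _)

  rot : List ℕ → List ℕ
  rot []          = []
  rot (x ∷ [])    = suc x ∷ []
  rot (x ∷ y ∷ l) = swap 0 (x ∷ rot (y ∷ l))

  rot-∷ʳ : ∀ t k → rot (t ++ k ∷ []) ≡ suc k ∷ t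
  rot-∷ʳ []          k = ≡.refl
  rot-∷ʳ (a ∷ [])    k = ≡.refl
  rot-∷ʳ (a ∷ b ∷ t) k = ≡.cong (λ l → swap 0 (a ∷ l)) (rot-∷ʳ (b ∷ t) k)

  rotated : ∀ n φ → Rotated n φ (λ v → φ (rot v))
  rotated n φ t k _ = reflexive (≡.cong φ (rot-∷ʳ t k))

  -- commutativity of the operators Y

  Comm : ℕ → ℕ → List ℕ → Set
  Comm i j η = ∀ φ → Y i (Y j φ) η ≈ Y j (Y i φ) η

  Comm-sym : ∀ {i j η} → Comm i j η → Comm j i η
  Comm-sym c φ = sym (c φ)

  module _ (k : ℕ) where
    private
      s = swap {A = ℕ} k

    Y-at-swapˡ : ∀ η χ → suc k < length η → Y k χ (s η) ≈ Y (suc k) (λ l → χ (s l)) η + χ η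
    Y-at-swapˡ η χ p = sym (trans (+-cong (Y-swapʳ k η χ p) (reflexive (≡.cong χ (≡.sym (swap-invol k η)))))
      (solve 2 (λ x y → x :- y :+ y := x) refl _ _))

    Y-at-swapʳ : ∀ η χ → suc k < length η → Y (suc k) χ (s η) ≈ Y k (λ l → χ (s l)) η - χ η
    Y-at-swapʳ η χ p = sym (trans (+-congʳ (Y-swapˡ k η χ p)) (solve 2 (λ x y → x :+ y :- y := x) refl _ _))

    module _ (η : List ℕ) (p : suc k < length η) where
      private
        p′ : k < length η
        p′ = ℕₚ.<-trans (ℕₚ.n<1+n k) p
        at-len : (l : List ℕ) → length l ≡ length η → suc k < length l
        at-len l e = ≡.subst (suc k <_) (≡.sym e) p

      comm-swap-other : ∀ {i j} → i < length η → j < length η → i ≢ k → i ≢ suc k → j ≢ k → j ≢ suc k →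
        Comm i j η → Comm i j (s η)
      comm-swap-other {i} {j} _ _ i≢k i≢k′ j≢k j≢k′ c φ = begin
        Y i (Y j φ) (s η)             ≈⟨ Y-swap i k η (Y j φ) i≢k i≢k′ ⟨
        Y i (λ l → Y j φ (s l)) η     ≈⟨ Y-ext i (λ l → sym (Y-swap j k l φ j≢k j≢k′)) η ⟩
        Y i (Y j (λ l → φ (s l))) η   ≈⟨ c (λ l → φ (s l)) ⟩
        Y j (Y i (λ l → φ (s l))) η   ≈⟨ Y-ext j (λ l → Y-swap i k l φ i≢k i≢k′) η ⟩
        Y j (λ l → Y i φ (s l)) η     ≈⟨ Y-swap j k η (Y i φ) j≢k j≢k′ ⟩
        Y j (Y i φ) (s η)             ∎

      comm-swapˡ : ∀ {j} → j < length η → j ≢ k → j ≢ suc k → Comm (suc k) j η → Comm k j (s η)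
      comm-swapˡ {j} q j≢k j≢k′ c φ = begin
        Y k (Y j φ) (s η)                               ≈⟨ Y-at-swapˡ η (Y j φ) p ⟩
        Y (suc k) (λ l → Y j φ (s l)) η + Y j φ η       ≈⟨ +-congʳ (Y-ext (suc k) (λ l → sym (Y-swap j k l φ j≢k j≢k′)) η) ⟩
        Y (suc k) (Y j (λ l → φ (s l))) η + Y j φ η     ≈⟨ +-congʳ (c (λ l → φ (s l))) ⟩
        Y j (Y (suc k) (λ l → φ (s l))) η + Y j φ η     ≈⟨ Y-+ j (Y (suc k) (λ l → φ (s l))) φ η ⟨
        Y j (λ l → Y (suc k) (λ l → φ (s l)) l + φ l) η ≈⟨ Y-cong j η q (λ l e → sym (Y-at-swapˡ l φ (at-len l e))) ⟩
        Y j (λ l → Y k φ (s l)) η                       ≈⟨ Y-swap j k η (Y k φ) j≢k j≢k′ ⟩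
        Y j (Y k φ) (s η)                               ∎

      comm-swapʳ : ∀ {j} → j < length η → j ≢ k → j ≢ suc k → Comm k j η → Comm (suc k) j (s η)
      comm-swapʳ {j} q j≢k j≢k′ c φ = begin
        Y (suc k) (Y j φ) (s η)                   ≈⟨ Y-at-swapʳ η (Y j φ) p ⟩
        Y k (λ l → Y j φ (s l)) η - Y j φ η       ≈⟨ +-congʳ (Y-ext k (λ l → sym (Y-swap j k l φ j≢k j≢k′)) η) ⟩
        Y k (Y j (λ l → φ (s l))) η - Y j φ η     ≈⟨ +-congʳ (c (λ l → φ (s l))) ⟩
        Y j (Y k (λ l → φ (s l))) η - Y j φ η     ≈⟨ Y-minus j (Y k (λ l → φ (s l))) φ η ⟨
        Y j (λ l → Y k (λ l → φ (s l)) l - φ l) η ≈⟨ Y-cong j η q (λ l e → sym (Y-at-swapʳ l φ (at-len l e))) ⟩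
        Y j (λ l → Y (suc k) φ (s l)) η           ≈⟨ Y-swap j k η (Y (suc k) φ) j≢k j≢k′ ⟩
        Y j (Y (suc k) φ) (s η)                   ∎

      -- The exchange relations produce two corrections, +φ and -φ, and these cancel once both
      -- operators have been moved across the swap.
      comm-swap-both : Comm k (suc k) η → Comm k (suc k) (s η)
      comm-swap-both c φ = begin
        Y k (Y (suc k) φ) (s η)                                 ≈⟨ Y-at-swapˡ η (Y (suc k) φ) p ⟩
        Y (suc k) (λ l → Y (suc k) φ (s l)) η + Y (suc k) φ η   ≈⟨ +-congʳ (Y-cong (suc k) η p (λ l e → Y-at-swapʳ l φ (at-len l e))) ⟩
        Y (suc k) (λ l → Y k ψ l - φ l) η + Y (suc k) φ η       ≈⟨ +-congʳ (Y-minus (suc k) (Y k ψ) φ η) ⟩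
        Y (suc k) (Y k ψ) η - Y (suc k) φ η + Y (suc k) φ η     ≈⟨ solve 2 (λ x y → x :- y :+ y := x) refl _ _ ⟩
        Y (suc k) (Y k ψ) η                                     ≈⟨ c ψ ⟨
        Y k (Y (suc k) ψ) η                                     ≈⟨ solve 2 (λ x y → x :+ y :- y := x) refl _ _ ⟨
        Y k (Y (suc k) ψ) η + Y k φ η - Y k φ η                 ≈⟨ +-congʳ (Y-+ k (Y (suc k) ψ) φ η) ⟨
        Y k (λ l → Y (suc k) ψ l + φ l) η - Y k φ η             ≈⟨ +-congʳ (Y-cong k η p′ (λ l e → sym (Y-at-swapˡ l φ (at-len l e)))) ⟩
        Y k (λ l → Y k φ (s l)) η - Y k φ η                     ≈⟨ Y-at-swapʳ η (Y k φ) p ⟨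
        Y (suc k) (Y k φ) (s η)                                 ∎
        where ψ = λ l → φ (s l)

  zeros : ℕ → List ℕ
  zeros n = replicate n 0

  swap-zeros : ∀ k n → swap k (zeros n) ≡ zeros n
  swap-zeros k       zero          = ≡.refl
  swap-zeros zero    (suc zero)    = ≡.refl
  swap-zeros zero    (suc (suc n)) = ≡.refl
  swap-zeros (suc k) (suc n)       = ≡.cong (0 ∷_) (swap-zeros k n)

  S-zeros : ∀ n φ → S 0 (zeros n) φ ≈ 0#
  S-zeros zero    φ = refl
  S-zeros (suc n) φ = trans (+-cong -0#≈0# (S-zeros n (λ u l → φ u (0 ∷ l)))) (+-identityʳ 0#)

  Ξ-zeros : ∀ n χ → Ξ 0 (zeros (suc n)) χ ≈ 0#
  Ξ-zeros n χ = trans (+-cong (trans (*-congʳ (zeroʳ α)) (zeroˡ _)) (S-zeros n _)) (+-identityʳ 0#)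

  -- Direct expansion: on both sides only φ (1 ∷ 1 ∷ z) remains, the two occurrences of φ (1 ∷ 0 ∷
  -- z) on the right having opposite signs.
  comm-zeros₀₁ : ∀ n → Comm 0 1 (zeros (suc (suc n)))
  comm-zeros₀₁ n φ = begin
    Y 1 φ (1 ∷ 0 ∷ z) - Ξ 0 (0 ∷ 0 ∷ z) (Y 1 φ)
      ≈⟨ +-cong (+-congˡ (-‿cong (+-congʳ (Ξ-zeros n (λ l → φ (1 ∷ l)))))) (-‿cong (Ξ-zeros (suc n) (Y 1 φ))) ⟩
    (φ (1 ∷ 1 ∷ z) - (0# + - 0#)) - 0#
      ≈⟨ solve 3 (λ x y a → (x :- (con (+ 0) :+ :- con (+ 0))) :- con (+ 0)
           := (x :- (a :* con (+ 0) :* y :+ (:- (con (+ 0) :+ y) :+ con (+ 0)))) :- (con (+ 0) :+ (y :- con (+ 0)))) refl _ (φ (1 ∷ 0 ∷ z)) α ⟩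
    (φ (1 ∷ 1 ∷ z) - (α * 0# * φ (1 ∷ 0 ∷ z) + (- (0# + φ (1 ∷ 0 ∷ z)) + 0#))) - (0# + (φ (1 ∷ 0 ∷ z) - 0#))
      ≈⟨ +-cong (+-congˡ (-‿cong (+-cong (trans (*-congʳ (zeroʳ α)) (trans (zeroˡ _) (sym (trans (*-congʳ (zeroʳ α)) (zeroˡ _))))) (+-congˡ (sym (S-zeros n (λ u l → φ (u ∷ 1 ∷ l))))))))
                (-‿cong (+-cong (sym (Ξ-zeros n (λ l → Y 0 φ (0 ∷ l)))) (+-congˡ (-‿cong (sym (Ξ-zeros (suc n) φ)))))) ⟩
    Y 0 φ (0 ∷ 1 ∷ z) - (Ξ 0 (0 ∷ z) (λ l → Y 0 φ (0 ∷ l)) + Y 0 φ (0 ∷ 0 ∷ z)) ∎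
    where z = zeros n

  -- Swaps fix the zero exponent, so the exchange lemmas raise an index there without changing the
  -- exponent.
  comm-zeros₀ : ∀ n j → suc j < n → Comm 0 (suc j) (zeros n)
  comm-zeros₀ (suc (suc n)) zero    p = comm-zeros₀₁ n
  comm-zeros₀ n (suc j) p = ≡.subst (Comm 0 (suc (suc j))) (swap-zeros (suc j) n)
    (Comm-sym (comm-swapʳ (suc j) (zeros n) (≡.subst (suc (suc j) <_) (≡.sym (len n)) p)
      (≡.subst (0 <_) (≡.sym (len n)) (ℕₚ.≤-<-trans z≤n p)) (λ ()) (λ ())
      (Comm-sym (comm-zeros₀ n j (ℕₚ.<-trans (ℕₚ.n<1+n _) p)))))
    where len = λ n → Listₚ.length-replicate n {0}
  comm-zeros₀ zero zero ()
  comm-zeros₀ (suc zero) zero (s≤s ())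

  comm-zeros< : ∀ n i j → i < j → j < n → Comm i j (zeros n)
  comm-zeros< n zero    (suc j) _ q = comm-zeros₀ n j q
  comm-zeros< n (suc i) j p q = ≡.subst (Comm (suc i) j) (swap-zeros i n)
    (comm-swapʳ i (zeros n) (≡.subst (suc i <_) (≡.sym len) (ℕₚ.<-trans p q)) (≡.subst (j <_) (≡.sym len) q)
      (λ e → ℕₚ.<-irrefl (≡.sym e) (ℕₚ.<-trans (ℕₚ.n<1+n i) p)) (λ e → ℕₚ.<-irrefl (≡.sym e) p)
      (comm-zeros< n i j (ℕₚ.<-trans (ℕₚ.n<1+n i) p) q))
    where len = Listₚ.length-replicate n {0}

  AllComm : List ℕ → Set
  AllComm η = ∀ i j → i < length η → j < length η → Comm i j η

  all-comm-zeros : ∀ n → AllComm (zeros n)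
  all-comm-zeros n i j p q with ℕₚ.<-cmp i j
  ... | tri< i<j _ _ = comm-zeros< n i j i<j (≡.subst (j <_) (Listₚ.length-replicate n) q)
  ... | tri≈ _ ≡.refl _ = λ φ → refl
  ... | tri> _ _ j<i = Comm-sym (comm-zeros< n j i j<i (≡.subst (i <_) (Listₚ.length-replicate n) p))

  all-comm-swap : ∀ k η → suc k < length η → AllComm η → AllComm (swap k η)
  all-comm-swap k η r c i j p q with i ℕ.≟ j
  ... | yes ≡.refl = λ φ → refl
  ... | no i≢j = go (i ℕ.≟ k) (i ℕ.≟ suc k) (j ℕ.≟ k) (j ℕ.≟ suc k)
    where
    r′ : k < length η
    r′ = ℕₚ.<-trans (ℕₚ.n<1+n k) r
    p′ = ≡.subst (i <_) (length-swap k η) p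
    q′ = ≡.subst (j <_) (length-swap k η) q
    go : Dec (i ≡ k) → Dec (i ≡ suc k) → Dec (j ≡ k) → Dec (j ≡ suc k) → Comm i j (swap k η)
    go (yes ≡.refl) _ (yes e) _ = ⊥-elim (i≢j (≡.sym e))
    go (yes ≡.refl) _ _ (yes ≡.refl) = comm-swap-both k η r (c k (suc k) r′ r)
    go (yes ≡.refl) _ (no a) (no b) = comm-swapˡ k η r q′ a b (c _ j r q′)
    go _ (yes ≡.refl) (yes ≡.refl) _ = Comm-sym {k} {suc k} {swap k η} (comm-swap-both k η r (c k (suc k) r′ r))
    go _ (yes ≡.refl) _ (yes e) = ⊥-elim (i≢j (≡.sym e))
    go _ (yes ≡.refl) (no a) (no b) = comm-swapʳ k η r q′ a b (c _ j r′ q′)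
    go (no a) (no b) (yes ≡.refl) _ = Comm-sym {k} {i} {swap k η} (comm-swapˡ k η r p′ a b (c _ i r p′))
    go (no a) (no b) _ (yes ≡.refl) = Comm-sym {suc k} {i} {swap k η} (comm-swapʳ k η r p′ a b (c _ i r′ p′))
    go (no a) (no b) (no a′) (no b′) = comm-swap-other k η r p′ q′ a b a′ b′ (c i j p′ q′)

  length-∷ʳ : ∀ {A : Set} (t : List A) k → length (t ++ k ∷ []) ≡ suc (length t)
  length-∷ʳ []      k = ≡.refl
  length-∷ʳ (a ∷ t) k = ≡.cong suc (length-∷ʳ t k)

  -- Rotation turns Y 0 into Y n - α and Y (suc j) into Y j, and the scalar α commutes with
  -- everything.
  all-comm-rot₀ : ∀ t k → AllComm (t ++ k ∷ []) → ∀ j → j < length t → Comm 0 (suc j) (suc k ∷ t)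
  all-comm-rot₀ t k c j q φ = begin
    Y 0 (Y (suc j) φ) (suc k ∷ t)
      ≈⟨ Y-rot₀ t k (Y (suc j) φ) (Y j φ′) (λ t′ k′ e → sym (Y-rot j t′ k′ φ φ′ (rotated _ φ) (≡.subst (j <_) (≡.sym e) q))) ⟩
    Y n (Y j φ′) v - α * Y (suc j) φ (suc k ∷ t)
      ≈⟨ +-cong (c n j ltn (≡.subst (j <_) (≡.sym (length-∷ʳ t k)) (ℕₚ.m<n⇒m<1+n q)) φ′)
                (-‿cong (trans (*-congˡ (Y-rot j t k φ φ′ (rotated _ φ) q)) (sym (Y-* j α φ′ v)))) ⟩
    Y j (Y n φ′) v - Y j (λ l → α * φ′ l) v ≈⟨ Y-minus j (Y n φ′) (λ l → α * φ′ l) v ⟨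
    Y j (λ l → Y n φ′ l - α * φ′ l) v
      ≈⟨ Y-rot j t k (Y 0 φ) (λ l → Y n φ′ l - α * φ′ l) (λ t′ k′ e → sym (trans (Y-rot₀ t′ k′ φ φ′ (rotated _ φ))
            (+-cong (reflexive (≡.cong (λ m → Y m φ′ (t′ ++ k′ ∷ [])) e)) (-‿cong (*-congˡ (sym (rotated _ φ t′ k′ ≡.refl))))))) q ⟨
    Y (suc j) (Y 0 φ) (suc k ∷ t) ∎
    where φ′ = λ v → φ (rot v)
          n = length t
          v = t ++ k ∷ []
          ltn : n < length v
          ltn = ≡.subst (n <_) (≡.sym (length-∷ʳ t k)) (ℕₚ.n<1+n n)

  all-comm-rot : ∀ t k → AllComm (t ++ k ∷ []) → AllComm (suc k ∷ t)
  all-comm-rot t k c zero    zero    _ _ φ = refl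
  all-comm-rot t k c (suc i) (suc j) (s≤s p) (s≤s q) φ = begin
    Y (suc i) (Y (suc j) φ) (suc k ∷ t) ≈⟨ Y-rot i t k (Y (suc j) φ) (Y j φ′) (λ t′ k′ e → sym (Y-rot j t′ k′ φ φ′ (rotated _ φ) (≡.subst (j <_) (≡.sym e) q))) p ⟩
    Y i (Y j φ′) (t ++ k ∷ [])          ≈⟨ c i j (lt p) (lt q) φ′ ⟩
    Y j (Y i φ′) (t ++ k ∷ [])          ≈⟨ Y-rot j t k (Y (suc i) φ) (Y i φ′) (λ t′ k′ e → sym (Y-rot i t′ k′ φ φ′ (rotated _ φ) (≡.subst (i <_) (≡.sym e) p))) q ⟨
    Y (suc j) (Y (suc i) φ) (suc k ∷ t) ∎
    where φ′ = λ v → φ (rot v)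
          lt : ∀ {i} → i < length t → i < length (t ++ k ∷ [])
          lt h = ≡.subst (_ <_) (≡.sym (length-∷ʳ t k)) (ℕₚ.m<n⇒m<1+n h)
  all-comm-rot t k c zero    (suc j) _ (s≤s q) = all-comm-rot₀ t k c j q
  all-comm-rot t k c (suc i) zero    (s≤s p) _ = Comm-sym {0} {suc i} {suc k ∷ t} (all-comm-rot₀ t k c i p)

  size-∷ʳ : ∀ t k → size (t ++ k ∷ []) ≡ k ℕ.+ size t
  size-∷ʳ []      k = ≡.refl
  size-∷ʳ (a ∷ t) k = ≡.trans (≡.cong (a ℕ.+_) (size-∷ʳ t k)) (ℕS.solve 3 (λ a k s → a ℕS.:+ (k ℕS.:+ s) ℕS.:= k ℕS.:+ (a ℕS.:+ s)) ≡.refl a k (size t))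

  size≡0⇒zeros : ∀ l → size l ≡ 0 → l ≡ zeros (length l)
  size≡0⇒zeros []         _ = ≡.refl
  size≡0⇒zeros (zero ∷ l) e = ≡.cong (0 ∷_) (size≡0⇒zeros l e)

  size-zeros : ∀ n → size (zeros n) ≡ 0
  size-zeros zero    = ≡.refl
  size-zeros (suc n) = size-zeros n

  positive-entry : ∀ l d → size l ≡ suc d → ∃ λ m → (m < length l) × 0 < at m l
  positive-entry (zero ∷ l) d e with positive-entry l d e
  ... | m , p , q = suc m , s≤s p , q
  positive-entry (suc a ∷ l) d e = 0 , s≤s z≤n , s≤s z≤n

  at-swap-pred : ∀ m l → suc m < length l → at m (swap m l) ≡ at (suc m) l
  at-swap-pred zero    (a ∷ b ∷ l) _       = ≡.refl
  at-swap-pred (suc m) (a ∷ l)     (s≤s p) = at-swap-pred m l p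
  at-swap-pred zero    (a ∷ [])    (s≤s ())

  -- Swaps bring some positive entry to the front, and undoing a rotation then lowers it by one; the
  -- size drops until only zeros are left.
  generate : (P : List ℕ → Set) → (∀ n → P (zeros n)) → (∀ t k → P (t ++ k ∷ []) → P (suc k ∷ t)) →
    (∀ k l → suc k < length l → P l → P (swap k l)) → ∀ d l → size l ≡ d → P l
  generate P z r s zero    l e = ≡.subst P (≡.sym (size≡0⇒zeros l e)) (z (length l))
  generate P z r s (suc d) l e = go m l e m< pos
    where
    m = proj₁ (positive-entry l d e)
    m< = proj₁ (proj₂ (positive-entry l d e))
    pos = proj₂ (proj₂ (positive-entry l d e))
    go : ∀ m l → size l ≡ suc d → m < length l → 0 < at m l → P l
    go zero    (suc k ∷ t) e _ _ = r t k (generate P z r s d (t ++ k ∷ []) (≡.trans (size-∷ʳ t k) (ℕₚ.suc-injective e)))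
    go (suc m) l e p q = ≡.subst P (swap-invol m l) (s m (swap m l) (≡.subst (suc m <_) (≡.sym (length-swap m l)) p)
      (go m (swap m l) (≡.trans (size-swap m l) e) (≡.subst (m <_) (≡.sym (length-swap m l)) (ℕₚ.<-trans (ℕₚ.n<1+n m) p))
        (≡.subst (0 <_) (≡.sym (at-swap-pred m l p)) q)))

  all-comm : ∀ η → AllComm η
  all-comm η = generate AllComm all-comm-zeros all-comm-rot all-comm-swap (size η) η ≡.refl

  -- The rightmost maximal entry

  -- One more than the maximum, with 0 for the empty list, so that in `pick` a last entry always
  -- wins against the empty tail; the non-strict test there sends ties to the right.
  sup : List ℕ → ℕ
  sup []      = 0
  sup (a ∷ l) = suc a ⊔ sup l

  pick : List ℕ → ℕ
  pick []      = 0
  pick (a ∷ l) with suc a ≤? sup l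
  ... | yes _ = suc (pick l)
  ... | no _  = 0

  dec : ℕ → List ℕ → List ℕ
  dec _       []      = []
  dec zero    (a ∷ l) = pred a ∷ l
  dec (suc i) (a ∷ l) = a ∷ dec i l

  pick< : ∀ l → 0 < length l → pick l < length l
  pick< (a ∷ l) _ with suc a ≤? sup l
  pick< (a ∷ []) _      | yes ()
  pick< (a ∷ b ∷ l) _   | yes _ = s≤s (pick< (b ∷ l) (s≤s z≤n))
  ... | no _ = s≤s z≤n

  at-pick : ∀ l → 0 < length l → suc (at (pick l) l) ≡ sup l
  at-pick (a ∷ l) _ with suc a ≤? sup l
  at-pick (a ∷ []) _      | yes ()
  at-pick (a ∷ b ∷ l) _   | yes p = ≡.trans (at-pick (b ∷ l) (s≤s z≤n)) (≡.sym (ℕₚ.m≤n⇒m⊔n≡n p))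
  ... | no p = ≡.sym (ℕₚ.m≥n⇒m⊔n≡m (ℕₚ.<⇒≤ (ℕₚ.≰⇒> p)))

  at≤sup : ∀ i l → i < length l → suc (at i l) ≤ sup l
  at≤sup zero    (a ∷ l) _       = ℕₚ.m≤m⊔n (suc a) (sup l)
  at≤sup (suc i) (a ∷ l) (s≤s p) = ℕₚ.≤-trans (at≤sup i l p) (ℕₚ.m≤n⊔m (suc a) (sup l))

  at-inc : ∀ i j l → i ≢ j → at i (inc j l) ≡ at i l
  at-inc i       j       []      _ = ≡.refl
  at-inc zero    zero    (a ∷ l) p = ⊥-elim (p ≡.refl)
  at-inc (suc i) zero    (a ∷ l) p = ≡.refl
  at-inc zero    (suc j) (a ∷ l) p = ≡.refl
  at-inc (suc i) (suc j) (a ∷ l) p = at-inc i j l (λ e → p (≡.cong suc e))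

  at-inc-same : ∀ i l → i < length l → at i (inc i l) ≡ suc (at i l)
  at-inc-same zero    (a ∷ l) _       = ≡.refl
  at-inc-same (suc i) (a ∷ l) (s≤s p) = at-inc-same i l p

  sup-inc : ∀ j l → sup l ≤ sup (inc j l)
  sup-inc j       []      = z≤n
  sup-inc zero    (a ∷ l) = ℕₚ.⊔-monoˡ-≤ (sup l) (ℕₚ.n≤1+n (suc a))
  sup-inc (suc j) (a ∷ l) = ℕₚ.⊔-monoʳ-≤ (suc a) (sup-inc j l)

  pick-rise : ∀ j l → j < length l → sup l < sup (inc j l) → pick (inc j l) ≡ j
  pick-rise j l p q with pick (inc j l) ℕ.≟ j
  ... | yes e = e
  ... | no ne = ⊥-elim (ℕₚ.<⇒≱ q (≡.subst (_≤ sup l) eq (at≤sup (pick (inc j l)) l i<)))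
    where
    len>0 : 0 < length (inc j l)
    len>0 = ≡.subst (0 <_) (≡.sym (length-inc j l)) (ℕₚ.≤-<-trans z≤n p)
    i< : pick (inc j l) < length l
    i< = ≡.subst (pick (inc j l) <_) (length-inc j l) (pick< (inc j l) len>0)
    eq : suc (at (pick (inc j l)) l) ≡ sup (inc j l)
    eq = ≡.trans (≡.cong suc (≡.sym (at-inc _ j l ne))) (at-pick (inc j l) len>0)

  -- The case split of `eigen`: either the relation for j is the defining one, or inc j l and l are
  -- both built at the same entry, where both can be lowered.
  pick-inc : ∀ j l → j < length l → pick (inc j l) ≡ j ⊎ pick (inc j l) ≡ pick l
  pick-inc zero (a ∷ l) _ with suc (suc a) ≤? sup l | suc a ≤? sup l
  ... | yes p | yes _ = inj₂ ≡.refl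
  ... | yes p | no q  = ⊥-elim (q (ℕₚ.≤-trans (ℕₚ.n≤1+n _) p))
  ... | no _  | _     = inj₁ ≡.refl
  pick-inc (suc j) (a ∷ l) (s≤s p) with suc a ≤? sup (inc j l) | suc a ≤? sup l
  ... | yes q | yes r = Data.Sum.map (≡.cong suc) (≡.cong suc) (pick-inc j l p)
    where import Data.Sum
  ... | yes q | no r  = inj₁ (≡.cong suc (pick-rise j l p (ℕₚ.<-≤-trans (ℕₚ.≰⇒> r) q)))
  ... | no q  | yes r = ⊥-elim (q (ℕₚ.≤-trans r (sup-inc j l)))
  ... | no q  | no r  = inj₂ ≡.refl

  dec-inc : ∀ j l → dec j (inc j l) ≡ l
  dec-inc j       []      = ≡.refl
  dec-inc zero    (a ∷ l) = ≡.refl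
  dec-inc (suc j) (a ∷ l) = ≡.cong (a ∷_) (dec-inc j l)

  inc-dec : ∀ j l → 0 < at j l → inc j (dec j l) ≡ l
  inc-dec zero    (suc a ∷ l) _ = ≡.refl
  inc-dec (suc j) (a ∷ l)     p = ≡.cong (a ∷_) (inc-dec j l p)
  inc-dec _       []          _ = ≡.refl

  inc-comm : ∀ i j l → inc i (inc j l) ≡ inc j (inc i l)
  inc-comm i       j       []      = ≡.refl
  inc-comm zero    zero    (a ∷ l) = ≡.refl
  inc-comm zero    (suc j) (a ∷ l) = ≡.refl
  inc-comm (suc i) zero    (a ∷ l) = ≡.refl
  inc-comm (suc i) (suc j) (a ∷ l) = ≡.cong (a ∷_) (inc-comm i j l)

  length-dec : ∀ j l → length (dec j l) ≡ length l
  length-dec j       []      = ≡.refl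
  length-dec zero    (a ∷ l) = ≡.refl
  length-dec (suc j) (a ∷ l) = ≡.cong suc (length-dec j l)

  -- joint eigenfunctions of the operators Y

  -- The index may change along with the scalar. With a constant index this gives evaluation at a
  -- point; with the index lowered by `dec` it gives the coefficients of monomials.
  module Eigen {I : Set} (c : ℕ → I → K) (σ : ℕ → I → I) (u : I → K)
    (σ-comm : ∀ i j e → σ j (σ i e) ≡ σ i (σ j e))
    (c-comm : ∀ i j e → c i e * c j (σ i e) ≈ c j e * c i (σ j e)) where

    -- The number d stands for the size of the exponent and carries the recursion; both summands of
    -- the second clause live at size d.
    ψ : ℕ → List ℕ → I → K
    ψ zero    l e = u e
    ψ (suc d) l e = c (pick l) e * ψ d (dec (pick l) l) (σ (pick l) e)
                  + Ξ (pick l) (dec (pick l) l) (λ m → ψ d m e)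

    Ψ : I → Fun
    Ψ e l = ψ (size l) l e

    Ψ-zeros : ∀ n e → Ψ e (zeros n) ≈ u e
    Ψ-zeros n e = reflexive (≡.cong (λ d → ψ d (zeros n) e) (size-zeros n))

    Ψ-pick : ∀ j l e → j < length l → pick (inc j l) ≡ j → Y j (Ψ e) l ≈ c j e * Ψ (σ j e) l
    Ψ-pick j l e p eq = begin
      Ψ e (inc j l) - Ξ j l (Ψ e)
        ≈⟨ +-cong (reflexive (≡.trans (≡.cong (λ d → ψ d (inc j l) e) (size-inc j l p))
                    (≡.trans (≡.cong (step (inc j l)) eq) (≡.cong (step₂ j) (dec-inc j l)))))
             (-‿cong (Ξ-cong j l p (λ m _ e₂ → reflexive (≡.cong (λ d → ψ d m e) e₂)))) ⟩
      c j e * Ψ (σ j e) l + x - x ≈⟨ solve 2 (λ a x → a :+ x :- x := a) refl _ x ⟩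
      c j e * Ψ (σ j e) l ∎
      where
      x = Ξ j l (λ m → ψ (size l) m e)
      step₂ : ℕ → List ℕ → K
      step₂ i l′ = c i e * ψ (size l) l′ (σ i e) + Ξ i l′ (λ m → ψ (size l) m e)
      step : List ℕ → ℕ → K
      step l i = step₂ i (dec i l)

    -- Only the relation at the picked entry is built in. For another j, write l as inc i l′ with i
    -- picked: commuting Y i with Y j leaves relations at smaller size and built-in ones at i, and
    -- the two orders agree by `c-comm` and `σ-comm`.
    eigen : ∀ d l j e → size l ≡ d → j < length l → Y j (Ψ e) l ≈ c j e * Ψ (σ j e) l
    eigen d l j e s p with pick-inc j l p
    ... | inj₁ eq = Ψ-pick j l e p eq
    ... | inj₂ eq with pick (inc j l) ℕ.≟ j
    ...   | yes eq′ = Ψ-pick j l e p eq′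
    ...   | no ne = go d (≡.subst (0 <_) (at-inc i j l (λ e → ne (≡.trans eq e))) at>0) s
      where
      i = pick l
      l>0 : 0 < length l
      l>0 = ℕₚ.≤-<-trans z≤n p
      i< : i < length l
      i< = pick< l l>0
      at>0 : 0 < at i (inc j l)
      at>0 = ℕₚ.≤-trans (s≤s z≤n) (ℕₚ.≤-pred (ℕₚ.≤-trans (≡.subst (λ a → suc a ≤ sup (inc j l)) (at-inc-same j l p)
               (at≤sup j (inc j l) (≡.subst (j <_) (≡.sym (length-inc j l)) p)))
               (ℕₚ.≤-reflexive (≡.sym (≡.trans (≡.cong (λ k → suc (at k (inc j l))) (≡.sym eq))
                 (at-pick (inc j l) (≡.subst (0 <_) (≡.sym (length-inc j l)) l>0)))))))
      go : ∀ d → 0 < at i l → size l ≡ d → Y j (Ψ e) l ≈ c j e * Ψ (σ j e) l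
      go d ati s = go′ d (≡.trans (≡.sym (size-inc i l′ i<′)) (≡.trans (≡.cong size l≡) s))
        where
        l′ = dec i l
        l≡ : inc i l′ ≡ l
        l≡ = inc-dec i l ati
        i<′ : i < length l′
        i<′ = ≡.subst (i <_) (≡.sym (length-dec i l)) i<
        j<′ : j < length l′
        j<′ = ≡.subst (j <_) (≡.sym (length-dec i l)) p
        go′ : ∀ d → suc (size l′) ≡ d → Y j (Ψ e) l ≈ c j e * Ψ (σ j e) l
        go′ (suc d) s′ = begin
          Y j (Ψ e) l
            ≡⟨ ≡.cong (Y j (Ψ e)) l≡ ⟨
          Y j (Ψ e) (inc i l′)
            ≈⟨ solve 2 (λ x y → x := x :- y :+ y) refl _ _ ⟩
          Y i (Y j (Ψ e)) l′ + Ξ i l′ (Y j (Ψ e))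
            ≈⟨ +-cong (all-comm l′ i j i<′ j<′ (Ψ e))
                 (Ξ-cong i l′ i<′ (λ m e₁ e₂ → eigen d m j e (≡.trans e₂ (ℕₚ.suc-injective s′)) (≡.subst (j <_) (≡.sym e₁) j<′))) ⟩
          Y j (Y i (Ψ e)) l′ + Ξ i l′ (λ m → c j e * Ψ (σ j e) m)
            ≈⟨ +-cong (+-cong (Ψ-pick i (inc j l′) e i<″ pick₁)
                 (-‿cong (Ξ-cong j l′ j<′ (λ m e₁ e₂ → eigen d m i e (≡.trans e₂ (ℕₚ.suc-injective s′)) (≡.subst (i <_) (≡.sym e₁) i<′)))))
                 (Ξ-* i l′ (c j e) _) ⟩
          (c i e * Ψ (σ i e) (inc j l′) - Ξ j l′ (λ m → c i e * Ψ (σ i e) m)) + c j e * x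
            ≈⟨ +-congʳ (trans (+-congˡ (-‿cong (Ξ-* j l′ (c i e) _)))
                 (solve 3 (λ c x y → c :* x :- c :* y := c :* (x :- y)) refl (c i e) _ _)) ⟩
          c i e * Y j (Ψ (σ i e)) l′ + c j e * x
            ≈⟨ +-congʳ (*-congˡ (eigen d l′ j (σ i e) (ℕₚ.suc-injective s′) j<′)) ⟩
          c i e * (c j (σ i e) * Ψ (σ j (σ i e)) l′) + c j e * x
            ≈⟨ +-congʳ (trans (sym (*-assoc _ _ _)) (trans (*-cong (c-comm i j e) (reflexive (≡.cong (λ e → Ψ e l′) (σ-comm i j e)))) (*-assoc _ _ _))) ⟩
          c j e * (c i (σ j e) * Ψ (σ i (σ j e)) l′) + c j e * x
            ≈⟨ distribˡ _ _ _ ⟨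
          c j e * (c i (σ j e) * Ψ (σ i (σ j e)) l′ + x)
            ≈⟨ *-congˡ (trans (+-congʳ (sym (Ψ-pick i l′ (σ j e) i<′ pick₂))) (solve 2 (λ x y → x :- y :+ y := x) refl _ _)) ⟩
          c j e * Ψ (σ j e) (inc i l′)
            ≡⟨ ≡.cong (λ l → c j e * Ψ (σ j e) l) l≡ ⟩
          c j e * Ψ (σ j e) l ∎
          where
          x = Ξ i l′ (Ψ (σ j e))
          i<″ : i < length (inc j l′)
          i<″ = ≡.subst (i <_) (≡.sym (length-inc j l′)) i<′
          pick₁ : pick (inc i (inc j l′)) ≡ i
          pick₁ = ≡.trans (≡.cong pick (≡.trans (inc-comm i j l′) (≡.cong (inc j) l≡))) eq
          pick₂ : pick (inc i l′) ≡ i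
          pick₂ = ≡.cong pick l≡

  -- Any positive entry expresses φ l through values at smaller size, so the value at zeros decides.
  -- The identities between evaluations below are obtained by comparing eigenvalues and this one
  -- value.
  eigen-unique : ∀ n (φ : Fun) (c : ℕ → K) →
    (∀ l j → length l ≡ n → j < n → Y j φ l ≈ c j * φ l) → φ (zeros n) ≈ 0# →
    ∀ d l → size l ≡ d → length l ≡ n → φ l ≈ 0#
  eigen-unique n φ c h z zero l s e = trans (reflexive (≡.cong φ (≡.trans (size≡0⇒zeros l s) (≡.cong zeros e)))) z
  eigen-unique n φ c h z (suc d) l s e = begin
    φ l                      ≡⟨ ≡.cong φ l≡ ⟨
    φ (inc j l′)             ≈⟨ solve 2 (λ x y → x := x :- y :+ y) refl _ _ ⟩
    Y j φ l′ + Ξ j l′ φ      ≈⟨ +-cong (h l′ j (≡.trans (length-dec j l) e) (≡.subst (j <_) e j<))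
                                 (Ξ-cong j l′ j<′ (λ m e₁ e₂ → eigen-unique n φ c h z d m (≡.trans e₂ s′) (≡.trans e₁ (≡.trans (length-dec j l) e)))) ⟩
    c j * φ l′ + Ξ j l′ (λ _ → 0#)
      ≈⟨ +-cong (*-congˡ (eigen-unique n φ c h z d l′ s′ (≡.trans (length-dec j l) e))) (trans (Ξ-ext j l′ (λ _ → sym (zeroˡ 0#))) (trans (Ξ-* j l′ 0# (λ _ → 0#)) (zeroˡ _))) ⟩
    c j * 0# + 0#            ≈⟨ trans (+-identityʳ _) (zeroʳ _) ⟩
    0#                       ∎
    where
    entry = positive-entry l d s
    j = proj₁ entry
    j< = proj₁ (proj₂ entry)
    l′ = dec j l
    l≡ = inc-dec j l (proj₂ (proj₂ entry))
    j<′ = ≡.subst (j <_) (≡.sym (length-dec j l)) j<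
    s′ : size l′ ≡ d
    s′ = ℕₚ.suc-injective (≡.trans (≡.sym (size-inc j l′ j<′)) (≡.trans (≡.cong size l≡) s))

  pt : ℕ → List K → K
  pt _       []      = 0#
  pt zero    (x ∷ p) = x
  pt (suc j) (x ∷ p) = pt j p

  -- β p l is the value at the point p of the bar monomial with exponent l.
  module Ev (p : List K) = Eigen {⊤} (λ j _ → pt j p) (λ _ e → e) (λ _ → 1#)
    (λ _ _ _ → ≡.refl) (λ i j _ → *-comm _ _)

  β : List K → Fun
  β p = Ev.Ψ p tt

  β-zeros : ∀ p n → β p (zeros n) ≈ 1#
  β-zeros p n = Ev.Ψ-zeros p n tt

  β-eigen : ∀ p l j → j < length l → Y j (β p) l ≈ pt j p * β p l
  β-eigen p l j q = Ev.eigen p (size l) l j tt ≡.refl q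

  -- Swapping, rotating and shortening the point of evaluation

  pt-swap : ∀ j k p → j ≢ k → j ≢ suc k → pt j (swap k p) ≡ pt j p
  pt-swap j             k       []          _ _ = ≡.refl
  pt-swap j             zero    (a ∷ [])    _ _ = ≡.refl
  pt-swap zero          zero    (a ∷ b ∷ l) p q = ⊥-elim (p ≡.refl)
  pt-swap (suc zero)    zero    (a ∷ b ∷ l) p q = ⊥-elim (q ≡.refl)
  pt-swap (suc (suc i)) zero    (a ∷ b ∷ l) p q = ≡.refl
  pt-swap zero          (suc k) (a ∷ l)     p q = ≡.refl
  pt-swap (suc i)       (suc k) (a ∷ l)     p q = pt-swap i k l (λ e → p (≡.cong suc e)) (λ e → q (≡.cong suc e))

  pt-swapˡ : ∀ k p → suc k < length p → pt k (swap k p) ≡ pt (suc k) p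
  pt-swapˡ zero    (a ∷ b ∷ l) _       = ≡.refl
  pt-swapˡ (suc k) (a ∷ l)     (s≤s p) = pt-swapˡ k l p
  pt-swapˡ zero    (a ∷ [])    (s≤s ())

  pt-swapʳ : ∀ k p → suc k < length p → pt (suc k) (swap k p) ≡ pt k p
  pt-swapʳ zero    (a ∷ b ∷ l) _       = ≡.refl
  pt-swapʳ (suc k) (a ∷ l)     (s≤s p) = pt-swapʳ k l p
  pt-swapʳ zero    (a ∷ [])    (s≤s ())

  x-y≈0⇒x≈y : ∀ {x y} → x - y ≈ 0# → x ≈ y
  x-y≈0⇒x≈y {x} {y} h = trans (solve 2 (λ x y → x := (x :- y) :+ y) refl x y) (trans (+-congʳ h) (+-identityˡ y))

  -- The Hecke intertwiner: d (β p ∘ s) + β p is a joint eigenfunction for the swapped point, and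
  -- the factor d + 1 is its value at zeros. Keeping d on the left avoids a division and allows
  -- ties.
  β-swap : ∀ k p l → length l ≡ length p → suc k < length p → ∀ d → d ≈ pt (suc k) p - pt k p →
    d * β p (swap k l) ≈ (d + 1#) * β (swap k p) l - β p l
  β-swap k p l e k< d d≈ = x-y≈0⇒x≈y (eigen-unique (length p) φ (λ j → pt j sp) step base (size l) l ≡.refl e)
    where
    sp = swap k p
    φ : Fun
    φ l = d * β p (swap k l) - ((d + 1#) * β sp l - β p l)
    expand : ∀ j l → j < length l → Y j φ l ≈ d * Y j (λ l → β p (swap k l)) l - ((d + 1#) * (pt j sp * β sp l) - pt j p * β p l)
    expand j l j< = trans (Y-minus j (λ l → d * β p (swap k l)) (λ l → (d + 1#) * β sp l - β p l) l) (+-cong (Y-* j d _ l)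
      (-‿cong (trans (Y-minus j (λ l → (d + 1#) * β sp l) (β p) l)
        (+-cong (trans (Y-* j _ _ l) (*-congˡ (β-eigen sp l j j<))) (-‿cong (β-eigen p l j j<))))))
    step : ∀ l j → length l ≡ length p → j < length p → Y j φ l ≈ pt j sp * φ l
    step l j e j< with j ℕ.≟ k | j ℕ.≟ suc k
    ... | yes ≡.refl | _ = begin
      Y k φ l ≈⟨ expand k l (≡.subst (k <_) (≡.sym e) j<) ⟩
      _       ≈⟨ +-cong (*-congˡ (trans (Y-swapˡ k l (β p) (≡.subst (suc k <_) (≡.sym e) k<))
                          (+-congʳ (β-eigen p (swap k l) (suc k) (≡.subst (suc k <_) (≡.sym (≡.trans (length-swap k l) e)) k<)))))
                  (-‿cong (+-congʳ (*-congˡ (*-congʳ eqQ)))) ⟩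
      d * (Q * A + C) - ((d + 1#) * (Q * B) - P * C) ≈⟨ +-congʳ (*-congʳ d≈) ⟩
      (Q - P) * (Q * A + C) - ((d + 1#) * (Q * B) - P * C)
        ≈⟨ solve 6 (λ P Q D A B C → (Q :- P) :* (Q :* A :+ C) :- (D :* (Q :* B) :- P :* C)
                    := Q :* ((Q :- P) :* A :- (D :* B :- C))) refl P Q (d + 1#) A B C ⟩
      Q * ((Q - P) * A - ((d + 1#) * B - C)) ≈⟨ *-cong (sym eqQ) (+-congʳ (*-congʳ (sym d≈))) ⟩
      pt k sp * φ l ∎
      where P = pt k p
            Q = pt (suc k) p
            A = β p (swap k l)
            B = β sp l
            C = β p l
            eqQ : pt k sp ≈ Q
            eqQ = reflexive (pt-swapˡ k p k<)
    ... | no _ | yes ≡.refl = begin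
      Y (suc k) φ l ≈⟨ expand (suc k) l (≡.subst (suc k <_) (≡.sym e) j<) ⟩
      _       ≈⟨ +-cong (*-congˡ (trans (Y-swapʳ k l (β p) (≡.subst (suc k <_) (≡.sym e) k<))
                          (+-cong (β-eigen p (swap k l) k (≡.subst (k <_) (≡.sym (≡.trans (length-swap k l) e)) (ℕₚ.<-trans (ℕₚ.n<1+n k) k<)))
                            (-‿cong (reflexive (≡.cong (β p) (swap-invol k l)))))))
                  (-‿cong (+-congʳ (*-congˡ (*-congʳ eqP)))) ⟩
      d * (P * A - C) - ((d + 1#) * (P * B) - Q * C) ≈⟨ +-congʳ (*-congʳ d≈) ⟩
      (Q - P) * (P * A - C) - ((d + 1#) * (P * B) - Q * C)
        ≈⟨ solve 6 (λ P Q D A B C → (Q :- P) :* (P :* A :- C) :- (D :* (P :* B) :- Q :* C)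
                    := P :* ((Q :- P) :* A :- (D :* B :- C))) refl P Q (d + 1#) A B C ⟩
      P * ((Q - P) * A - ((d + 1#) * B - C)) ≈⟨ *-cong (sym eqP) (+-congʳ (*-congʳ (sym d≈))) ⟩
      pt (suc k) sp * φ l ∎
      where P = pt k p
            Q = pt (suc k) p
            A = β p (swap k l)
            B = β sp l
            C = β p l
            eqP : pt (suc k) sp ≈ P
            eqP = reflexive (pt-swapʳ k p k<)
    ... | no j≢k | no j≢k′ = begin
      Y j φ l ≈⟨ expand j l (≡.subst (j <_) (≡.sym e) j<) ⟩
      _       ≈⟨ +-cong (*-congˡ (trans (Y-swap j k l (β p) j≢k j≢k′)
                          (β-eigen p (swap k l) j (≡.subst (j <_) (≡.sym (≡.trans (length-swap k l) e)) j<))))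
                  (-‿cong (+-congˡ (-‿cong (*-congʳ (sym eq))))) ⟩
      d * (pt j p * A) - ((d + 1#) * (pt j sp * B) - pt j sp * C) ≈⟨ +-congʳ (*-congˡ (*-congʳ (sym eq))) ⟩
      d * (pt j sp * A) - ((d + 1#) * (pt j sp * B) - pt j sp * C)
        ≈⟨ solve 6 (λ d D P A B C → d :* (P :* A) :- (D :* (P :* B) :- P :* C) := P :* (d :* A :- (D :* B :- C))) refl d (d + 1#) (pt j sp) A B C ⟩
      pt j sp * φ l ∎
      where A = β p (swap k l)
            B = β sp l
            C = β p l
            eq : pt j sp ≈ pt j p
            eq = reflexive (pt-swap j k p j≢k j≢k′)
    base : φ (zeros (length p)) ≈ 0#
    base = begin
      d * β p (swap k (zeros (length p))) - ((d + 1#) * β sp (zeros (length p)) - β p (zeros (length p)))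
        ≈⟨ +-cong (*-congˡ (trans (reflexive (≡.cong (β p) (swap-zeros k (length p)))) (β-zeros p (length p))))
             (-‿cong (+-cong (*-congˡ (β-zeros sp (length p))) (-‿cong (β-zeros p (length p))))) ⟩
      d * 1# - ((d + 1#) * 1# - 1#) ≈⟨ +-cong (*-identityʳ d) (-‿cong (+-congʳ (*-identityʳ _))) ⟩
      d - ((d + 1#) - 1#) ≈⟨ solve 2 (λ d o → d :- ((d :+ o) :- o) := con (+ 0)) refl d 1# ⟩
      0# ∎

  pt-∷ʳ : ∀ j p x → j < length p → pt j (p ++ x ∷ []) ≡ pt j p
  pt-∷ʳ zero    (a ∷ p) x _       = ≡.refl
  pt-∷ʳ (suc j) (a ∷ p) x (s≤s h) = pt-∷ʳ j p x h

  pt-last : ∀ p x → pt (length p) (p ++ x ∷ []) ≡ x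
  pt-last []      x = ≡.refl
  pt-last (a ∷ p) x = pt-last p x

  zeros-∷ʳ : ∀ n → zeros (suc n) ≡ zeros n ++ 0 ∷ []
  zeros-∷ʳ zero    = ≡.refl
  zeros-∷ʳ (suc n) = ≡.cong (0 ∷_) (zeros-∷ʳ n)

  -- The rotated function is an eigenfunction whose last eigenvalue is raised by α through `Y-rot₀`;
  -- the factor x is its value at zeros, that is, the value of y_0.
  β-rot : ∀ x p k t → length t ≡ length p →
    β (x ∷ p) (suc k ∷ t) ≈ x * β (p ++ (x + α) ∷ []) (t ++ k ∷ [])
  β-rot x p k t e = trans (reflexive (≡.cong B (≡.sym (rot-∷ʳ t k)))) (x-y≈0⇒x≈y
    (eigen-unique n φ (λ j → pt j p′) step base _ (t ++ k ∷ []) ≡.refl (≡.trans (length-∷ʳ t k) (≡.cong suc e))))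
    where
    n = suc (length p)
    p′ = p ++ (x + α) ∷ []
    B B′ φ : Fun
    B = β (x ∷ p)
    B′ v = B (rot v)
    φ v = B′ v - x * β p′ v
    step′ : ∀ t k j → length t ≡ length p → j < n → Y j B′ (t ++ k ∷ []) ≈ pt j p′ * B′ (t ++ k ∷ [])
    step′ t k j e j< with j ℕ.≟ length t
    ... | yes ≡.refl = begin
      Y (length t) B′ v       ≈⟨ solve 2 (λ x y → x := x :- y :+ y) refl _ (α * B (suc k ∷ t)) ⟩
      Y (length t) B′ v - α * B (suc k ∷ t) + α * B (suc k ∷ t) ≈⟨ +-congʳ (sym (Y-rot₀ t k B B′ (rotated _ B))) ⟩
      Y 0 B (suc k ∷ t) + α * B (suc k ∷ t) ≈⟨ +-congʳ (β-eigen (x ∷ p) (suc k ∷ t) 0 (s≤s z≤n)) ⟩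
      x * B (suc k ∷ t) + α * B (suc k ∷ t) ≈⟨ distribʳ _ _ _ ⟨
      (x + α) * B (suc k ∷ t)               ≈⟨ *-cong (reflexive (≡.sym (≡.trans (≡.cong (λ m → pt m p′) e) (pt-last p _)))) (sym (rotated _ B t k ≡.refl)) ⟩
      pt (length t) p′ * B′ v               ∎
      where v = t ++ k ∷ []
    ... | no ne = begin
      Y j B′ (t ++ k ∷ [])             ≈⟨ Y-rot j t k B B′ (rotated _ B) j<t ⟨
      Y (suc j) B (suc k ∷ t)          ≈⟨ β-eigen (x ∷ p) (suc k ∷ t) (suc j) (s≤s j<t) ⟩
      pt j p * B (suc k ∷ t)           ≈⟨ *-cong (reflexive (≡.sym (pt-∷ʳ j p (x + α) (≡.subst (j <_) e j<t)))) (sym (rotated _ B t k ≡.refl)) ⟩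
      pt j p′ * B′ (t ++ k ∷ [])       ∎
      where j<t : j < length t
            j<t = ℕₚ.≤∧≢⇒< (≡.subst (j ≤_) (≡.sym e) (ℕₚ.≤-pred j<)) ne
    step : ∀ v j → length v ≡ n → j < n → Y j φ v ≈ pt j p′ * φ v
    step v j e j< with initLast v
    ... | t ∷ʳ′ k = begin
      Y j φ (t ++ k ∷ [])  ≈⟨ Y-minus j B′ (λ v → x * β p′ v) (t ++ k ∷ []) ⟩
      Y j B′ (t ++ k ∷ []) - Y j (λ v → x * β p′ v) (t ++ k ∷ [])
        ≈⟨ +-cong (step′ t k j (ℕₚ.suc-injective (≡.trans (≡.sym (length-∷ʳ t k)) e)) j<)
                  (-‿cong (trans (Y-* j x (β p′) (t ++ k ∷ [])) (*-congˡ (β-eigen p′ (t ++ k ∷ []) j (≡.subst (j <_) (≡.sym e) j<))))) ⟩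
      pt j p′ * B′ (t ++ k ∷ []) - x * (pt j p′ * β p′ (t ++ k ∷ []))
        ≈⟨ solve 4 (λ c x a b → c :* a :- x :* (c :* b) := c :* (a :- x :* b)) refl (pt j p′) x _ _ ⟩
      pt j p′ * φ (t ++ k ∷ []) ∎
    base : φ (zeros n) ≈ 0#
    base = begin
      B′ (zeros n) - x * β p′ (zeros n)
        ≈⟨ +-cong (reflexive (≡.trans (≡.cong B′ (zeros-∷ʳ (length p))) (≡.cong B (rot-∷ʳ (zeros (length p)) 0))))
                  (-‿cong (trans (*-congˡ (β-zeros p′ n)) (*-identityʳ x))) ⟩
      B (1 ∷ z) - x ≈⟨ +-congʳ (solve 2 (λ x y → x := x :- y :+ y) refl _ (Ξ 0 (0 ∷ z) B)) ⟩
      Y 0 B (0 ∷ z) + Ξ 0 (0 ∷ z) B - x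
        ≈⟨ +-congʳ (+-cong (trans (β-eigen (x ∷ p) (0 ∷ z) 0 (s≤s z≤n)) (trans (*-congˡ (β-zeros (x ∷ p) n)) (*-identityʳ x))) (Ξ-zeros (length p) B)) ⟩
      x + 0# - x ≈⟨ solve 1 (λ x → x :+ con (+ 0) :- x := con (+ 0)) refl x ⟩
      0# ∎
      where z = zeros (length p)

  β-0-suc : ∀ p k t → length t ≡ length p → β (0# ∷ p) (suc k ∷ t) ≈ 0#
  β-0-suc p k t e = trans (β-rot 0# p k t e) (zeroˡ _)

  T-first : ∀ a f → (∀ u v → f u (suc v) ≈ 0#) → T a f ≈ f a 0
  T-first zero    f h = refl
  T-first (suc a) f h = trans (+-cong (h 0 a) (T-first a (λ u v → f (suc u) v) (λ u v → h (suc u) v))) (+-identityˡ _)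

  put-at : ∀ j l → put j (at j l) l ≡ l
  put-at j       []      = ≡.refl
  put-at zero    (a ∷ l) = ≡.refl
  put-at (suc j) (a ∷ l) = ≡.cong (a ∷_) (put-at j l)

  pt-map : ∀ f j p → j < length p → pt j (map f p) ≡ f (pt j p)
  pt-map f zero    (a ∷ p) _       = ≡.refl
  pt-map f (suc j) (a ∷ p) (s≤s h) = pt-map f j p h

  -- By `β-0-suc` only exponents with first entry zero survive, so the divided difference with that
  -- entry collapses to a single term. This term adds one to each remaining eigenvalue.
  β-stable : ∀ p t → length t ≡ length p → β (0# ∷ p) (0 ∷ t) ≈ β (map (_+ 1#) p) t
  β-stable p t e = x-y≈0⇒x≈y (eigen-unique n φ (λ j → pt j p + 1#) step base _ t ≡.refl e)
    where
    n = length p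
    p₁ = map (_+ 1#) p
    B φ : Fun
    B t = β (0# ∷ p) (0 ∷ t)
    φ t = B t - β p₁ t
    step : ∀ t j → length t ≡ n → j < n → Y j φ t ≈ (pt j p + 1#) * φ t
    step t j e j< = begin
      Y j φ t ≈⟨ Y-minus j B (β p₁) t ⟩
      Y j B t - Y j (β p₁) t
        ≈⟨ +-cong eqB (-‿cong (trans (β-eigen p₁ t j (≡.subst (j <_) (≡.sym e) j<)) (*-congʳ (reflexive (pt-map (_+ 1#) j p j<))))) ⟩
      (pt j p + 1#) * B t - (pt j p + 1#) * β p₁ t
        ≈⟨ solve 3 (λ c x y → c :* x :- c :* y := c :* (x :- y)) refl _ _ _ ⟩
      (pt j p + 1#) * φ t ∎
      where
      kt = T (at j t) (λ u v → β (0# ∷ p) (v ∷ put j u t))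
      kt≈ : kt ≈ B t
      kt≈ = trans (T-first (at j t) _ (λ u v → β-0-suc p v (put j u t) (≡.trans (length-put j u t) e)))
                  (reflexive (≡.cong B (put-at j t)))
      eqB : Y j B t ≈ (pt j p + 1#) * B t
      eqB = begin
        Y j B t ≈⟨ solve 3 (λ x y z → x :- y := x :- (y :+ z) :+ z) refl (B (inc j t)) (Ξ j t B) kt ⟩
        Y (suc j) (β (0# ∷ p)) (0 ∷ t) + kt
          ≈⟨ +-cong (β-eigen (0# ∷ p) (0 ∷ t) (suc j) (s≤s (≡.subst (j <_) (≡.sym e) j<))) (trans kt≈ (sym (*-identityˡ _))) ⟩
        pt j p * B t + 1# * B t ≈⟨ distribʳ _ _ _ ⟨
        (pt j p + 1#) * B t ∎
    base : φ (zeros n) ≈ 0#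
    base = trans (+-cong (β-zeros (0# ∷ p) (suc n)) (-‿cong (β-zeros p₁ n))) (-‿inverseʳ 1#)

  -- coefficients of the bar monomials

  ind : ℕ → K
  ind zero    = 0#
  ind (suc _) = 1#

  dec-comm : ∀ i j l → dec j (dec i l) ≡ dec i (dec j l)
  dec-comm i       j       []      = ≡.refl
  dec-comm zero    zero    (a ∷ l) = ≡.refl
  dec-comm zero    (suc j) (a ∷ l) = ≡.refl
  dec-comm (suc i) zero    (a ∷ l) = ≡.refl
  dec-comm (suc i) (suc j) (a ∷ l) = ≡.cong (a ∷_) (dec-comm i j l)

  at-dec : ∀ i j l → i ≢ j → at i (dec j l) ≡ at i l
  at-dec i       j       []      _ = ≡.refl
  at-dec zero    zero    (a ∷ l) p = ⊥-elim (p ≡.refl)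
  at-dec (suc i) zero    (a ∷ l) p = ≡.refl
  at-dec zero    (suc j) (a ∷ l) p = ≡.refl
  at-dec (suc i) (suc j) (a ∷ l) p = at-dec i j l (λ e → p (≡.cong suc e))

  ind-comm : ∀ i j l → ind (at i l) * ind (at j (dec i l)) ≈ ind (at j l) * ind (at i (dec j l))
  ind-comm i j l with i ℕ.≟ j
  ... | yes ≡.refl = refl
  ... | no ne = trans (*-cong (reflexive (≡.cong ind (≡.sym (at-dec i j l ne)))) (reflexive (≡.cong ind (at-dec j i l (λ e → ne (≡.sym e))))))
                      (*-comm _ _)

  isZero : ℕ → K
  isZero zero    = 1#
  isZero (suc _) = 0#

  module Co = Eigen {List ℕ} (λ j e → ind (at j e)) dec (λ e → isZero (size e)) dec-comm ind-comm

  -- barCoeff e l is the coefficient of y^e in the bar monomial with exponent l.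
  barCoeff : List ℕ → Fun
  barCoeff = Co.Ψ

  barCoeff-eigen : ∀ e l j → j < length l → Y j (barCoeff e) l ≈ ind (at j e) * barCoeff (dec j e) l
  barCoeff-eigen e l j p = Co.eigen (size l) l j e ≡.refl p

  Ξ-0 : ∀ i η φ → (∀ l → φ l ≈ 0#) → Ξ i η φ ≈ 0#
  Ξ-0 i η φ h = trans (Ξ-ext i η (λ l → trans (h l) (sym (zeroˡ 0#)))) (trans (Ξ-* i η 0# (λ _ → 0#)) (zeroˡ _))

  size-dec : ∀ j l → 0 < at j l → size l ≡ suc (size (dec j l))
  size-dec j       []          ()
  size-dec zero    (suc a ∷ l) _ = ≡.refl
  size-dec (suc j) (a ∷ l)     p = ≡.trans (≡.cong (a ℕ.+_) (size-dec j l p)) (ℕₚ.+-suc a _)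

  -- With the next two lemmas: a bar monomial is the ordinary monomial plus terms of lower degree,
  -- since the Ξ part of the recursion never reaches the top degree.
  ψ-low : ∀ d l e → d < size e → Co.ψ d l e ≈ 0#
  ψ-low zero    l e p with size e
  ... | suc _ = refl
  ψ-low (suc d) l e p = trans (+-cong first (Ξ-0 i l′ _ (λ m → ψ-low d m e (ℕₚ.<-trans (ℕₚ.n<1+n d) p)))) (+-identityʳ 0#)
    where
    i = pick l
    l′ = dec i l
    first : ind (at i e) * Co.ψ d l′ (dec i e) ≈ 0#
    first with at i e in eq
    ... | zero  = zeroˡ _
    ... | suc a = trans (*-congˡ (ψ-low d l′ (dec i e) (ℕₚ.≤-pred (≡.subst (suc d <_)
                    (size-dec i e (≡.subst (0 <_) (≡.sym eq) (s≤s z≤n))) p)))) (zeroʳ _)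

  pick>0 : ∀ l → 0 < size l → 0 < at (pick l) l
  pick>0 l p with positive-entry l (pred (size l)) (≡.sym (ℕₚ.suc-pred (size l) {{ℕ.>-nonZero p}}))
  ... | m , m< , q = ℕₚ.≤-pred (ℕₚ.≤-trans (s≤s q) (ℕₚ.≤-trans (at≤sup m l m<) (ℕₚ.≤-reflexive (≡.sym (at-pick l (ℕₚ.≤-<-trans z≤n m<))))))

  ψ-top≢ : ∀ d l e → size l ≡ d → size e ≡ d → length l ≡ length e → l ≢ e → Co.ψ d l e ≈ 0#
  ψ-top≢ zero l e s s′ n ne = ⊥-elim (ne (≡.trans (size≡0⇒zeros l s) (≡.trans (≡.cong zeros n) (≡.sym (size≡0⇒zeros e s′)))))
  ψ-top≢ (suc d) l e s s′ n ne = trans (+-cong first (Ξ-0 i l′ _ (λ m → ψ-low d m e (≡.subst (d <_) (≡.sym s′) (ℕₚ.n<1+n d))))) (+-identityʳ 0#)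
    where
    i = pick l
    l′ = dec i l
    ati : 0 < at i l
    ati = pick>0 l (≡.subst (0 <_) (≡.sym s) (s≤s z≤n))
    first : ind (at i e) * Co.ψ d l′ (dec i e) ≈ 0#
    first with at i e in eq
    ... | zero  = zeroˡ _
    ... | suc a = trans (*-congˡ (ψ-top≢ d l′ (dec i e)
                    (ℕₚ.suc-injective (≡.trans (≡.sym (size-dec i l ati)) s)) (ℕₚ.suc-injective (≡.trans (≡.sym (size-dec i e e>0)) s′))
                    (≡.trans (length-dec i l) (≡.trans n (≡.sym (length-dec i e))))
                    (λ h → ne (≡.trans (≡.sym (inc-dec i l ati)) (≡.trans (≡.cong (inc i) h) (inc-dec i e e>0)))))) (zeroʳ _)
      where e>0 : 0 < at i e
            e>0 = ≡.subst (0 <_) (≡.sym eq) (s≤s z≤n)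

  ψ-top≡ : ∀ d l → size l ≡ d → Co.ψ d l l ≈ 1#
  ψ-top≡ zero l s = reflexive (≡.cong isZero s)
  ψ-top≡ (suc d) l s = trans (+-cong first (Ξ-0 i l′ _ (λ m → ψ-low d m l (≡.subst (d <_) (≡.sym s) (ℕₚ.n<1+n d))))) (+-identityʳ 1#)
    where
    i = pick l
    l′ = dec i l
    first : ind (at i l) * Co.ψ d l′ (dec i l) ≈ 1#
    first with at i l in eq
    ... | zero  = ⊥-elim (ℕₚ.<-irrefl (≡.sym eq) (pick>0 l (≡.subst (0 <_) (≡.sym s) (s≤s z≤n))))
    ... | suc a = trans (*-identityˡ _) (ψ-top≡ d l′ (ℕₚ.suc-injective (≡.trans (≡.sym (size-dec i l (≡.subst (0 <_) (≡.sym eq) (s≤s z≤n)))) s)))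

  -- positivity

  -- Abstract positivity; `cone` instantiates it with the values at α of polynomials over ℕ.
  record Cone : Set₁ where
    field
      Pos   : K → Set
      resp  : ∀ {x y} → x ≈ y → Pos x → Pos y
      pos-0 : Pos 0#
      pos-1 : Pos 1#
      pos-α : Pos α
      pos-+ : ∀ {x y} → Pos x → Pos y → Pos (x + y)
      pos-* : ∀ {x y} → Pos x → Pos y → Pos (x * y)

  module Positivity (C : Cone) where
    open Cone C

    pos-nat : ∀ n → Pos (nat n)
    pos-nat zero    = pos-0
    pos-nat (suc n) = pos-+ pos-1 (pos-nat n)

    pos-T : ∀ a f → (∀ u v → Pos (f u v)) → Pos (T a f)
    pos-T zero    f h = h 0 0
    pos-T (suc a) f h = pos-+ (h 0 (suc a)) (pos-T a _ (λ u v → h (suc u) v))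

    -- The bounds say that in each numerator the term with the plus sign has the larger or equal
    -- power of x; the quotient is then a sum of monomials without signs. At equality the quotient
    -- is zero, which is the clause with -0.
    pos-K⁺ : ∀ a b f → b ≤ suc a → (∀ u v → Pos (f u v)) → Pos (K⁺ a b f)
    pos-K⁻ : ∀ a b f → b ≤ a → (∀ u v → Pos (f u v)) → Pos (K⁻ a b f)
    pos-K⁺ a zero    f _       h = pos-T a f h
    pos-K⁺ a (suc b) f (s≤s p) h = pos-K⁻ a b _ p (λ u v → h u (suc v))
    pos-K⁻ zero    zero f _ h = resp (sym -0#≈0#) pos-0
    pos-K⁻ (suc a) b    f p h = pos-K⁺ a b _ p (λ u v → h (suc u) v)

    pos-S : ∀ a ys φ → sup ys ≤ suc a → (∀ u l → Pos (φ u l)) → Pos (S a ys φ)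
    pos-S a []       φ p h = pos-0
    pos-S a (b ∷ ys) φ p h = pos-+ (pos-K⁻ a b _ (ℕₚ.≤-pred (ℕₚ.≤-trans (ℕₚ.m≤m⊔n (suc b) (sup ys)) p)) (λ u v → h u (v ∷ ys)))
      (pos-S a ys _ (ℕₚ.≤-trans (ℕₚ.m≤n⊔m (suc b) (sup ys)) p) (λ u l → h u (b ∷ l)))

    -- An exponent after its rightmost maximal entry, at position i, was lowered: entries to the
    -- left may exceed that entry by one, entries to the right may not exceed it.
    Good : ℕ → List ℕ → Set
    Good _       []       = ⊤
    Good zero    (a ∷ ys) = sup ys ≤ suc a
    Good (suc i) (b ∷ ys) = (b ≤ suc (at i ys)) × Good i ys

    pos-Ξ : ∀ i η φ → Good i η → (∀ l → Pos (φ l)) → Pos (Ξ i η φ)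
    pos-Ξ _       []       φ g h = pos-0
    pos-Ξ zero    (a ∷ ys) φ g h = pos-+ (pos-* (pos-* pos-α (pos-nat a)) (h _)) (pos-S a ys _ g (λ u l → h _))
    pos-Ξ (suc i) (b ∷ ys) φ (p , g) h = pos-+ (pos-Ξ i ys _ g (λ l → h _)) (pos-K⁺ (at i ys) b _ p (λ u v → h _))

    at-dec-same : ∀ i l → at i (dec i l) ≡ pred (at i l)
    at-dec-same i       []      = ≡.refl
    at-dec-same zero    (a ∷ l) = ≡.refl
    at-dec-same (suc i) (a ∷ l) = at-dec-same i l

    n≤suc-pred : ∀ n → n ≤ suc (pred n)
    n≤suc-pred zero    = z≤n
    n≤suc-pred (suc n) = ℕₚ.≤-refl

    good-pick : ∀ l → Good (pick l) (dec (pick l) l)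
    good-pick []      = tt
    good-pick (a ∷ l) with suc a ≤? sup l
    good-pick (a ∷ [])    | yes ()
    good-pick (a ∷ b ∷ l) | yes p = ℕₚ.≤-trans (ℕₚ.≤-pred (ℕₚ.≤-trans p (ℕₚ.≤-reflexive (≡.sym (at-pick (b ∷ l) (s≤s z≤n))))))
        (ℕₚ.≤-trans (n≤suc-pred _) (ℕₚ.≤-reflexive (≡.cong suc (≡.sym (at-dec-same (pick (b ∷ l)) (b ∷ l)))))) , good-pick (b ∷ l)
    ... | no p  = ℕₚ.≤-trans (ℕₚ.≤-pred (ℕₚ.≰⇒> p)) (n≤suc-pred a)

    pos-isZero : ∀ n → Pos (isZero n)
    pos-isZero zero    = pos-1
    pos-isZero (suc n) = pos-0

    pos-ind : ∀ n → Pos (ind n)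
    pos-ind zero    = pos-0
    pos-ind (suc n) = pos-1

    pos-ψ : ∀ d l e → Pos (Co.ψ d l e)
    pos-ψ zero    l e = pos-isZero (size e)
    pos-ψ (suc d) l e = pos-+ (pos-* (pos-ind (at (pick l) e)) (pos-ψ d _ _)) (pos-Ξ (pick l) _ _ (good-pick l) (λ m → pos-ψ d m e))

  -- ranks and interpolation points

  le : ℕ → ℕ → ℕ
  le zero    x       = 1
  le (suc a) zero    = 0
  le (suc a) (suc x) = le a x

  below : ℕ → List ℕ → ℕ
  below a []      = 0
  below a (x ∷ l) = le (suc x) a ℕ.+ below a l

  bump : ℕ → List ℕ → List ℕ → List ℕ
  bump a (x ∷ l) (r ∷ rs) = le a x ℕ.+ r ∷ bump a l rs
  bump a _       _        = []

  -- Each entry counts the earlier entries that are at most as large and the later ones that are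
  -- smaller. Ties are thus ranked from left to right, and an increasing exponent has ranks 0, 1, 2,
  -- ....
  rank : List ℕ → List ℕ
  rank []      = []
  rank (a ∷ l) = below a l ∷ bump a l (rank l)

  val : ℕ → ℕ → K
  val a r = - (α * nat a + nat r)

  vals : List ℕ → List ℕ → List K
  vals (a ∷ l) (r ∷ rs) = val a r ∷ vals l rs
  vals _       _        = []

  bar : List ℕ → List K
  bar l = vals l (rank l)

  length-bump : ∀ a l rs → length rs ≡ length l → length (bump a l rs) ≡ length l
  length-bump a []      []       e = ≡.refl
  length-bump a (x ∷ l) (r ∷ rs) e = ≡.cong suc (length-bump a l rs (ℕₚ.suc-injective e))

  length-rank : ∀ l → length (rank l) ≡ length l
  length-rank []      = ≡.refl
  length-rank (a ∷ l) = ≡.cong suc (length-bump a l (rank l) (length-rank l))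

  length-vals : ∀ l rs → length rs ≡ length l → length (vals l rs) ≡ length l
  length-vals []      []       e = ≡.refl
  length-vals (x ∷ l) (r ∷ rs) e = ≡.cong suc (length-vals l rs (ℕₚ.suc-injective e))

  length-bar : ∀ l → length (bar l) ≡ length l
  length-bar l = length-vals l (rank l) (length-rank l)

  pt-vals : ∀ j l rs → j < length l → length rs ≡ length l → pt j (vals l rs) ≡ val (at j l) (at j rs)
  pt-vals zero    (a ∷ l) (r ∷ rs) _       _ = ≡.refl
  pt-vals (suc j) (a ∷ l) (r ∷ rs) (s≤s p) e = pt-vals j l rs p (ℕₚ.suc-injective e)

  pt-bar : ∀ j l → j < length l → pt j (bar l) ≡ val (at j l) (at j (rank l))
  pt-bar j l p = pt-vals j l (rank l) p (length-rank l)

  below-∷ʳ : ∀ a t k → below a (t ++ k ∷ []) ≡ le (suc k) a ℕ.+ below a t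
  below-∷ʳ a []      k = ≡.refl
  below-∷ʳ a (x ∷ t) k = ≡.trans (≡.cong (le (suc x) a ℕ.+_) (below-∷ʳ a t k))
    (ℕS.solve 3 (λ x k b → x ℕS.:+ (k ℕS.:+ b) ℕS.:= k ℕS.:+ (x ℕS.:+ b)) ≡.refl (le (suc x) a) (le (suc k) a) (below a t))

  bump-comm : ∀ a b l rs → bump a l (bump b l rs) ≡ bump b l (bump a l rs)
  bump-comm a b []      rs       = ≡.refl
  bump-comm a b (x ∷ l) []       = ≡.refl
  bump-comm a b (x ∷ l) (r ∷ rs) = ≡.cong₂ _∷_
    (ℕS.solve 3 (λ a b r → a ℕS.:+ (b ℕS.:+ r) ℕS.:= b ℕS.:+ (a ℕS.:+ r)) ≡.refl (le a x) (le b x) r) (bump-comm a b l rs)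

  bump-∷ʳ : ∀ a l rs k c → length rs ≡ length l →
    bump a (l ++ k ∷ []) (rs ++ c ∷ []) ≡ bump a l rs ++ le a k ℕ.+ c ∷ []
  bump-∷ʳ a []      []       k c _ = ≡.refl
  bump-∷ʳ a (x ∷ l) (r ∷ rs) k c e = ≡.cong (_ ∷_) (bump-∷ʳ a l rs k c (ℕₚ.suc-injective e))

  -- These are the ranks of suc k ∷ t in rotated order: a last entry k and a first entry suc k
  -- compare alike with all others. Hence `bar` follows the rotation of points in `β-rot`.
  rank-∷ʳ : ∀ t k → rank (t ++ k ∷ []) ≡ bump (suc k) t (rank t) ++ below (suc k) t ∷ []
  rank-∷ʳ []      k = ≡.refl
  rank-∷ʳ (a ∷ t) k = ≡.cong₂ _∷_ (below-∷ʳ a t k) (≡.trans (≡.cong (bump a (t ++ k ∷ [])) (rank-∷ʳ t k))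
    (≡.trans (bump-∷ʳ a t (bump (suc k) t (rank t)) k _ (length-bump (suc k) t (rank t) (length-rank t)))
      (≡.cong (_++ le a k ℕ.+ below (suc k) t ∷ []) (bump-comm a (suc k) t (rank t)))))

  vals-∷ʳ : ∀ l rs k c → length rs ≡ length l → vals (l ++ k ∷ []) (rs ++ c ∷ []) ≡ vals l rs ++ val k c ∷ []
  vals-∷ʳ []      []       k c _ = ≡.refl
  vals-∷ʳ (x ∷ l) (r ∷ rs) k c e = ≡.cong (_ ∷_) (vals-∷ʳ l rs k c (ℕₚ.suc-injective e))

  Pointwise : List K → List K → Set
  Pointwise p q = ∀ j → pt j p ≈ pt j q

  β-cong : ∀ p q → Pointwise p q → ∀ l → β p l ≈ β q l
  β-cong p q h l = go (size l) l
    where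
    go : ∀ d l → Ev.ψ p d l tt ≈ Ev.ψ q d l tt
    go zero    l = refl
    go (suc d) l = +-cong (*-cong (h (pick l)) (go d _)) (Ξ-ext (pick l) (dec (pick l) l) (go d))

  ++-pointwise : ∀ p {x y} → x ≈ y → Pointwise (p ++ x ∷ []) (p ++ y ∷ [])
  ++-pointwise []      h zero    = h
  ++-pointwise []      h (suc j) = refl
  ++-pointwise (a ∷ p) h zero    = refl
  ++-pointwise (a ∷ p) h (suc j) = ++-pointwise p h j

  val-suc : ∀ k c → val (suc k) c + α ≈ val k c
  val-suc k c = trans (+-congʳ (-‿cong (+-congʳ (trans (distribˡ α 1# (nat k)) (+-congʳ (*-identityʳ α))))))
    (solve 3 (λ a x y → :- ((a :+ x) :+ y) :+ a := :- (x :+ y)) refl α (α * nat k) (nat c))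

  ev : List ℕ → Fun
  ev ν = β (bar ν)

  ev-rot : ∀ k t m l → length l ≡ length t →
    ev (suc k ∷ t) (suc m ∷ l) ≈ val (suc k) (below (suc k) t) * ev (t ++ k ∷ []) (l ++ m ∷ [])
  ev-rot k t m l e = trans (β-rot (val (suc k) c) (vals t rs) m l (≡.trans e (≡.sym (length-vals t rs len))))
    (*-congˡ (trans (β-cong (vals t rs ++ (val (suc k) c + α) ∷ []) (vals t rs ++ val k c ∷ []) (++-pointwise (vals t rs) (val-suc k c)) (l ++ m ∷ []))
      (reflexive (≡.cong (λ p → β p (l ++ m ∷ []))
        (≡.trans (≡.sym (vals-∷ʳ t rs k c len)) (≡.cong (vals (t ++ k ∷ [])) (≡.sym (rank-∷ʳ t k))))))))
    where
    c = below (suc k) t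
    rs = bump (suc k) t (rank t)
    len = length-bump (suc k) t (rank t) (length-rank t)

  below-0 : ∀ l → below 0 l ≡ 0
  below-0 []      = ≡.refl
  below-0 (x ∷ l) = below-0 l

  val-0 : ∀ l → val 0 (below 0 l) ≈ 0#
  val-0 l = trans (reflexive (≡.cong (val 0) (below-0 l))) (solve 1 (λ a → :- (a :* con (+ 0) :+ con (+ 0)) := con (+ 0)) refl α)

  ∷-pointwise : ∀ {x y} p → x ≈ y → Pointwise (x ∷ p) (y ∷ p)
  ∷-pointwise p h zero    = h
  ∷-pointwise p h (suc j) = refl

  ev-0-suc : ∀ t m l → length l ≡ length t → ev (0 ∷ t) (suc m ∷ l) ≈ 0#
  ev-0-suc t m l e = trans (β-cong (val 0 (below 0 t) ∷ vals t rs) (0# ∷ vals t rs) (∷-pointwise (vals t rs) (val-0 t)) (suc m ∷ l))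
    (β-0-suc (vals t rs) m l (≡.trans e (≡.sym (length-vals t rs (length-bump 0 t (rank t) (length-rank t))))))
    where rs = bump 0 t (rank t)

  vals-bump-0 : ∀ l rs → Pointwise (map (_+ 1#) (vals l (bump 0 l rs))) (vals l rs)
  vals-bump-0 []      rs       j       = refl
  vals-bump-0 (x ∷ l) []       j       = refl
  vals-bump-0 (x ∷ l) (r ∷ rs) zero    = solve 3 (λ a r o → :- (a :+ (o :+ r)) :+ o := :- (a :+ r)) refl (α * nat x) (nat r) 1#
  vals-bump-0 (x ∷ l) (r ∷ rs) (suc j) = vals-bump-0 l rs j

  ev-0-0 : ∀ t l → length l ≡ length t → ev (0 ∷ t) (0 ∷ l) ≈ ev t l
  ev-0-0 t l e = trans (β-cong (val 0 (below 0 t) ∷ vals t rs) (0# ∷ vals t rs) (∷-pointwise (vals t rs) (val-0 t)) (0 ∷ l))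
    (trans (β-stable (vals t rs) l (≡.trans e (≡.sym (length-vals t rs (length-bump 0 t (rank t) (length-rank t))))))
      (β-cong (map (_+ 1#) (vals t rs)) (bar t) (vals-bump-0 t (rank t)) l))
    where rs = bump 0 t (rank t)

  le-refl : ∀ a → le a a ≡ 1
  le-refl zero    = ≡.refl
  le-refl (suc a) = le-refl a

  lt-irrefl : ∀ a → le (suc a) a ≡ 0
  lt-irrefl zero    = ≡.refl
  lt-irrefl (suc a) = lt-irrefl a

  lt≡le : ∀ a b → a ≢ b → le (suc b) a ≡ le b a
  lt≡le zero    zero    ne = ⊥-elim (ne ≡.refl)
  lt≡le zero    (suc b) ne = ≡.refl
  lt≡le (suc a) zero    ne = ≡.refl
  lt≡le (suc a) (suc b) ne = lt≡le a b (λ e → ne (≡.cong suc e))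

  le-mono : ∀ c {a b} → a ≤ b → le c a ≤ le c b
  le-mono zero    p       = ℕₚ.≤-refl
  le-mono (suc c) z≤n     = z≤n
  le-mono (suc c) (s≤s p) = le-mono c p

  below-mono : ∀ {a b} l → a ≤ b → below a l ≤ below b l
  below-mono []      p = z≤n
  below-mono (x ∷ l) p = ℕₚ.+-mono-≤ (le-mono (suc x) p) (below-mono l p)

  below-swap : ∀ a k l → below a (swap k l) ≡ below a l
  below-swap a k       []          = ≡.refl
  below-swap a zero    (x ∷ [])    = ≡.refl
  below-swap a zero    (x ∷ y ∷ l) = ℕS.solve 3 (λ a b r → b ℕS.:+ (a ℕS.:+ r) ℕS.:= a ℕS.:+ (b ℕS.:+ r)) ≡.refl (le (suc x) a) (le (suc y) a) _
  below-swap a (suc k) (x ∷ l)     = ≡.cong (le (suc x) a ℕ.+_) (below-swap a k l)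

  bump-swap : ∀ a k l rs → length rs ≡ length l → bump a (swap k l) (swap k rs) ≡ swap k (bump a l rs)
  bump-swap a k       []          []           e = ≡.refl
  bump-swap a zero    (x ∷ [])    (r ∷ [])     e = ≡.refl
  bump-swap a zero    (x ∷ y ∷ l) (r ∷ s ∷ rs) e = ≡.refl
  bump-swap a (suc k) (x ∷ l)     (r ∷ rs)     e = ≡.cong (_ ∷_) (bump-swap a k l rs (ℕₚ.suc-injective e))

  rank-swap : ∀ k l → at k l ≢ at (suc k) l → rank (swap k l) ≡ swap k (rank l)
  rank-swap k       []          ne = ≡.refl
  rank-swap zero    (a ∷ [])    ne = ≡.refl
  rank-swap zero    (a ∷ b ∷ l) ne = ≡.cong₂ _∷_
    (≡.cong (ℕ._+ below b l) (lt≡le b a (λ e → ne (≡.sym e))))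
    (≡.cong₂ _∷_ (≡.cong (ℕ._+ below a l) (≡.sym (lt≡le a b ne))) (bump-comm b a l (rank l)))
  rank-swap (suc k) (a ∷ l)     ne = ≡.cong₂ _∷_ (below-swap a k l)
    (≡.trans (≡.cong (bump a (swap k l)) (rank-swap k l ne)) (bump-swap a k l (rank l) (length-rank l)))

  vals-swap : ∀ k l rs → length rs ≡ length l → vals (swap k l) (swap k rs) ≡ swap k (vals l rs)
  vals-swap k       []          []           e = ≡.refl
  vals-swap zero    (x ∷ [])    (r ∷ [])     e = ≡.refl
  vals-swap zero    (x ∷ y ∷ l) (r ∷ s ∷ rs) e = ≡.refl
  vals-swap (suc k) (x ∷ l)     (r ∷ rs)     e = ≡.cong (_ ∷_) (vals-swap k l rs (ℕₚ.suc-injective e))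

  bar-swap : ∀ k l → at k l ≢ at (suc k) l → bar (swap k l) ≡ swap k (bar l)
  bar-swap k l ne = ≡.trans (≡.cong (vals (swap k l)) (rank-swap k l ne)) (vals-swap k l (rank l) (length-rank l))

  at-bump : ∀ a j l rs → j < length l → length rs ≡ length l → at j (bump a l rs) ≡ le a (at j l) ℕ.+ at j rs
  at-bump a zero    (x ∷ l) (r ∷ rs) _       e = ≡.refl
  at-bump a (suc j) (x ∷ l) (r ∷ rs) (s≤s p) e = at-bump a j l rs p (ℕₚ.suc-injective e)

  rank-asc : ∀ k l → suc k < length l → at k l < at (suc k) l → at k (rank l) ≤ at (suc k) (rank l)
  rank-asc zero    (a ∷ [])    (s≤s ()) _
  rank-asc zero    (a ∷ b ∷ l) _ p = ℕₚ.+-mono-≤ (lt-le a b (ℕₚ.<⇒≤ p)) (below-mono l (ℕₚ.<⇒≤ p))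
    where
    lt-le : ∀ a b → a ≤ b → le (suc b) a ≤ le a b
    lt-le zero    b       _       = z≤n
    lt-le (suc a) (suc b) (s≤s p) = lt-le a b p
  rank-asc (suc k) (a ∷ l) (s≤s q) p = ≡.subst₂ _≤_ (≡.sym (at-bump a k l (rank l) (ℕₚ.<-trans (ℕₚ.n<1+n k) q) (length-rank l)))
    (≡.sym (at-bump a (suc k) l (rank l) q (length-rank l))) (ℕₚ.+-mono-≤ (le-mono a (ℕₚ.<⇒≤ p)) (rank-asc k l q p))

  rank-desc : ∀ k l → suc k < length l → at (suc k) l < at k l → at (suc k) (rank l) ≤ at k (rank l)
  rank-desc zero    (a ∷ [])    (s≤s ()) _
  rank-desc zero    (a ∷ b ∷ l) _ p = ℕₚ.+-mono-≤ (≡.subst (le a b ≤_) (≡.sym (lt≡le a b (λ e → ℕₚ.<-irrefl (≡.sym e) p))) (lt-le a b (ℕₚ.<⇒≤ p))) (below-mono l (ℕₚ.<⇒≤ p))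
    where
    lt-le : ∀ a b → b ≤ a → le a b ≤ le b a
    lt-le a zero          _       = le-1 a
      where le-1 : ∀ a → le a 0 ≤ 1
            le-1 zero    = ℕₚ.≤-refl
            le-1 (suc a) = z≤n
    lt-le (suc a) (suc b) (s≤s p) = lt-le a b p
  rank-desc (suc k) (a ∷ l) (s≤s q) p = ≡.subst₂ _≤_ (≡.sym (at-bump a (suc k) l (rank l) q (length-rank l)))
    (≡.sym (at-bump a k l (rank l) (ℕₚ.<-trans (ℕₚ.n<1+n k) q) (length-rank l))) (ℕₚ.+-mono-≤ (le-mono a (ℕₚ.<⇒≤ p)) (rank-desc k l q p))

  rank-tie : ∀ k l → suc k < length l → at k l ≡ at (suc k) l → at (suc k) (rank l) ≡ suc (at k (rank l))
  rank-tie zero    (a ∷ [])    (s≤s ()) _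
  rank-tie zero    (a ∷ b ∷ l) _ ≡.refl = ≡.cong₂ ℕ._+_ (le-refl a) (≡.cong (ℕ._+ below a l) (≡.sym (lt-irrefl a)))
  rank-tie (suc k) (a ∷ l) (s≤s q) p = ≡.trans (at-bump a (suc k) l (rank l) q (length-rank l))
    (≡.trans (≡.cong₂ (λ x r → le a x ℕ.+ r) (≡.sym p) (rank-tie k l q p))
      (≡.trans (ℕₚ.+-suc _ _) (≡.cong suc (≡.sym (at-bump a k l (rank l) (ℕₚ.<-trans (ℕₚ.n<1+n k) q) (length-rank l))))))

  -- Gaps between neighbouring coordinates of a node

  gap : ℕ → List ℕ → K
  gap k ν = pt (suc k) (bar ν) - pt k (bar ν)

  gap-val : ∀ k ν → suc k < length ν →
    gap k ν ≈ val (at (suc k) ν) (at (suc k) (rank ν)) - val (at k ν) (at k (rank ν))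
  gap-val k ν p = +-cong (reflexive (pt-bar (suc k) ν p)) (-‿cong (reflexive (pt-bar k ν (ℕₚ.<-trans (ℕₚ.n<1+n k) p))))

  val-diff : ∀ {a b r s} → a ≤ b → r ≤ s → val a r - val b s ≈ α * nat (b ∸ a) + nat (s ∸ r)
  val-diff {a} {b} {r} {s} p q = begin
    val a r - val b s ≈⟨ +-congˡ (-‿cong (-‿cong (+-cong (*-congˡ (trans (reflexive (≡.cong nat (≡.sym (ℕₚ.m+[n∸m]≡n p)))) (nat-+ a _)))
                          (trans (reflexive (≡.cong nat (≡.sym (ℕₚ.m+[n∸m]≡n q)))) (nat-+ r _))))) ⟩
    _ ≈⟨ solve 5 (λ α a r x y → :- (α :* a :+ r) :- :- (α :* (a :+ x) :+ (r :+ y)) := α :* x :+ y) refl α (nat a) (nat r) (nat (b ∸ a)) (nat (s ∸ r)) ⟩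
    α * nat (b ∸ a) + nat (s ∸ r) ∎

  gap-tie : ∀ k ν → suc k < length ν → at k ν ≡ at (suc k) ν → gap k ν ≈ - 1#
  gap-tie k ν p e = begin
    gap k ν ≈⟨ gap-val k ν p ⟩
    val (at (suc k) ν) (at (suc k) (rank ν)) - val (at k ν) (at k (rank ν))
      ≡⟨ ≡.cong₂ (λ a r → val a r - val (at k ν) (at k (rank ν))) (≡.sym e) (rank-tie k ν p e) ⟩
    val (at k ν) (suc (at k (rank ν))) - val (at k ν) (at k (rank ν))
      ≈⟨ solve 3 (λ x r o → :- (x :+ (o :+ r)) :- :- (x :+ r) := :- o) refl (α * nat (at k ν)) _ 1# ⟩
    - 1# ∎

  -- Equal neighbours have consecutive ranks, so d = -1 in `β-swap` and the term of the swapped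
  -- point drops out.
  ev-tie : ∀ k ν l → length l ≡ length ν → suc k < length ν → at k ν ≡ at (suc k) ν → ev ν (swap k l) ≈ ev ν l
  ev-tie k ν l e p t = begin
    ev ν (swap k l)            ≈⟨ sym (*-identityˡ _) ⟩
    1# * ev ν (swap k l)       ≈⟨ solve 2 (λ o x → o :* x := :- ((:- o) :* x)) refl 1# _ ⟩
    - (- 1# * ev ν (swap k l)) ≈⟨ -‿cong (β-swap k (bar ν) l (≡.trans e (≡.sym (length-bar ν))) (≡.subst (suc k <_) (≡.sym (length-bar ν)) p) (- 1#) (sym (gap-tie k ν p t))) ⟩
    - ((- 1# + 1#) * β (swap k (bar ν)) l - ev ν l)
      ≈⟨ solve 3 (λ o x y → :- ((:- o :+ o) :* x :- y) := y) refl 1# _ _ ⟩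
    ev ν l ∎

  ev-swap : ∀ k ν l → length l ≡ length ν → suc k < length ν → at k ν ≢ at (suc k) ν →
    gap k ν * ev ν (swap k l) ≈ (gap k ν + 1#) * ev (swap k ν) l - ev ν l
  ev-swap k ν l e p ne = trans (β-swap k (bar ν) l (≡.trans e (≡.sym (length-bar ν))) (≡.subst (suc k <_) (≡.sym (length-bar ν)) p) (gap k ν) refl)
    (+-congʳ (*-congˡ (reflexive (≡.cong (λ p → β p l) (≡.sym (bar-swap k ν ne))))))

  -- Cancellation and a weak form of the transcendence of α, which keep the gaps and the hook
  -- factors away from zero.
  record Regular : Set where
    field
      cancel  : ∀ {x y} → ¬ (x ≈ 0#) → x * y ≈ 0# → y ≈ 0#
      nonzero : ∀ p s → 0 < p ℕ.+ s → ¬ (α * nat p + nat s ≈ 0#)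

  module Points (G : Regular) where
    open Regular G

    gap-desc : ∀ k ν → suc k < length ν → at (suc k) ν < at k ν →
      gap k ν ≈ α * nat (at k ν ∸ at (suc k) ν) + nat (at k (rank ν) ∸ at (suc k) (rank ν))
    gap-desc k ν p q = trans (gap-val k ν p) (val-diff (ℕₚ.<⇒≤ q) (rank-desc k ν p q))

    gap≉0 : ∀ k ν → suc k < length ν → at k ν ≢ at (suc k) ν → ¬ (gap k ν ≈ 0#)
    gap≉0 k ν p ne h with ℕₚ.<-cmp (at k ν) (at (suc k) ν)
    ... | tri≈ _ e _ = ne e
    ... | tri> _ _ q = nonzero (at k ν ∸ at (suc k) ν) (at k (rank ν) ∸ at (suc k) (rank ν)) (ℕₚ.<-≤-trans (ℕₚ.m<n⇒0<n∸m q) (ℕₚ.m≤m+n _ _)) (trans (sym (gap-desc k ν p q)) h)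
    ... | tri< q _ _ = nonzero (at (suc k) ν ∸ at k ν) (at (suc k) (rank ν) ∸ at k (rank ν)) (ℕₚ.<-≤-trans (ℕₚ.m<n⇒0<n∸m q) (ℕₚ.m≤m+n _ _)) (begin
      α * nat (at (suc k) ν ∸ at k ν) + nat (at (suc k) (rank ν) ∸ at k (rank ν)) ≈⟨ val-diff (ℕₚ.<⇒≤ q) (rank-asc k ν p q) ⟨
      val (at k ν) (at k (rank ν)) - val (at (suc k) ν) (at (suc k) (rank ν)) ≈⟨ solve 2 (λ x y → x :- y := :- (y :- x)) refl _ _ ⟩
      - (val (at (suc k) ν) (at (suc k) (rank ν)) - val (at k ν) (at k (rank ν))) ≈⟨ -‿cong (trans (sym (gap-val k ν p)) h) ⟩
      - 0# ≈⟨ -0#≈0# ⟩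
      0# ∎)

  -- Linear functionals and the insertion of an entry

  sumTo : ℕ → (ℕ → K) → K
  sumTo zero    f = 0#
  sumTo (suc n) f = sumTo n f + f n

  sumTo-cong : ∀ n {f g} → (∀ j → j < n → f j ≈ g j) → sumTo n f ≈ sumTo n g
  sumTo-cong zero    h = refl
  sumTo-cong (suc n) h = +-cong (sumTo-cong n (λ j p → h j (ℕₚ.m<n⇒m<1+n p))) (h n (ℕₚ.n<1+n n))

  sumTo-exchange : ∀ n k {f g} → suc k < n → (∀ j → j ≢ k → j ≢ suc k → j < n → f j ≈ g j) →
    f k ≈ g (suc k) → f (suc k) ≈ g k → sumTo n f ≈ sumTo n g
  sumTo-exchange (suc n) k {f} {g} p h e₁ e₂ with suc k ℕ.≟ n
  ... | yes ≡.refl = begin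
    sumTo k f + f k + f (suc k) ≈⟨ +-cong (+-cong (sumTo-cong k (λ j q → h j (λ e → ℕₚ.<-irrefl e q) (λ e → ℕₚ.<-irrefl e (ℕₚ.m<n⇒m<1+n q))
                                     (ℕₚ.<-trans q (ℕₚ.<-trans (ℕₚ.n<1+n k) p)))) e₁) e₂ ⟩
    sumTo k g + g (suc k) + g k ≈⟨ solve 3 (λ x y z → x :+ y :+ z := x :+ z :+ y) refl _ _ _ ⟩
    sumTo k g + g k + g (suc k) ∎
  ... | no ne = +-cong (sumTo-exchange n k k<n (λ j a b q → h j a b (ℕₚ.m<n⇒m<1+n q)) e₁ e₂)
                       (h n (λ e → ℕₚ.<-irrefl (≡.sym e) (ℕₚ.<-trans (ℕₚ.n<1+n k) k<n)) (λ e → ne (≡.sym e)) (ℕₚ.n<1+n n))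
    where k<n = ℕₚ.≤∧≢⇒< (ℕₚ.≤-pred p) ne

  -- A polynomial in n variables. The support condition sits in `ext`: only bar monomials of length
  -- n whose size satisfies V matter, so V records a degree or a bound for it.
  record Linear (n : ℕ) (V : ℕ → Set) : Set where
    field
      ⟪_⟫ : Fun → K
      ext : ∀ {φ ψ} → (∀ l → length l ≡ n → V (size l) → φ l ≈ ψ l) → ⟪ φ ⟫ ≈ ⟪ ψ ⟫
      lin : ∀ c d φ ψ → ⟪ (λ l → c * φ l + d * ψ l) ⟫ ≈ c * ⟪ φ ⟫ + d * ⟪ ψ ⟫

    ext′ : ∀ {φ ψ} → (∀ l → length l ≡ n → φ l ≈ ψ l) → ⟪ φ ⟫ ≈ ⟪ ψ ⟫
    ext′ h = ext (λ l e _ → h l e)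

    null : ⟪ (λ _ → 0#) ⟫ ≈ 0#
    null = begin
      ⟪ (λ _ → 0#) ⟫                 ≈⟨ ext′ (λ _ _ → solve 0 (con (+ 0) := con (+ 0) :* con (+ 0) :+ con (+ 0) :* con (+ 0)) refl) ⟩
      ⟪ (λ _ → 0# * 0# + 0# * 0#) ⟫ ≈⟨ lin 0# 0# (λ _ → 0#) (λ _ → 0#) ⟩
      0# * x + 0# * x                ≈⟨ solve 1 (λ x → con (+ 0) :* x :+ con (+ 0) :* x := con (+ 0)) refl x ⟩
      0#                             ∎
      where x = ⟪ (λ _ → 0#) ⟫

    scale : ∀ c φ → ⟪ (λ l → c * φ l) ⟫ ≈ c * ⟪ φ ⟫
    scale c φ = begin
      ⟪ (λ l → c * φ l) ⟫            ≈⟨ ext′ (λ l _ → solve 2 (λ c x → c :* x := c :* x :+ con (+ 0) :* x) refl c (φ l)) ⟩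
      ⟪ (λ l → c * φ l + 0# * φ l) ⟫ ≈⟨ lin c 0# φ φ ⟩
      c * ⟪ φ ⟫ + 0# * ⟪ φ ⟫         ≈⟨ solve 2 (λ c x → c :* x :+ con (+ 0) :* x := c :* x) refl c ⟪ φ ⟫ ⟩
      c * ⟪ φ ⟫                      ∎

    add : ∀ φ ψ → ⟪ (λ l → φ l + ψ l) ⟫ ≈ ⟪ φ ⟫ + ⟪ ψ ⟫
    add φ ψ = trans (ext′ (λ l _ → +-cong (sym (*-identityˡ _)) (sym (*-identityˡ _))))
      (trans (lin 1# 1# φ ψ) (+-cong (*-identityˡ _) (*-identityˡ _)))

    sub : ∀ φ ψ → ⟪ (λ l → φ l - ψ l) ⟫ ≈ ⟪ φ ⟫ - ⟪ ψ ⟫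
    sub φ ψ = trans (ext′ (λ l _ → +-cong (sym (*-identityˡ _)) (neg _))) (trans (lin 1# (- 1#) φ ψ) (+-cong (*-identityˡ _) (sym (neg _))))
      where neg : ∀ x → - x ≈ - 1# * x
            neg x = trans (-‿cong (sym (*-identityˡ x))) (solve 2 (λ o x → :- (o :* x) := :- o :* x) refl 1# x)

    sum : ∀ m (w : ℕ → K) (φ : ℕ → Fun) → ⟪ (λ l → sumTo m (λ j → w j * φ j l)) ⟫ ≈ sumTo m (λ j → w j * ⟪ φ j ⟫)
    sum zero    w φ = null
    sum (suc m) w φ = trans (add (λ l → sumTo m (λ j → w j * φ j l)) (λ l → w m * φ m l)) (+-cong (sum m w φ) (scale (w m) (φ m)))

  -- The cycle s_(j-1) ⋯ s_0, which carries the first entry to position j. These are the coset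
  -- representatives for inserting an entry into a symmetric prefix.
  ch : ℕ → List ℕ → List ℕ
  ch zero    l = l
  ch (suc j) l = swap j (ch j l)

  length-ch : ∀ j l → length (ch j l) ≡ length l
  length-ch zero    l = ≡.refl
  length-ch (suc j) l = ≡.trans (length-swap j (ch j l)) (length-ch j l)

  size-ch : ∀ j l → size (ch j l) ≡ size l
  size-ch zero    l = ≡.refl
  size-ch (suc j) l = ≡.trans (size-swap j (ch j l)) (size-ch j l)

  length-rot : ∀ v → length (rot v) ≡ length v
  length-rot []          = ≡.refl
  length-rot (x ∷ [])    = ≡.refl
  length-rot (x ∷ y ∷ v) = ≡.trans (length-swap 0 (x ∷ rot (y ∷ v))) (≡.cong suc (length-rot (y ∷ v)))

  size-rot : ∀ v → 0 < length v → size (rot v) ≡ suc (size v)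
  size-rot (x ∷ [])    _ = ≡.refl
  size-rot (x ∷ y ∷ v) _ = ≡.trans (size-swap 0 (x ∷ rot (y ∷ v)))
    (≡.trans (≡.cong (x ℕ.+_) (size-rot (y ∷ v) (s≤s z≤n))) (ℕₚ.+-suc x _))

  swap-comm : ∀ i k (l : List ℕ) → suc i < k → swap k (swap i l) ≡ swap i (swap k l)
  swap-comm i       k             []                _ = ≡.refl
  swap-comm zero    (suc (suc k)) (a ∷ [])          _ = ≡.refl
  swap-comm zero    (suc (suc k)) (a ∷ b ∷ l)       _ = ≡.refl
  swap-comm (suc i) (suc k)       (a ∷ l)     (s≤s p) = ≡.cong (a ∷_) (swap-comm i k l p)
  swap-comm zero    (suc zero)    (a ∷ l)     (s≤s ())

  swap-braid : ∀ k (l : List ℕ) → suc (suc k) < length l →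
    swap k (swap (suc k) (swap k l)) ≡ swap (suc k) (swap k (swap (suc k) l))
  swap-braid zero    (a ∷ b ∷ c ∷ l) _       = ≡.refl
  swap-braid zero    (a ∷ [])        (s≤s ())
  swap-braid zero    (a ∷ b ∷ [])    (s≤s (s≤s ()))
  swap-braid (suc k) (a ∷ l)         (s≤s p) = ≡.cong (a ∷_) (swap-braid k l p)

  ch-swap> : ∀ j k l → j < k → swap k (ch j l) ≡ ch j (swap k l)
  ch-swap> zero    k l p = ≡.refl
  ch-swap> (suc j) k l p = ≡.trans (swap-comm j k (ch j l) p) (≡.cong (swap j) (ch-swap> j k l (ℕₚ.<-trans (ℕₚ.n<1+n j) p)))

  ch-swap< : ∀ j k l → suc k < j → j < length l → swap k (ch j l) ≡ ch j (swap (suc k) l)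
  ch-swap< (suc j) k l (s≤s k<j) p with suc k ℕ.≟ j
  ... | yes ≡.refl = ≡.trans (swap-braid k (ch k l) (≡.subst (suc (suc k) <_) (≡.sym (length-ch k l)) p))
                       (≡.cong (swap (suc k) ∘ swap k) (ch-swap> k (suc k) l (ℕₚ.n<1+n k)))
  ... | no ne = ≡.trans (≡.sym (swap-comm k j (ch j l) k<j′))
                  (≡.cong (swap j) (ch-swap< j k l k<j′ (ℕₚ.<-trans (ℕₚ.n<1+n j) p)))
    where k<j′ : suc k < j
          k<j′ = ℕₚ.≤∧≢⇒< k<j ne

  swap-∷ʳ : ∀ m (t : List ℕ) c → suc m < length t → swap m (t ++ c ∷ []) ≡ swap m t ++ c ∷ []
  swap-∷ʳ zero    (a ∷ b ∷ t) c _       = ≡.refl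
  swap-∷ʳ zero    (a ∷ [])    c (s≤s ())
  swap-∷ʳ (suc m) (a ∷ t)     c (s≤s p) = ≡.cong (a ∷_) (swap-∷ʳ m t c p)

  rot-swap : ∀ m v → suc (suc m) < length v → swap (suc m) (rot v) ≡ rot (swap m v)
  rot-swap m v p with initLast v
  ... | t ∷ʳ′ c = ≡.trans (≡.cong (swap (suc m)) (rot-∷ʳ t c))
    (≡.sym (≡.trans (≡.cong rot (swap-∷ʳ m t c (ℕₚ.≤-pred (≡.subst (suc (suc m) <_) (length-∷ʳ t c) p)))) (rot-∷ʳ (swap m t) c)))

  -- Acting on test functions, this is the transpose of an insertion: the last entry is raised,
  -- rotated to the front and distributed over the first J positions with weights w.
  hat : ℕ → (ℕ → K) → Fun → Fun
  hat J w φ v = sumTo J (λ j → w j * φ (ch j (rot v)))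

  hat-lin : ∀ c d φ ψ J w v → hat J w (λ l → c * φ l + d * ψ l) v ≈ c * hat J w φ v + d * hat J w ψ v
  hat-lin c d φ ψ zero    w v = solve 2 (λ c d → con (+ 0) := c :* con (+ 0) :+ d :* con (+ 0)) refl c d
  hat-lin c d φ ψ (suc J) w v = trans (+-congʳ (hat-lin c d φ ψ J w v))
    (solve 7 (λ c d x y w p q → c :* x :+ d :* y :+ w :* (c :* p :+ d :* q) := c :* (x :+ w :* p) :+ d :* (y :+ w :* q)) refl c d _ _ (w J) _ _)

  lift : ∀ {n} {V W : ℕ → Set} → 0 < n → (∀ {s} → V s → W (suc s)) → Linear n V → ℕ → (ℕ → K) → Linear n W
  lift {n} {V} {W} n>0 up F J w = record
    { ⟪_⟫ = λ φ → ⟪ hat J w φ ⟫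
    ; ext = λ {φ} {ψ} h → ext (λ v e s → sumTo-cong J (λ j _ → *-congˡ (h (ch j (rot v))
        (≡.trans (length-ch j (rot v)) (≡.trans (length-rot v) e))
        (≡.subst W (≡.sym (≡.trans (size-ch j (rot v)) (size-rot v (≡.subst (0 <_) (≡.sym e) n>0)))) (up s)))))
    ; lin = λ c d φ ψ → trans (ext′ (λ v _ → hat-lin c d φ ψ J w v)) (lin c d (hat J w φ) (hat J w ψ))
    }
    where open Linear F

  module Insert {n V} (F : Linear n V) (q : ℕ) (q<n : q < n)
    (F-sym : ∀ m → suc m < q → ∀ φ → Linear.⟪_⟫ F (λ l → φ (swap m l)) ≈ Linear.⟪_⟫ F φ) where
    open Linear F

    g : ℕ → Fun → K
    g j φ = ⟪ (λ v → φ (ch j (rot v))) ⟫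

    g-sym> : ∀ j k φ → j < k → k < q → g j (λ l → φ (swap k l)) ≈ g j φ
    g-sym> j (suc m) φ p r = trans
      (ext′ (λ v e → reflexive (≡.cong φ (≡.trans (ch-swap> j (suc m) (rot v) p)
        (≡.cong (ch j) (rot-swap m v (≡.subst (suc (suc m) <_) (≡.sym e) (ℕₚ.≤-<-trans r q<n))))))))
      (F-sym m r (λ v → φ (ch j (rot v))))

    g-sym< : ∀ j k φ → suc k < j → j ≤ q → g j (λ l → φ (swap k l)) ≈ g j φ
    g-sym< j k φ p r = trans
      (ext′ (λ v e → reflexive (≡.cong φ (≡.trans (ch-swap< j k (rot v) p
          (≡.subst (j <_) (≡.sym (≡.trans (length-rot v) e)) (ℕₚ.≤-<-trans r q<n)))
        (≡.cong (ch j) (rot-swap k v (≡.subst (suc (suc k) <_) (≡.sym e) (ℕₚ.≤-<-trans p (ℕₚ.≤-<-trans r q<n)))))))))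
      (F-sym k (ℕₚ.<-≤-trans p r) (λ v → φ (ch j (rot v))))

    g-invol : ∀ k φ → g (suc k) (λ l → φ (swap k l)) ≈ g k φ
    g-invol k φ = ext′ (λ v _ → reflexive (≡.cong φ (swap-invol k (ch k (rot v)))))

    hat-sum : ∀ J w φ → ⟪ hat J w φ ⟫ ≈ sumTo J (λ j → w j * g j φ)
    hat-sum J w φ = sum J w (λ j v → φ (ch j (rot v)))

    -- The swap exchanges the terms k and suc k of the sum, and passes through `ch j` in every other
    -- term to become a swap inside the prefix, where F is symmetric.
    hat-sym : ∀ J w k φ → suc k < J → J ≤ suc q → w k ≈ w (suc k) →
      ⟪ hat J w (λ l → φ (swap k l)) ⟫ ≈ ⟪ hat J w φ ⟫
    hat-sym J w k φ p r e = trans (hat-sum J w (λ l → φ (swap k l))) (trans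
      (sumTo-exchange J k {λ j → w j * g j (λ l → φ (swap k l))} {λ j → w j * g j φ} p other (*-congʳ e) (*-cong (sym e) (g-invol k φ)))
      (sym (hat-sum J w φ)))
      where
      other : ∀ j → j ≢ k → j ≢ suc k → j < J → w j * g j (λ l → φ (swap k l)) ≈ w j * g j φ
      other j a b j< with ℕₚ.<-cmp j k
      ... | tri< j<k _ _ = *-congˡ (g-sym> j k φ j<k (ℕₚ.≤-pred (ℕₚ.<-≤-trans p r)))
      ... | tri≈ _ j≡k _ = ⊥-elim (a j≡k)
      ... | tri> _ _ k<j = *-congˡ (g-sym< j k φ (ℕₚ.≤∧≢⇒< k<j (λ e → b (≡.sym e))) (ℕₚ.≤-pred (ℕₚ.≤-trans j< r)))

  wt : ℕ → K → ℕ → K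
  wt zero    a j       = a
  wt (suc q) a zero    = 1#
  wt (suc q) a (suc j) = wt q a j

  wt< : ∀ q a j → j < q → wt q a j ≡ 1#
  wt< (suc q) a zero    p       = ≡.refl
  wt< (suc q) a (suc j) (s≤s p) = wt< q a j p

  wt-top : ∀ q a → wt q a q ≡ a
  wt-top zero    a = ≡.refl
  wt-top (suc q) a = wt-top q a

  -- The first q entries of the exponent are zero and b is still to be built: zero∷ moves a zero into the prefix, and
  -- step takes off a rotation, which turns the last entry c into the first entry suc c.
  data Build (n : ℕ) : ℕ → List ℕ → Set where
    nil   : ∀ {q} → q ≡ n → Build n q []
    zero∷ : ∀ {q t} → Build n (suc q) t → Build n q (0 ∷ t)
    step  : ∀ {q c t b} → b ≡ t ++ c ∷ [] → Build n q b → Build n q (suc c ∷ t)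

  -- The quantity `dc 0` of `Step`: for a nonempty zero prefix, the gap met when the new entry
  -- passes its last zero. With q added for the weights one it becomes a hook factor, see
  -- `factor-column`.
  top : ℕ → List ℕ → K
  top c t = α * nat (suc c) + nat (suc (below (suc c) t))

  Build-length : ∀ {n q b} → Build n q b → q ℕ.+ length b ≡ n
  Build-length (nil e)   = ≡.trans (ℕₚ.+-identityʳ _) e
  Build-length (zero∷ d) = ≡.trans (ℕₚ.+-suc _ _) (Build-length d)
  Build-length {q = q} (step {_} {c} {t} ≡.refl d) = ≡.trans (≡.cong (q ℕ.+_) (≡.sym (length-∷ʳ t c))) (Build-length d)

  Build-q<n : ∀ {n q b} {c t} → b ≡ t ++ c ∷ [] → Build n q b → q < n
  Build-q<n {n} {q} {_} {c} {t} ≡.refl d = ≡.subst (q <_) (Build-length d)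
    (≡.subst (λ m → q < q ℕ.+ m) (≡.sym (length-∷ʳ t c)) (≡.subst (q <_) (≡.sym (ℕₚ.+-suc q _)) (s≤s (ℕₚ.m≤m+n q _))))

  -- By `E-sym` and `E-van`, a multiple of the interpolation polynomial of the exponent zeros q ++
  -- b, symmetric in the first q variables. Moving a zero into the list just forgets part of the
  -- symmetry, so it leaves the functional as it is.
  𝔼 : ∀ {n q b} → Build n q b → Linear n (_≡ size b)
  𝔼 {n} (nil e)       = record
    { ⟪_⟫ = λ φ → φ (zeros n) ; ext = λ h → h (zeros n) (Listₚ.length-replicate n) (size-zeros n) ; lin = λ _ _ _ _ → refl }
  𝔼 (zero∷ d)         = 𝔼 d
  𝔼 {n} {q} (step {_} {c} {t} e d) =
    lift (ℕₚ.≤-<-trans z≤n (Build-q<n {c = c} {t} e d)) (λ eq → ≡.cong suc (≡.trans eq (≡.trans (≡.cong size e) (size-∷ʳ t c))))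
      (𝔼 d) (suc q) (wt q (top c t))

  E : ∀ {n q b} → Build n q b → Fun → K
  E d = Linear.⟪_⟫ (𝔼 d)

  Symmetric : ∀ {n V} → Linear n V → ℕ → Set
  Symmetric F q = ∀ k → suc k < q → ∀ φ → Linear.⟪_⟫ F (λ l → φ (swap k l)) ≈ Linear.⟪_⟫ F φ

  E-sym : ∀ {n q b} (d : Build n q b) → Symmetric (𝔼 d) q
  E-sym {n} (nil _) k p φ = reflexive (≡.cong φ (swap-zeros k n))
  E-sym (zero∷ d) k p φ = E-sym d k (ℕₚ.m<n⇒m<1+n p) φ
  E-sym {n} {q} (step {_} {c} {t} ≡.refl d) k p φ = Insert.hat-sym (𝔼 d) q (Build-q<n {c = c} {t} ≡.refl d) (E-sym d) (suc q) (wt q (top c t)) k φ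
    (ℕₚ.m<n⇒m<1+n p) ℕₚ.≤-refl (reflexive (≡.trans (wt< q _ k (ℕₚ.<-trans (ℕₚ.n<1+n k) p)) (≡.sym (wt< q _ (suc k) p))))

  module EPositive (C : Cone) where
    open Cone C
    open Positivity C using (pos-nat)

    pos-hat : ∀ J w φ → (∀ j → j < J → Pos (w j)) → (∀ l → Pos (φ l)) → ∀ v → Pos (hat J w φ v)
    pos-hat zero    w φ hw h v = pos-0
    pos-hat (suc J) w φ hw h v = pos-+ (pos-hat J w φ (λ j p → hw j (ℕₚ.m<n⇒m<1+n p)) h v) (pos-* (hw J ℕₚ.≤-refl) (h _))

    pos-E : ∀ {n q b} (d : Build n q b) φ → (∀ l → Pos (φ l)) → Pos (E d φ)
    pos-E (nil _)   φ h = h _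
    pos-E (zero∷ d) φ h = pos-E d φ h
    pos-E {q = q} (step {_} {c} {t} _ d) φ h = pos-E d _ (pos-hat (suc q) (wt q (top c t)) φ (pos-wt q) h)
      where
      pos-wt : ∀ q j → j < suc q → Pos (wt q (top c t) j)
      pos-wt zero    j       _       = pos-+ (pos-* pos-α (pos-nat (suc c))) (pos-nat (suc (below (suc c) t)))
      pos-wt (suc q) zero    _       = pos-1
      pos-wt (suc q) (suc j) (s≤s p) = pos-wt q j p

  -- Vanishing of the functionals at the nodes

  zeros-∷ : ∀ q t → zeros q ++ 0 ∷ t ≡ 0 ∷ zeros q ++ t
  zeros-∷ zero    t = ≡.refl
  zeros-∷ (suc q) t = ≡.cong (0 ∷_) (zeros-∷ q t)

  single : ℕ → ℕ → ℕ → List ℕ → List ℕ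
  single J m c t = zeros J ++ suc c ∷ zeros m ++ t

  single-size : ∀ J m c t → length (single J m c t) ≡ suc (J ℕ.+ m ℕ.+ length t)
  single-size zero    m c t = ≡.cong suc (≡.trans (Listₚ.length-++ (zeros m)) (≡.cong (ℕ._+ length t) (Listₚ.length-replicate m)))
  single-size (suc J) m c t = ≡.cong suc (single-size J m c t)

  at-single : ∀ J m c t → at J (single J m c t) ≡ suc c
  at-single zero    m c t = ≡.refl
  at-single (suc J) m c t = at-single J m c t

  at-single-suc : ∀ J m c t → at (suc J) (single J (suc m) c t) ≡ 0
  at-single-suc zero    m c t = ≡.refl
  at-single-suc (suc J) m c t = at-single-suc J m c t

  swap-single : ∀ J m c t → swap J (single J (suc m) c t) ≡ single (suc J) m c t
  swap-single zero    m c t = ≡.refl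
  swap-single (suc J) m c t = ≡.cong (0 ∷_) (swap-single J m c t)

  below-zeros : ∀ a m t → below (suc a) (zeros m ++ t) ≡ m ℕ.+ below (suc a) t
  below-zeros a zero    t = ≡.refl
  below-zeros a (suc m) t = ≡.cong suc (below-zeros a m t)

  rank-single : ∀ J m c t → at J (rank (single J m c t)) ≡ J ℕ.+ (m ℕ.+ below (suc c) t)
  rank-single zero    m c t = below-zeros c m t
  rank-single (suc J) m c t = ≡.trans (at-bump 0 J (single J m c t) (rank (single J m c t))
    (≡.subst (J <_) (≡.sym (single-size J m c t)) (s≤s (ℕₚ.≤-trans (ℕₚ.m≤m+n J m) (ℕₚ.m≤m+n _ _)))) (length-rank (single J m c t)))
    (≡.cong suc (rank-single J m c t))

  rank-single-suc : ∀ J m c t → at (suc J) (rank (single J (suc m) c t)) ≡ J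
  rank-single-suc zero    m c t = below-0 (zeros m ++ t)
  rank-single-suc (suc J) m c t = ≡.trans (at-bump 0 (suc J) l (rank l)
    (≡.subst (suc J <_) (≡.sym (single-size J (suc m) c t)) (s≤s (ℕₚ.≤-trans (ℕₚ.≤-trans (s≤s (ℕₚ.m≤m+n J m)) (ℕₚ.≤-reflexive (≡.sym (ℕₚ.+-suc J m)))) (ℕₚ.m≤m+n _ _)))) (length-rank l))
    (≡.cong suc (rank-single-suc J m c t))
    where l = single J (suc m) c t

  -- A node that starts with zero kills every rotated exponent. Otherwise `ev-rot` leads to the node
  -- with its first entry lowered and moved to the end, where the hypothesis applies.
  rot-van : ∀ {n V} (F : Linear n V) → 0 < n → ∀ ν → length ν ≡ n →
    (∀ m ν′ → ν ≡ suc m ∷ ν′ → Linear.⟪_⟫ F (ev (ν′ ++ m ∷ [])) ≈ 0#) → Linear.⟪_⟫ F (λ v → ev ν (rot v)) ≈ 0#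
  rot-van F n>0 []          e h = ⊥-elim (ℕₚ.<⇒≢ n>0 e)
  rot-van {n} F n>0 (zero ∷ ν)  e h = trans (ext′ on) null
    where
    open Linear F
    on : ∀ v → length v ≡ n → ev (0 ∷ ν) (rot v) ≈ 0#
    on v e′ with initLast v
    ... | [] = ⊥-elim (ℕₚ.1+n≢0 (≡.trans e (≡.sym e′)))
    ... | v ∷ʳ′ k = trans (reflexive (≡.cong (ev (0 ∷ ν)) (rot-∷ʳ v k)))
      (ev-0-suc ν k v (ℕₚ.suc-injective (≡.trans (≡.sym (length-∷ʳ v k)) (≡.trans e′ (≡.sym e)))))
  rot-van {n} F n>0 (suc m ∷ ν) e h =
    trans (ext′ on) (trans (scale x (ev (ν ++ m ∷ []))) (trans (*-congˡ (h m ν ≡.refl)) (zeroʳ x)))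
    where
    open Linear F
    x = val (suc m) (below (suc m) ν)
    on : ∀ v → length v ≡ n → ev (suc m ∷ ν) (rot v) ≈ x * ev (ν ++ m ∷ []) v
    on v e′ with initLast v
    ... | [] = ⊥-elim (ℕₚ.1+n≢0 (≡.trans e (≡.sym e′)))
    ... | v ∷ʳ′ k = trans (reflexive (≡.cong (ev (suc m ∷ ν)) (rot-∷ʳ v k)))
      (ev-rot m ν k v (ℕₚ.suc-injective (≡.trans (≡.sym (length-∷ʳ v k)) (≡.trans e′ (≡.sym e)))))

  ev-exchange : ∀ {n V} (F : Linear n V) k ν → length ν ≡ n → suc k < n → at k ν ≢ at (suc k) ν →
    gap k ν * Linear.⟪_⟫ F (λ l → ev ν (swap k l)) ≈ (gap k ν + 1#) * Linear.⟪_⟫ F (ev (swap k ν)) - Linear.⟪_⟫ F (ev ν)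
  ev-exchange F k ν e p ne = begin
    γ * ⟪ (λ l → ev ν (swap k l)) ⟫ ≈⟨ scale γ (λ l → ev ν (swap k l)) ⟨
    ⟪ (λ l → γ * ev ν (swap k l)) ⟫
      ≈⟨ ext′ (λ l e′ → ev-swap k ν l (≡.trans e′ (≡.sym e)) (≡.subst (suc k <_) (≡.sym e) p) ne) ⟩
    ⟪ (λ l → (γ + 1#) * ev (swap k ν) l - ev ν l) ⟫ ≈⟨ sub (λ l → (γ + 1#) * ev (swap k ν) l) (ev ν) ⟩
    ⟪ (λ l → (γ + 1#) * ev (swap k ν) l) ⟫ - ⟪ ev ν ⟫ ≈⟨ +-congʳ (scale (γ + 1#) (ev (swap k ν))) ⟩
    (γ + 1#) * ⟪ ev (swap k ν) ⟫ - ⟪ ev ν ⟫ ∎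
    where
    open Linear F
    γ = gap k ν

  module Vanish (G : Regular) where
    open Regular G
    open Points G

    -- On a tie the swap does nothing; otherwise the exchange relation has a nonzero gap in front of
    -- the wanted value.
    swap-van : ∀ {n V} (F : Linear n V) k ν → length ν ≡ n → suc k < n →
      Linear.⟪_⟫ F (ev ν) ≈ 0# → Linear.⟪_⟫ F (ev (swap k ν)) ≈ 0# → Linear.⟪_⟫ F (λ l → ev ν (swap k l)) ≈ 0#
    swap-van F k ν e p h h′ with at k ν ℕ.≟ at (suc k) ν
    ... | yes tie = trans (Linear.ext′ F (λ l e′ → ev-tie k ν l (≡.trans e′ (≡.sym e)) (≡.subst (suc k <_) (≡.sym e) p) tie)) h
    ... | no ¬tie = cancel (gap≉0 k ν (≡.subst (suc k <_) (≡.sym e) p) ¬tie)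
      (trans (ev-exchange F k ν e p ¬tie) (trans (+-cong (*-congˡ h′) (-‿cong h)) (solve 1 (λ x → x :* con (+ 0) :- con (+ 0) := con (+ 0)) refl _)))

    module Step {n s} (F : Linear n (_≡ s)) (q c : ℕ) (t : List ℕ) (q<n : q < n) (F-sym : Symmetric F q)
      (F-van : ∀ ν → length ν ≡ n → size ν ≤ c ℕ.+ size t → ν ≢ (zeros q ++ t) ++ c ∷ [] → Linear.⟪_⟫ F (ev ν) ≈ 0#) where
      open Linear F
      open Insert F q q<n F-sym

      b = below (suc c) t

      -- The gap at position J of the node `single J (suc m) c t`, the same for every J. It grows by
      -- one with m.
      dc : ℕ → K
      dc m = α * nat (suc c) + nat (suc (m ℕ.+ b))

      -- By `h-van` its only surviving node of admissible size is `single J m c t`: the new entry at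
      -- position J of the zero prefix, with m zeros after it. Up to a scalar it arises from the
      -- rotation by applying s + 1/gap once for each position passed.
      h : ℕ → ℕ → Fun → K
      h J m φ = sumTo J (λ i → g i φ) + dc m * g J φ

      -- The intertwiner without its denominator. It rests on dc (suc m) = dc m + 1 and on the first
      -- J terms being blind to the swap at J, which acts inside the symmetric prefix.
      h-step : ∀ J m φ → suc J ℕ.+ m ≡ q → dc (suc m) * h (suc J) m φ ≈ dc m * h J (suc m) (λ l → φ (swap J l)) + h J (suc m) φ
      h-step J m φ e = begin
        dc (suc m) * (A + B + dc m * C)
          ≈⟨ solve 7 (λ p r o A B C z → (p :+ (o :+ r)) :* (A :+ B :+ (p :+ r) :* C) :=
               (p :+ r) :* (A :+ (p :+ (o :+ r)) :* C) :+ (o :* A :+ (p :+ (o :+ r)) :* B) :+ z :* con (+ 0)) refl (α * nat (suc c)) (nat (suc (m ℕ.+ b))) 1# A B C 0# ⟩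
        dc m * (A + dc (suc m) * C) + (1# * A + dc (suc m) * B) + 0# * 0# ≈⟨ +-cong (+-cong (*-congˡ (+-congʳ A≈)) (+-congʳ (*-identityˡ A))) (zeroˡ 0#) ⟩
        dc m * (A′ + dc (suc m) * C) + (A + dc (suc m) * B) + 0#          ≈⟨ +-identityʳ _ ⟩
        dc m * h J (suc m) (λ l → φ (swap J l)) + h J (suc m) φ           ∎
        where
        A = sumTo J (λ i → g i φ)
        A′ = sumTo J (λ i → g i (λ l → φ (swap J l)))
        B = g J φ
        C = g (suc J) φ
        A≈ : A ≈ A′
        A≈ = sumTo-cong J (λ i p → sym (g-sym> i J φ p (≡.subst (J <_) e (s≤s (ℕₚ.m≤m+n J m)))))

      dc≉0 : ∀ m → ¬ (dc m ≈ 0#)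
      dc≉0 m = nonzero (suc c) (suc (m ℕ.+ b)) (s≤s z≤n)

      H : ℕ → ℕ → Linear n (λ _ → ⊤)
      H J m = record
        { ⟪_⟫ = h J m
        ; ext = λ eq → let g-cong = λ i → ext′ (λ v e → eq (ch i (rot v)) (≡.trans (length-ch i (rot v)) (≡.trans (length-rot v) e)) tt)
                       in +-cong (sumTo-cong J (λ i _ → g-cong i)) (*-congˡ (g-cong J))
        ; lin = λ x y φ ψ → trans (+-cong (sums x y φ ψ J) (*-congˡ (g-lin x y φ ψ J)))
            (solve 7 (λ x y A B d C D → (x :* A :+ y :* B) :+ d :* (x :* C :+ y :* D) := x :* (A :+ d :* C) :+ y :* (B :+ d :* D)) refl x y _ _ (dc m) _ _)
        }
        where
        g-lin : ∀ x y φ ψ i → g i (λ l → x * φ l + y * ψ l) ≈ x * g i φ + y * g i ψ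
        g-lin x y φ ψ i = lin x y (λ v → φ (ch i (rot v))) (λ v → ψ (ch i (rot v)))
        sums : ∀ x y φ ψ J → sumTo J (λ i → g i (λ l → x * φ l + y * ψ l)) ≈ x * sumTo J (λ i → g i φ) + y * sumTo J (λ i → g i ψ)
        sums x y φ ψ zero    = solve 2 (λ x y → con (+ 0) := x :* con (+ 0) :+ y :* con (+ 0)) refl x y
        sums x y φ ψ (suc J) = trans (+-cong (sums x y φ ψ J) (g-lin x y φ ψ J))
          (solve 6 (λ x y A B C D → (x :* A :+ y :* B) :+ (x :* C :+ y :* D) := x :* (A :+ C) :+ y :* (B :+ D)) refl x y _ _ _ _)

      h-van₀ : ∀ ν → length ν ≡ n → size ν ≤ suc c ℕ.+ size t → ν ≢ single 0 q c t → h 0 q (ev ν) ≈ 0#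
      h-van₀ ν e s ne = trans (+-identityˡ _) (trans (*-congˡ (rot-van F (ℕₚ.≤-<-trans z≤n q<n) ν e below₁)) (zeroʳ _))
        where
        below₁ : ∀ m ν′ → ν ≡ suc m ∷ ν′ → ⟪ ev (ν′ ++ m ∷ []) ⟫ ≈ 0#
        below₁ m ν′ ≡.refl = F-van (ν′ ++ m ∷ []) (≡.trans (length-∷ʳ ν′ m) e) (≡.subst (_≤ c ℕ.+ size t) (≡.sym (size-∷ʳ ν′ m)) (ℕₚ.≤-pred s)) ne′
          where
          ne′ : ν′ ++ m ∷ [] ≢ (zeros q ++ t) ++ c ∷ []
          ne′ eq with Listₚ.∷ʳ-injective ν′ (zeros q ++ t) eq
          ... | ≡.refl , ≡.refl = ne ≡.refl

      h-van : ∀ J m → J ℕ.+ m ≡ q → ∀ ν → length ν ≡ n → size ν ≤ suc c ℕ.+ size t → ν ≢ single J m c t → h J m (ev ν) ≈ 0#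
      h-van zero    m ≡.refl ν e s ne = h-van₀ ν e s ne
      h-van (suc J) m eq ν e s ne = cancel (dc≉0 (suc m)) (trans (h-step J m (ev ν) eq) combined)
        where
        IH : ∀ ν → length ν ≡ n → size ν ≤ suc c ℕ.+ size t → ν ≢ single J (suc m) c t → h J (suc m) (ev ν) ≈ 0#
        IH = h-van J (suc m) (≡.trans (ℕₚ.+-suc J m) eq)
        SJ<n : suc J < n
        SJ<n = ℕₚ.≤-<-trans (≡.subst (suc J ≤_) eq (ℕₚ.m≤m+n (suc J) m)) q<n
        z+z : dc m * 0# + 0# ≈ 0#
        z+z = trans (+-identityʳ _) (zeroʳ _)
        swapped : h J (suc m) (ev (swap J ν)) ≈ 0#
        swapped = IH (swap J ν) (≡.trans (length-swap J ν) e) (≡.subst (_≤ _) (≡.sym (size-swap J ν)) s)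
          (λ e₁ → ne (≡.trans (≡.sym (swap-invol J ν)) (≡.trans (≡.cong (swap J) e₁) (swap-single J m c t))))
        combined : dc m * h J (suc m) (λ l → ev ν (swap J l)) + h J (suc m) (ev ν) ≈ 0#
        combined with Listₚ.≡-dec ℕ._≟_ ν (single J (suc m) c t)
        ... | no ne′ = trans (+-cong (*-congˡ (swap-van (H J (suc m)) J ν e SJ<n (IH ν e s ne′) swapped)) (IH ν e s ne′)) z+z
        -- At the one surviving node the gap is exactly dc m, so the exchange relation produces the
        -- negative of the second summand.
        ... | yes ≡.refl = begin
          dc m * h J (suc m) (λ l → ev ν (swap J l)) + h J (suc m) (ev ν) ≈⟨ +-congʳ (*-congʳ (sym gap≈)) ⟩
          gap J ν * h J (suc m) (λ l → ev ν (swap J l)) + h J (suc m) (ev ν) ≈⟨ +-congʳ (trans (ev-exchange (H J (suc m)) J ν e SJ<n ¬tie) (+-congʳ (*-congˡ swapped))) ⟩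
          (gap J ν + 1#) * 0# - h J (suc m) (ev ν) + h J (suc m) (ev ν) ≈⟨ solve 2 (λ x y → x :* con (+ 0) :- y :+ y := con (+ 0)) refl _ _ ⟩
          0# ∎
          where
          ¬tie : at J ν ≢ at (suc J) ν
          ¬tie tie = ℕₚ.1+n≢0 (≡.trans (≡.sym (at-single J (suc m) c t)) (≡.trans tie (at-single-suc J m c t)))
          gap≈ : gap J ν ≈ dc m
          gap≈ = trans (gap-desc J ν (≡.subst (suc J <_) (≡.sym e) SJ<n) (≡.subst₂ _<_ (≡.sym (at-single-suc J m c t)) (≡.sym (at-single J (suc m) c t)) (s≤s z≤n)))
            (+-cong (*-congˡ (reflexive (≡.cong nat (≡.cong₂ _∸_ (at-single J (suc m) c t) (at-single-suc J m c t)))))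
              (reflexive (≡.cong nat (≡.trans (≡.cong₂ _∸_ (rank-single J (suc m) c t) (rank-single-suc J m c t)) (ℕₚ.m+n∸m≡n J _)))))

    E-van : ∀ {n q b} (d : Build n q b) ν → length ν ≡ n → size ν ≤ size b → ν ≢ zeros q ++ b → E d (ev ν) ≈ 0#
    E-van (nil ≡.refl) ν e s ne = ⊥-elim (ne (≡.trans (size≡0⇒zeros ν (ℕₚ.n≤0⇒n≡0 s))
      (≡.trans (≡.cong zeros e) (≡.sym (Listₚ.++-identityʳ _)))))
    E-van {q = q} (zero∷ {t = t} d) ν e s ne = E-van d ν e s (λ e₁ → ne (≡.trans e₁ (≡.sym (zeros-∷ q t))))
    E-van {n} {q} (step {_} {c} {t} ≡.refl d) ν e s ne = trans (hat-sum (suc q) (wt q (top c t)) (ev ν))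
      -- The weights of `wt` are those of `h q 0`: the new entry has passed the whole zero prefix.
      (trans (+-cong (sumTo-cong q (λ j p → trans (*-congʳ (reflexive (wt< q _ j p))) (*-identityˡ _))) (*-congʳ (reflexive (wt-top q _))))
        (h-van q 0 (ℕₚ.+-identityʳ q) ν e s ne))
      where
      q<n = Build-q<n {c = c} {t} ≡.refl d
      open Insert (𝔼 d) q q<n (E-sym d) using (hat-sum)
      open Step (𝔼 d) q c t q<n (E-sym d)
        (λ ν e s ne → E-van d ν e (≡.subst (size ν ≤_) (≡.sym (size-∷ʳ t c)) s) (λ e₁ → ne (≡.trans e₁ (≡.sym (Listₚ.++-assoc (zeros q) t (c ∷ []))))))

  -- Symmetrisation in all variables

  open import Data.List.Relation.Binary.Permutation.Propositional using (_↭_; prep; ↭-refl; ↭-sym; ↭-trans)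
  import Data.List.Relation.Binary.Permutation.Propositional as Perm
  open import Data.List.Relation.Binary.Permutation.Propositional.Properties using (↭-length; shift; All-resp-↭; drop-∷; ↭-reverse; ++-comm; ++⁺ʳ; map⁺)

  swap-++ : ∀ k (u w : List ℕ) → suc k < length u → swap k (u ++ w) ≡ swap k u ++ w
  swap-++ zero    (a ∷ b ∷ u) w p       = ≡.refl
  swap-++ zero    (a ∷ [])    w (s≤s ())
  swap-++ (suc k) (a ∷ u)     w (s≤s p) = ≡.cong (a ∷_) (swap-++ k u w p)

  swap-↭ : ∀ k (l : List ℕ) → swap k l ↭ l
  swap-↭ k       []          = ↭-refl
  swap-↭ zero    (a ∷ [])    = ↭-refl
  swap-↭ zero    (a ∷ b ∷ l) = Perm.swap b a ↭-refl
  swap-↭ (suc k) (a ∷ l)     = prep a (swap-↭ k l)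

  ones : ℕ → K
  ones _ = 1#

  -- The m remaining entries are raised and shuffled into the prefix one by one, which adds the
  -- first column of the diagram. All weights are one: a symmetric polynomial has only to vanish off
  -- a whole orbit, so no single position needs correcting.
  Shuffle : ℕ → ℕ → Fun → Fun
  Shuffle q zero    φ = φ
  Shuffle q (suc m) φ = hat (suc q) ones (Shuffle (suc q) m φ)

  q<q+suc : ∀ q m {n} → q ℕ.+ suc m ≡ n → q < n
  q<q+suc q m ≡.refl = ≡.subst (q <_) (≡.sym (ℕₚ.+-suc q m)) (s≤s (ℕₚ.m≤m+n q m))

  shuffle₁ : ∀ {n d} m q → q ℕ.+ suc m ≡ n → Linear n (λ s → s ℕ.+ suc m ≡ d) → Linear n (λ s → s ℕ.+ m ≡ d)
  shuffle₁ m q e F = lift (ℕₚ.≤-<-trans z≤n (q<q+suc q m e)) (λ {s} eq → ≡.trans (≡.sym (ℕₚ.+-suc s m)) eq) F (suc q) ones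

  shuffle : ∀ {n d} m q → q ℕ.+ m ≡ n → Linear n (λ s → s ℕ.+ m ≡ d) → Linear n (λ s → s ℕ.+ 0 ≡ d)
  shuffle zero    q e F = F
  shuffle (suc m) q e F = shuffle m (suc q) (≡.trans (≡.sym (ℕₚ.+-suc q m)) e) (shuffle₁ m q e F)

  shuffle-Shuffle : ∀ {n d} m q e (F : Linear n (λ s → s ℕ.+ m ≡ d)) φ →
    Linear.⟪_⟫ (shuffle m q e F) φ ≡ Linear.⟪_⟫ F (Shuffle q m φ)
  shuffle-Shuffle zero    q e F φ = ≡.refl
  shuffle-Shuffle (suc m) q e F φ = shuffle-Shuffle m (suc q) (≡.trans (≡.sym (ℕₚ.+-suc q m)) e) (shuffle₁ m q e F) φ

  shuffle₁-sym : ∀ {n d} m q e (F : Linear n (λ s → s ℕ.+ suc m ≡ d)) → Symmetric F q → Symmetric (shuffle₁ m q e F) (suc q)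
  shuffle₁-sym m q e F F-sym k p φ = Insert.hat-sym F q (q<q+suc q m e) F-sym (suc q) ones k φ p ℕₚ.≤-refl refl

  shuffle-sym : ∀ {n d} m q e (F : Linear n (λ s → s ℕ.+ m ≡ d)) → Symmetric F q → Symmetric (shuffle m q e F) n
  shuffle-sym zero    q e F F-sym = ≡.subst (Symmetric F) (≡.trans (≡.sym (ℕₚ.+-identityʳ q)) e) F-sym
  shuffle-sym (suc m) q e F F-sym = shuffle-sym m (suc q) _ (shuffle₁ m q e F) (shuffle₁-sym m q e F F-sym)

  Orbit : List ℕ → List ℕ → List ℕ → Set
  Orbit u₀ w ν = ∃ λ u → ν ≡ u ++ w × u ↭ u₀

  Vanishes : ∀ {n V} → Linear n V → ℕ → (List ℕ → Set) → Set
  Vanishes {n} F s O = ∀ ν → length ν ≡ n → size ν ≤ s → ¬ O ν → Linear.⟪_⟫ F (ev ν) ≈ 0#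

  module ShuffleVanish (R : Regular) where
    open Vanish R

    -- Swaps inside the prefix preserve the orbit and its complement. So a node off the orbit never
    -- meets an exceptional neighbour, and every term of the sum vanishes separately by `swap-van`.
    shuffle₁-van : ∀ {n d} m q e (F : Linear n (λ s → s ℕ.+ suc m ≡ d)) → Symmetric F q → ∀ s u w c → length u ≡ q →
      Vanishes F s (Orbit u (w ++ c ∷ [])) → Vanishes (shuffle₁ m q e F) (suc s) (Orbit (suc c ∷ u) w)
    shuffle₁-van {n} m q e F F-sym s u w c lu van ν len sz ¬o = trans (hat-sum (suc q) ones (ev ν)) (sum0 (suc q) ℕₚ.≤-refl)
      where
      q<n = q<q+suc q m e
      open Insert F q q<n F-sym
      G : ℕ → Linear n (λ _ → ⊤)
      G j = record
        { ⟪_⟫ = g j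
        ; ext = λ eq → Linear.ext′ F (λ v e → eq (ch j (rot v)) (≡.trans (length-ch j (rot v)) (≡.trans (length-rot v) e)) tt)
        ; lin = λ x y φ ψ → Linear.lin F x y (λ v → φ (ch j (rot v))) (λ v → ψ (ch j (rot v)))
        }
      O = Orbit (suc c ∷ u) w
      O-swap : ∀ j → j < q → ∀ ν → O (swap j ν) → O ν
      O-swap j p ν (u′ , eq , π) = swap j u′ ,
        ≡.trans (≡.sym (swap-invol j ν)) (≡.trans (≡.cong (swap j) eq) (swap-++ j u′ w (≡.subst (suc j <_) (≡.sym (≡.trans (↭-length π) (≡.cong suc lu))) (s≤s p)))) ,
        ↭-trans (swap-↭ j u′) π
      g-van : ∀ j → j ≤ q → Vanishes (G j) (suc s) O
      g-van zero p ν len sz ¬o = rot-van F (ℕₚ.≤-<-trans z≤n q<n) ν len rotated-van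
        where
        rotated-van : ∀ m ν′ → ν ≡ suc m ∷ ν′ → Linear.⟪_⟫ F (ev (ν′ ++ m ∷ [])) ≈ 0#
        rotated-van m ν′ ≡.refl = van (ν′ ++ m ∷ []) (≡.trans (length-∷ʳ ν′ m) len) (≡.subst (_≤ s) (≡.sym (size-∷ʳ ν′ m)) (ℕₚ.≤-pred sz)) no′
          where
          no′ : ¬ Orbit u (w ++ c ∷ []) (ν′ ++ m ∷ [])
          no′ (u′ , eq , π) with Listₚ.∷ʳ-injective ν′ (u′ ++ w) (≡.trans eq (≡.sym (Listₚ.++-assoc u′ w (c ∷ []))))
          ... | ≡.refl , ≡.refl = ¬o (suc m ∷ u′ , ≡.refl , prep (suc m) π)
      g-van (suc j) p ν len sz ¬o = swap-van (G j) j ν len (ℕₚ.≤-<-trans p q<n)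
        (g-van j (ℕₚ.<⇒≤ p) ν len sz ¬o)
        (g-van j (ℕₚ.<⇒≤ p) (swap j ν) (≡.trans (length-swap j ν) len) (≡.subst (_≤ suc s) (≡.sym (size-swap j ν)) sz)
          (λ o → ¬o (O-swap j p ν o)))
      sum0 : ∀ J → J ≤ suc q → sumTo J (λ j → 1# * g j (ev ν)) ≈ 0#
      sum0 zero    p = refl
      sum0 (suc J) p = trans (+-cong (sum0 J (ℕₚ.<⇒≤ p)) (trans (*-identityˡ _) (g-van J (ℕₚ.≤-pred p) ν len sz ¬o))) (+-identityˡ 0#)

    grow : List ℕ → List ℕ → List ℕ
    grow []       u = u
    grow (c ∷ ws) u = grow ws (suc c ∷ u)

    grow-↭ : ∀ ws u → grow ws u ↭ map suc ws ++ u
    grow-↭ []       u = ↭-refl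
    grow-↭ (c ∷ ws) u = ↭-trans (grow-↭ ws (suc c ∷ u)) (shift (suc c) (map suc ws) u)

    shuffle-van : ∀ {n d} ws q e (F : Linear n (λ s → s ℕ.+ length ws ≡ d)) → Symmetric F q → ∀ s u → length u ≡ q →
      Vanishes F s (Orbit u (reverse ws)) → Vanishes (shuffle (length ws) q e F) (length ws ℕ.+ s) (_↭ grow ws u)
    shuffle-van []       q e F F-sym s u lu van ν len sz ¬o = van ν len sz (λ { (u′ , eq , π) → ¬o (≡.subst (_↭ u) (≡.sym (≡.trans eq (Listₚ.++-identityʳ u′))) π) })
    shuffle-van (c ∷ ws) q e F F-sym s u lu van ν len sz ¬o = shuffle-van ws (suc q) (≡.trans (≡.sym (ℕₚ.+-suc q (length ws))) e)
      (shuffle₁ (length ws) q e F) (shuffle₁-sym (length ws) q e F F-sym) (suc s) (suc c ∷ u) (≡.cong suc lu)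
      (shuffle₁-van (length ws) q e F F-sym s u (reverse ws) c lu (≡.subst (λ w → Vanishes F s (Orbit u w)) (Listₚ.unfold-reverse c ws) van))
      ν len (≡.subst (size ν ≤_) (≡.sym (ℕₚ.+-suc (length ws) s)) sz) ¬o

  -- The leading coefficient: deletions and permanents

  open import Data.List.Relation.Unary.All as All using (All; []; _∷_)
  import Data.List.Relation.Unary.All.Properties as Allₚ
  open import Data.List.Relation.Unary.AllPairs using (AllPairs; []; _∷_)
  import Data.List.Relation.Unary.AllPairs.Properties as AllPairsₚ

  same : ℕ → ℕ → K
  same zero    zero    = 1#
  same zero    (suc _) = 0#
  same (suc _) zero    = 0#
  same (suc a) (suc b) = same a b

  δ : List ℕ → Fun
  δ []      []      = 1#
  δ (x ∷ z) (y ∷ l) = same x y * δ z l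
  δ _       _       = 0#

  -- Dual to inserting a at every possible place: each occurrence of a in the list is removed in
  -- turn.
  del : ℕ → Fun → Fun
  del a φ []      = 0#
  del a φ (x ∷ l) = same a x * φ l + del a (λ l′ → φ (x ∷ l′)) l

  del-ext : ∀ a l {φ ψ : Fun} → (∀ l′ → suc (length l′) ≡ length l → φ l′ ≈ ψ l′) → del a φ l ≈ del a ψ l
  del-ext a []      h = refl
  del-ext a (x ∷ l) h = +-cong (*-congˡ (h l ≡.refl)) (del-ext a l (λ l′ e → h (x ∷ l′) (≡.cong suc e)))

  del-lin : ∀ a l c d φ ψ → del a (λ l → c * φ l + d * ψ l) l ≈ c * del a φ l + d * del a ψ l
  del-lin a []      c d φ ψ = solve 2 (λ c d → con (+ 0) := c :* con (+ 0) :+ d :* con (+ 0)) refl c d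
  del-lin a (x ∷ l) c d φ ψ = trans (+-congˡ (del-lin a l c d (λ l → φ (x ∷ l)) (λ l → ψ (x ∷ l))))
    (solve 7 (λ c d s p q u v → s :* (c :* p :+ d :* q) :+ (c :* u :+ d :* v) := c :* (s :* p :+ u) :+ d :* (s :* q :+ v)) refl c d (same a x) _ _ _ _)

  del-linear : ∀ a l n → suc n ≡ length l → Linear n (λ _ → ⊤)
  del-linear a l n e = record
    { ⟪_⟫ = λ φ → del a φ l
    ; ext = λ h → del-ext a l (λ l′ e′ → h l′ (ℕₚ.suc-injective (≡.trans e′ (≡.sym e))) tt)
    ; lin = λ c d φ ψ → del-lin a l c d φ ψ
    }

  del-comm : ∀ a b φ l → del a (del b φ) l ≈ del b (del a φ) l
  del-comm a b φ []          = refl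
  del-comm a b φ (x ∷ [])    = trans (+-congʳ (zeroʳ _)) (sym (+-congʳ (zeroʳ _)))
  del-comm a b φ (x ∷ l@(y ∷ l′)) = begin
    A * del b φ l + del a (λ l → B * φ l + del b φx l) l
      ≈⟨ +-congˡ (expand a b) ⟩
    A * del b φ l + (B * del a φ l + del a (del b φx) l)
      ≈⟨ +-congˡ (+-congˡ (del-comm a b φx l)) ⟩
    A * del b φ l + (B * del a φ l + del b (del a φx) l)
      ≈⟨ solve 3 (λ x y z → x :+ (y :+ z) := y :+ (x :+ z)) refl _ _ _ ⟩
    B * del a φ l + (A * del b φ l + del b (del a φx) l)
      ≈⟨ +-congˡ (expand b a) ⟨
    B * del a φ l + del b (λ l → A * φ l + del a φx l) l ∎
    where
    A = same a x
    B = same b x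
    φx : Fun
    φx l = φ (x ∷ l)
    expand : ∀ a b → del a (λ l → same b x * φ l + del b φx l) l ≈ same b x * del a φ l + del a (del b φx) l
    expand a b = trans (Linear.add (del-linear a l (length l′) ≡.refl) (λ l → same b x * φ l) (del b φx)) (+-congʳ (Linear.scale (del-linear a l (length l′) ≡.refl) (same b x) φ))

  dels : List ℕ → Fun → Fun
  dels []      φ = φ
  dels (a ∷ u) φ = del a (dels u φ)

  dels-ext : ∀ u l {φ ψ : Fun} → (∀ l′ → length u ℕ.+ length l′ ≡ length l → φ l′ ≈ ψ l′) → dels u φ l ≈ dels u ψ l
  dels-ext []      l h = h l ≡.refl
  dels-ext (a ∷ u) l h = del-ext a l (λ l′ e → dels-ext u l′ (λ l″ e′ → h l″ (≡.trans (≡.cong suc e′) e)))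

  dels-lin : ∀ u l c d φ ψ → dels u (λ l → c * φ l + d * ψ l) l ≈ c * dels u φ l + d * dels u ψ l
  dels-lin []      l c d φ ψ = refl
  dels-lin (a ∷ u) l c d φ ψ = trans (del-ext a l (λ l′ _ → dels-lin u l′ c d φ ψ)) (del-lin a l c d (dels u φ) (dels u ψ))

  dels-linear : ∀ u l n → length u ℕ.+ n ≡ length l → Linear n (λ _ → ⊤)
  dels-linear u l n e = record
    { ⟪_⟫ = λ φ → dels u φ l
    ; ext = λ h → dels-ext u l (λ l′ e′ → h l′ (ℕₚ.+-cancelˡ-≡ (length u) _ _ (≡.trans e′ (≡.sym e))) tt)
    ; lin = dels-lin u l
    }

  dels-++ : ∀ u z φ → dels (u ++ z) φ ≡ dels u (dels z φ)
  dels-++ []      z φ = ≡.refl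
  dels-++ (a ∷ u) z φ = ≡.cong (del a) (dels-++ u z φ)

  dels-swap : ∀ k u φ l → dels (swap k u) φ l ≈ dels u φ l
  dels-swap k       []          φ l = refl
  dels-swap zero    (a ∷ [])    φ l = refl
  dels-swap zero    (a ∷ b ∷ u) φ l = del-comm b a (dels u φ) l
  dels-swap (suc k) (a ∷ u)     φ l = del-ext a l (λ l′ _ → dels-swap k u φ l′)

  sumTo-shift : ∀ n f → sumTo (suc n) f ≈ f 0 + sumTo n (λ j → f (suc j))
  sumTo-shift zero    f = +-comm _ _
  sumTo-shift (suc n) f = trans (+-congʳ (sumTo-shift n f)) (+-assoc _ _ _)

  sumTo-scale : ∀ n c {f g} → (∀ j → f j ≈ c * g j) → sumTo n f ≈ c * sumTo n g
  sumTo-scale zero    c h = sym (zeroʳ c)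
  sumTo-scale (suc n) c h = trans (+-cong (sumTo-scale n c h) (h n)) (sym (distribˡ c _ _))

  ch-∷ : ∀ j (x y : ℕ) z → ch (suc j) (x ∷ y ∷ z) ≡ y ∷ ch j (x ∷ z)
  ch-∷ zero    x y z = ≡.refl
  ch-∷ (suc j) x y z = ≡.cong (swap (suc j)) (ch-∷ j x y z)

  ch-++ : ∀ j l w → j < length l → ch j (l ++ w) ≡ ch j l ++ w
  ch-++ zero    l w p = ≡.refl
  ch-++ (suc j) l w p = ≡.trans (≡.cong (swap j) (ch-++ j l w (ℕₚ.<-trans (ℕₚ.n<1+n j) p)))
    (swap-++ j (ch j l) w (≡.subst (suc j <_) (≡.sym (length-ch j l)) p))

  δ-nonempty : ∀ l n → length l ≡ suc n → δ l [] ≈ 0#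
  δ-nonempty (x ∷ l) n e = refl

  del-δ : ∀ x z l → sumTo (suc (length z)) (λ j → 1# * δ (ch j (x ∷ z)) l) ≈ del x (δ z) l
  del-δ x z [] = vanish (suc (length z))
    where
    vanish : ∀ n → sumTo n (λ j → 1# * δ (ch j (x ∷ z)) []) ≈ 0#
    vanish zero    = refl
    vanish (suc n) = trans (+-cong (vanish n) (trans (*-identityˡ _) (δ-nonempty (ch n (x ∷ z)) (length z) (length-ch n (x ∷ z))))) (+-identityˡ 0#)
  del-δ x [] (w ∷ [])     = trans (+-identityˡ _) (trans (*-identityˡ _) (sym (+-identityʳ _)))
  del-δ x [] (w ∷ w′ ∷ l) = trans (+-identityˡ _) (trans (*-identityˡ _) (trans (sym (+-identityʳ _))
    (+-congˡ (sym (Linear.null (del-linear x (w′ ∷ l) (length l) ≡.refl))))))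
  del-δ x (y ∷ z) (w ∷ l) = begin
    sumTo (suc (suc (length z))) (λ j → 1# * δ (ch j (x ∷ y ∷ z)) (w ∷ l))
      ≈⟨ sumTo-shift (suc (length z)) (λ j → 1# * δ (ch j (x ∷ y ∷ z)) (w ∷ l)) ⟩
    1# * (same x w * δ (y ∷ z) l) + sumTo (suc (length z)) (λ j → 1# * δ (ch (suc j) (x ∷ y ∷ z)) (w ∷ l))
      ≈⟨ +-cong (*-identityˡ _) (sumTo-scale (suc (length z)) (same y w) (λ j → trans (*-congˡ (reflexive (≡.cong (λ t → δ t (w ∷ l)) (ch-∷ j x y z))))
           (solve 3 (λ o s d → o :* (s :* d) := s :* (o :* d)) refl 1# (same y w) _))) ⟩
    same x w * δ (y ∷ z) l + same y w * sumTo (suc (length z)) (λ j → 1# * δ (ch j (x ∷ z)) l)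
      ≈⟨ +-congˡ (trans (*-congˡ (del-δ x z l)) (scale l)) ⟩
    same x w * δ (y ∷ z) l + del x (λ l′ → same y w * δ z l′) l ∎
    where
    scale : ∀ l → same y w * del x (δ z) l ≈ del x (λ l′ → same y w * δ z l′) l
    scale []      = zeroʳ _
    scale (v ∷ l) = sym (Linear.scale (del-linear x (v ∷ l) (length l) ≡.refl) (same y w) (δ z))

  map-∷ʳ : ∀ (v : List ℕ) k → map suc (v ++ k ∷ []) ≡ map suc v ++ suc k ∷ []
  map-∷ʳ v k = Listₚ.map-++ suc v (k ∷ [])

  -- Inserting a raised entry at all positions and comparing with μ is the same as deleting that
  -- entry from μ, by `del-δ`.
  Shuffle-δ : ∀ q m z v μ → length z ≡ q → length v ≡ m → length μ ≡ q ℕ.+ m →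
    Shuffle q m (λ l → δ l μ) (z ++ v) ≈ dels (map suc v) (δ z) μ
  Shuffle-δ q zero    z []      μ ez ev eμ = reflexive (≡.cong (λ l → δ l μ) (Listₚ.++-identityʳ z))
  Shuffle-δ q (suc m) z v μ ez ev eμ with initLast v
  Shuffle-δ q (suc m) z .(v ++ k ∷ []) μ ez ev eμ | v ∷ʳ′ k = begin
    sumTo (suc q) (λ j → 1# * χ (ch j (rot (z ++ (v ++ k ∷ [])))))
      ≈⟨ sumTo-cong (suc q) (λ j p → *-congˡ (trans (reflexive (≡.cong χ (place j (≡.subst (j <_) (≡.cong suc (≡.sym ez)) p))))
           (Shuffle-δ (suc q) m (ch j (suc k ∷ z)) v μ (≡.trans (length-ch j (suc k ∷ z)) (≡.cong suc ez)) ev′ (≡.trans eμ (ℕₚ.+-suc q m))))) ⟩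
    sumTo (suc q) (λ j → 1# * dels (map suc v) (δ (ch j (suc k ∷ z))) μ)
      ≈⟨ Linear.sum D (suc q) ones (λ j → δ (ch j (suc k ∷ z))) ⟨
    dels (map suc v) (λ l → sumTo (suc q) (λ j → 1# * δ (ch j (suc k ∷ z)) l)) μ
      ≈⟨ Linear.ext D (λ l _ _ → trans (reflexive (≡.cong (λ q → sumTo (suc q) (λ j → 1# * δ (ch j (suc k ∷ z)) l)) (≡.sym ez))) (del-δ (suc k) z l)) ⟩
    dels (map suc v) (del (suc k) (δ z)) μ
      ≡⟨ ≡.cong (λ f → f μ) (≡.trans (≡.cong (λ u → dels u (δ z)) (map-∷ʳ v k)) (dels-++ (map suc v) (suc k ∷ []) (δ z))) ⟨
    dels (map suc (v ++ k ∷ [])) (δ z) μ ∎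
    where
    χ = Shuffle (suc q) m (λ l → δ l μ)
    ev′ : length v ≡ m
    ev′ = ℕₚ.suc-injective (≡.trans (≡.sym (length-∷ʳ v k)) ev)
    D = dels-linear (map suc v) μ (suc q) (≡.trans (≡.cong (ℕ._+ suc q) (≡.trans (Listₚ.length-map suc v) ev′))
          (≡.trans (ℕₚ.+-comm m (suc q)) (≡.trans (≡.sym (ℕₚ.+-suc q m)) (≡.sym eμ))))
    place : ∀ j → j < suc (length z) → ch j (rot (z ++ (v ++ k ∷ []))) ≡ ch j (suc k ∷ z) ++ v
    place j p = ≡.trans (≡.cong (ch j) (≡.trans (≡.cong rot (≡.sym (Listₚ.++-assoc z v (k ∷ [])))) (rot-∷ʳ (z ++ v) k)))
      (ch-++ j (suc k ∷ z) v p)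

  dels-0 : ∀ v ψ l → dels (map suc v) ψ (0 ∷ l) ≈ dels (map suc v) (λ l′ → ψ (0 ∷ l′)) l
  dels-0 []      ψ l = refl
  dels-0 (a ∷ v) ψ l = trans (+-congʳ (zeroˡ _)) (trans (+-identityˡ _) (del-ext (suc a) l (λ l′ _ → dels-0 v ψ l′)))

  dels-zeros : ∀ q v ψ l → dels (map suc v) ψ (zeros q ++ l) ≈ dels (map suc v) (λ l′ → ψ (zeros q ++ l′)) l
  dels-zeros zero    v ψ l = refl
  dels-zeros (suc q) v ψ l = trans (dels-0 v ψ (zeros q ++ l)) (dels-zeros q v (λ l′ → ψ (0 ∷ l′)) l)

  del-map : ∀ a φ l → del (suc a) φ (map suc l) ≈ del a (λ l′ → φ (map suc l′)) l
  del-map a φ []      = refl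
  del-map a φ (x ∷ l) = +-congˡ (del-map a (λ l′ → φ (suc x ∷ l′)) l)

  dels-map : ∀ v ψ l → dels (map suc v) ψ (map suc l) ≈ dels v (λ l′ → ψ (map suc l′)) l
  dels-map []      ψ l = refl
  dels-map (a ∷ v) ψ l = trans (del-map a (dels (map suc v) ψ) l) (del-ext a l (λ l′ _ → dels-map v ψ l′))

  dels-all : ∀ v χ l → length v ≡ length l → dels v χ l ≈ χ [] * dels v (δ []) l
  dels-all v χ l e = trans (Linear.ext D (λ { [] _ _ → sym (*-identityʳ _) })) (Linear.scale D (χ []) (δ []))
    where D = dels-linear v l 0 (≡.trans (ℕₚ.+-identityʳ _) e)

  -- The deleted entries are positive, so they can only come out of map suc κ and leave the zeros to
  -- ψ.
  dels-split : ∀ q v ψ κ → length v ≡ length κ →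
    dels (map suc v) ψ (zeros q ++ map suc κ) ≈ ψ (zeros q) * dels v (δ []) κ
  dels-split q v ψ κ e = trans (dels-zeros q v ψ (map suc κ)) (trans (dels-map v (λ l → ψ (zeros q ++ l)) κ)
    (trans (dels-all v (λ l → ψ (zeros q ++ map suc l)) κ e) (*-congʳ (reflexive (≡.cong ψ (Listₚ.++-identityʳ (zeros q)))))))

  padded : ℕ → Fun → Fun
  padded zero    ψ l           = ψ l
  padded (suc q) ψ []          = 0#
  padded (suc q) ψ (zero ∷ l)  = padded q ψ l
  padded (suc q) ψ (suc _ ∷ l) = 0#

  δ-padded : ∀ q z v ψ → length z ≡ q → δ z (zeros q) * ψ v ≈ padded q ψ (z ++ v)
  δ-padded zero    []          v ψ e = *-identityˡ _
  δ-padded (suc q) (zero ∷ z)  v ψ e = trans (*-congʳ (*-identityˡ _)) (δ-padded q z v ψ (ℕₚ.suc-injective e))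
  δ-padded (suc q) (suc x ∷ z) v ψ e = trans (*-congʳ (zeroˡ _)) (zeroˡ _)

  fact : ℕ → K
  fact zero    = 1#
  fact (suc q) = nat (suc q) * fact q

  del-zeros : ∀ φ q → del 0 φ (zeros (suc q)) ≈ nat (suc q) * φ (zeros q)
  del-zeros φ zero    = trans (+-identityʳ _) (*-congʳ (sym (+-identityʳ 1#)))
  del-zeros φ (suc q) = trans (+-congˡ (del-zeros (λ l → φ (0 ∷ l)) q)) (sym (distribʳ _ _ _))

  del-suc-zeros : ∀ x φ q → del (suc x) φ (zeros q) ≈ 0#
  del-suc-zeros x φ zero    = refl
  del-suc-zeros x φ (suc q) = trans (+-cong (zeroˡ _) (del-suc-zeros x _ q)) (+-identityˡ _)

  dels-padded : ∀ q z v ψ → length z ≡ q → dels z (δ []) (zeros q) * ψ v ≈ fact q * padded q ψ (z ++ v)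
  dels-padded zero    []          v ψ e = refl
  dels-padded (suc q) (zero ∷ z)  v ψ e = trans (*-congʳ (del-zeros (dels z (δ [])) q)) (trans (*-assoc _ _ _)
    (trans (*-congˡ (dels-padded q z v ψ (ℕₚ.suc-injective e))) (sym (*-assoc _ _ _))))
  dels-padded (suc q) (suc x ∷ z) v ψ e = trans (*-congʳ (del-suc-zeros x (dels z (δ [])) (suc q))) (trans (zeroˡ _) (sym (zeroʳ _)))

  -- col p adds a first column to the diagram κ, and p empty rows.
  data Tower : List ℕ → Set where
    nil : Tower []
    col : ∀ p {κ} → Tower κ → Tower (zeros p ++ map suc κ)

  cyc : ∀ {n q} κ t → Build n q (t ++ κ) → Build n q (map suc κ ++ t)
  cyc {n} {q} []      t d = ≡.subst (Build n q) (Listₚ.++-identityʳ t) d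
  cyc {n} {q} (c ∷ κ) t d = step (≡.sym (Listₚ.++-assoc (map suc κ) t (c ∷ [])))
    (cyc κ (t ++ c ∷ []) (≡.subst (Build n q) (≡.sym (Listₚ.++-assoc t (c ∷ []) κ)) d))

  pad : ∀ {n q b} p → Build n (q ℕ.+ p) b → Build n q (zeros p ++ b)
  pad {n} {q} {b} zero    d = ≡.subst (λ q → Build n q b) (ℕₚ.+-identityʳ q) d
  pad {n} {q} {b} (suc p) d = zero∷ (pad p (≡.subst (λ q → Build n q b) (ℕₚ.+-suc q p) d))

  length-col : ∀ p κ → length (zeros p ++ map suc κ) ≡ p ℕ.+ length κ
  length-col p κ = ≡.trans (Listₚ.length-++ (zeros p)) (≡.cong₂ ℕ._+_ (Listₚ.length-replicate p) (Listₚ.length-map suc κ))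

  size-col : ∀ p κ → size (zeros p ++ map suc κ) ≡ length κ ℕ.+ size κ
  size-col zero    []      = ≡.refl
  size-col zero    (x ∷ κ) = ≡.cong suc (≡.trans (≡.cong (x ℕ.+_) (size-col 0 κ))
    (ℕS.solve 3 (λ a b c → a ℕS.:+ (b ℕS.:+ c) ℕS.:= b ℕS.:+ (a ℕS.:+ c)) ≡.refl x (length κ) (size κ)))
  size-col (suc p) κ       = size-col p κ

  build : ∀ {κ} → Tower κ → ∀ n q → q ℕ.+ length κ ≡ n → Build n q κ
  build nil             n q e = nil (≡.trans (≡.sym (ℕₚ.+-identityʳ q)) e)
  build (col p {κ} T)   n q e = pad p (≡.subst (Build n (q ℕ.+ p)) (Listₚ.++-identityʳ (map suc κ))
    (cyc κ [] (build T n (q ℕ.+ p) (≡.trans (ℕₚ.+-assoc q p _) (≡.trans (≡.cong (q ℕ.+_) (≡.sym (length-col p κ))) e)))))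

  E-subst : ∀ {n q b b′} (e : b ≡ b′) (d : Build n q b) φ → E (≡.subst (Build n q) e d) φ ≡ E d φ
  E-subst ≡.refl d φ = ≡.refl

  E-pad : ∀ {n q b} p (d : Build n (q ℕ.+ p) b) φ → E (pad p d) φ ≡ E d φ
  E-pad {n} {q} {b} zero    d φ = q-subst (ℕₚ.+-identityʳ q) d
    where
    q-subst : ∀ {q q′} (e : q ≡ q′) (d : Build n q b) → E (≡.subst (λ q → Build n q b) e d) φ ≡ E d φ
    q-subst ≡.refl d = ≡.refl
  E-pad {n} {q} {b} (suc p) d φ = ≡.trans (E-pad p _ φ) (q-subst (ℕₚ.+-suc q p) d)
    where
    q-subst : ∀ {q q′} (e : q ≡ q′) (d : Build n q b) → E (≡.subst (λ q → Build n q b) e d) φ ≡ E d φ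
    q-subst ≡.refl d = ≡.refl

  SymmetricOn : ℕ → ℕ → Fun → Set
  SymmetricOn n p φ = ∀ k l → length l ≡ n → suc k < p → φ (swap k l) ≈ φ l

  rots : ℕ → List ℕ → List ℕ
  rots zero    l = l
  rots (suc m) l = rot (rots m l)

  sumTo-const : ∀ n x {f} → (∀ j → j < n → f j ≈ x) → sumTo n f ≈ nat n * x
  sumTo-const zero    x h = sym (zeroˡ x)
  sumTo-const (suc n) x h = trans (+-cong (sumTo-const n x (λ j p → h j (ℕₚ.m<n⇒m<1+n p))) (h n ≤-refl))
    (trans (solve 3 (λ m o x → m :* x :+ x := x :+ m :* x) refl (nat n) 1# x) (trans (+-congʳ (sym (*-identityˡ x))) (sym (distribʳ x 1# (nat n)))))
    where open ℕₚ using (≤-refl)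

  ch-sym : ∀ {n p φ} → SymmetricOn n p φ → ∀ j l → length l ≡ n → j < p → φ (ch j l) ≈ φ l
  ch-sym h zero    l e q = refl
  ch-sym h (suc j) l e q = trans (h j (ch j l) (≡.trans (length-ch j l) e) q) (ch-sym h j l e (ℕₚ.<-trans (ℕₚ.n<1+n j) q))

  -- On a symmetric test function all positions contribute alike, so only the sum of the weights
  -- counts.
  hat-sym-const : ∀ {n} q a φ → SymmetricOn n (suc q) φ → ∀ v → length v ≡ n →
    hat (suc q) (wt q a) φ v ≈ (nat q + a) * φ (rot v)
  hat-sym-const q a φ h v e = trans (+-cong
    (sumTo-const q (φ (rot v)) (λ j p → trans (*-cong (reflexive (wt< q a j p)) (on j (ℕₚ.m<n⇒m<1+n p))) (*-identityˡ _)))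
    (*-cong (reflexive (wt-top q a)) (on q ℕₚ.≤-refl))) (sym (distribʳ _ _ _))
    where on = λ j p → ch-sym {φ = φ} h j (rot v) (≡.trans (length-rot v) e) p

  factor : ℕ → List ℕ → List ℕ → K
  factor q []      t = 1#
  factor q (c ∷ κ) t = (nat q + top c (map suc κ ++ t)) * factor q κ (t ++ c ∷ [])

  E-cyc : ∀ κ t {n q} (d : Build n q (t ++ κ)) φ → SymmetricOn n (length κ ℕ.+ q) φ → length κ ℕ.+ q ≤ n →
    E (cyc κ t d) φ ≈ factor q κ t * E d (λ l → φ (rots (length κ) l))
  E-cyc []      t d φ h b = trans (reflexive (E-subst (Listₚ.++-identityʳ t) d φ)) (sym (*-identityˡ _))
  E-cyc (c ∷ κ) t {n} {q} d φ h b = begin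
    E d₁ (hat (suc q) (wt q a) φ)
      ≈⟨ Linear.ext′ (𝔼 d₁) (hat-sym-const q a φ (λ k l e p → h k l e (ℕₚ.≤-trans p (s≤s (ℕₚ.m≤n+m q (length κ)))))) ⟩
    E d₁ (λ v → (nat q + a) * φ (rot v))     ≈⟨ Linear.scale (𝔼 d₁) (nat q + a) (λ v → φ (rot v)) ⟩
    (nat q + a) * E d₁ (λ v → φ (rot v))
      ≈⟨ *-congˡ (E-cyc κ (t ++ c ∷ []) d₀ (λ v → φ (rot v)) sym′ (ℕₚ.≤-trans (ℕₚ.n≤1+n _) b)) ⟩
    (nat q + a) * (factor q κ (t ++ c ∷ []) * E d₀ ψ) ≈⟨ *-assoc _ _ _ ⟨
    factor q (c ∷ κ) t * E d₀ ψ ≡⟨ ≡.cong (factor q (c ∷ κ) t *_) (E-subst (≡.sym (Listₚ.++-assoc t (c ∷ []) κ)) d ψ) ⟩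
    factor q (c ∷ κ) t * E d ψ ∎
    where
    a = top c (map suc κ ++ t)
    d₀ = ≡.subst (Build n q) (≡.sym (Listₚ.++-assoc t (c ∷ []) κ)) d
    d₁ = cyc κ (t ++ c ∷ []) d₀
    ψ : Fun
    ψ l = φ (rots (suc (length κ)) l)
    sym′ : SymmetricOn n (length κ ℕ.+ q) (λ v → φ (rot v))
    sym′ k l e p = trans (reflexive (≡.cong φ (≡.sym (rot-swap k l (≡.subst (suc (suc k) <_) (≡.sym e) (ℕₚ.≤-trans (s≤s p) b))))))
      (h (suc k) (rot l) (≡.trans (length-rot l) e) (s≤s p))

  -- Insertion at position 0 creates a positive first entry, which φ′ kills. The other positions
  -- keep the first entry, and their weights are those for one variable fewer.
  E-drop : ∀ {n q b} (d′ : Build (suc n) (suc q) b) (d : Build n q b) (φ′ φ : Fun) →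
    (∀ t → length t ≡ n → φ′ (0 ∷ t) ≈ φ t) → (∀ x t → length t ≡ n → φ′ (suc x ∷ t) ≈ 0#) → E d′ φ′ ≈ E d φ
  E-drop {n} (nil _) (nil _) φ′ φ h₀ h₁ = h₀ (zeros n) (Listₚ.length-replicate n)
  E-drop (zero∷ d′) (zero∷ d) φ′ φ h₀ h₁ = E-drop d′ d φ′ φ h₀ h₁
  E-drop {n} {q} (step {_} {c} {t} ≡.refl d′) (step ≡.refl d) φ′ φ h₀ h₁ = E-drop d′ d _ _ h₀′ h₁′
    where
    a = top c t
    0<n : 0 < n
    0<n = ℕₚ.≤-<-trans z≤n (Build-q<n {c = c} {t} ≡.refl d)
    split : ∀ y v → length v ≡ n → hat (suc (suc q)) (wt (suc q) a) φ′ (y ∷ v) ≈ sumTo (suc q) (λ j → wt q a j * φ′ (y ∷ ch j (rot v)))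
    split y v e with initLast v
    ... | [] = ⊥-elim (ℕₚ.<⇒≢ 0<n e)
    ... | v ∷ʳ′ k = trans (sumTo-shift (suc q) (λ j → wt (suc q) a j * φ′ (ch j (rot (y ∷ v ++ k ∷ [])))))
      (trans (+-cong
        (trans (*-identityˡ _) (trans (reflexive (≡.cong φ′ (rot-∷ʳ (y ∷ v) k))) (h₁ k (y ∷ v) (≡.trans (≡.sym (length-∷ʳ v k)) e))))
        (sumTo-cong (suc q) (λ j p → *-congˡ (reflexive (≡.cong φ′ (≡.trans (≡.cong (ch (suc j)) (rot-∷ʳ (y ∷ v) k))
          (≡.trans (ch-∷ j (suc k) y v) (≡.cong (λ w → y ∷ ch j w) (≡.sym (rot-∷ʳ v k)))))))))) (+-identityˡ _))
    len : ∀ j v → length v ≡ n → length (ch j (rot v)) ≡ n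
    len j v e = ≡.trans (length-ch j (rot v)) (≡.trans (length-rot v) e)
    h₀′ : ∀ v → length v ≡ n → hat (suc (suc q)) (wt (suc q) a) φ′ (0 ∷ v) ≈ hat (suc q) (wt q a) φ v
    h₀′ v e = trans (split 0 v e) (sumTo-cong (suc q) (λ j p → *-congˡ (h₀ (ch j (rot v)) (len j v e))))
    h₁′ : ∀ x v → length v ≡ n → hat (suc (suc q)) (wt (suc q) a) φ′ (suc x ∷ v) ≈ 0#
    h₁′ x v e = trans (split (suc x) v e) (trans (sumTo-const (suc q) 0# (λ j p → trans (*-congˡ (h₁ x (ch j (rot v)) (len j v e))) (zeroʳ _))) (zeroʳ _))

  E-padded : ∀ {κ} (T : Tower κ) q n e ψ → E (build T n q e) (padded q ψ) ≈ E (build T (length κ) 0 ≡.refl) ψ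
  E-padded T zero    _ ≡.refl ψ = refl
  E-padded T (suc q) _ ≡.refl ψ = trans (E-drop (build T _ (suc q) ≡.refl) (build T _ q ≡.refl) (padded (suc q) ψ) (padded q ψ) (λ _ _ → refl) (λ _ _ _ → refl))
    (E-padded T q _ ≡.refl ψ)

  -- The hook factors of the first column of the diagram with rows map suc l, from the shortest row
  -- up: x is the arm, and s, the number of rows already read, is the leg.
  column : ℕ → List ℕ → K
  column s []      = 1#
  column s (x ∷ l) = (α * nat x + nat (suc s)) * column (suc s) l

  column-zeros : ∀ p w → column 0 (zeros p ++ w) ≈ fact p * column p w
  column-zeros zero    w = sym (*-identityˡ _)
  column-zeros (suc p) w = trans (reflexive (≡.cong (column 0) (≡.sym (zeros-∷ p w)))) (trans (column-zeros p (0 ∷ w))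
    (trans (*-congˡ (*-congʳ (trans (+-congʳ (zeroʳ α)) (+-identityˡ _)))) (solve 3 (λ f m c → f :* (m :* c) := m :* f :* c) refl _ _ _)))

  le-above : ∀ {c x} → c ≤ x → le (suc x) c ≡ 0
  le-above z≤n     = ≡.refl
  le-above (s≤s p) = le-above p

  le-under : ∀ {c x} → x ≤ c → le x c ≡ 1
  le-under z≤n     = ≡.refl
  le-under (s≤s p) = le-under p

  below-cyc : ∀ c κ t → All (c ≤_) κ → All (_≤ c) t → below (suc c) (map suc κ ++ t) ≡ length t
  below-cyc c []      []      _        _       = ≡.refl
  below-cyc c []      (x ∷ t) hκ       (h ∷ ht) = ≡.cong₂ ℕ._+_ (le-under h) (below-cyc c [] t hκ ht)
  below-cyc c (x ∷ κ) t       (h ∷ hκ) ht       = ≡.cong₂ ℕ._+_ (le-above h) (below-cyc c κ t hκ ht)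

  -- As κ increases, `below` counts exactly the entries in t, hence the leg grows by one from each
  -- factor to the next.
  factor-column : ∀ q κ t → AllPairs _≤_ κ → All (λ x → All (x ≤_) κ) t → factor q κ t ≈ column (q ℕ.+ length t) (map suc κ)
  factor-column q []      t _        _  = refl
  factor-column q (c ∷ κ) t (h ∷ hκ) ht = *-cong
    (trans (+-congˡ (+-congˡ (reflexive (≡.cong (λ m → nat (suc m)) (below-cyc c κ t h (All.map All.head ht))))))
      (trans (solve 4 (λ q a o l → q :+ (a :+ (o :+ l)) := a :+ (o :+ (q :+ l))) refl (nat q) _ 1# (nat (length t)))
        (+-congˡ (+-congˡ (sym (nat-+ q (length t)))))))
    (trans (factor-column q κ (t ++ c ∷ []) hκ (Allₚ.++⁺ (All.map All.tail ht) (h ∷ [])))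
      (reflexive (≡.cong (λ s → column s (map suc κ)) (≡.trans (≡.cong (q ℕ.+_) (length-∷ʳ t c)) (ℕₚ.+-suc q (length t))))))

  Tower-increasing : ∀ {κ} → Tower κ → AllPairs _≤_ κ
  Tower-increasing nil         = []
  Tower-increasing (col p {κ} T) = AllPairsₚ.++⁺ (zeros-inc p) (AllPairsₚ.map⁺ (pairs-suc (Tower-increasing T))) (zeros-≤ p)
    where
    zeros-≤ : ∀ p → All (λ x → All (x ≤_) (map suc κ)) (zeros p)
    zeros-≤ zero    = []
    zeros-≤ (suc p) = All.universal (λ _ → z≤n) (map suc κ) ∷ zeros-≤ p
    zeros-inc : ∀ p → AllPairs _≤_ (zeros p)
    zeros-inc zero    = []
    zeros-inc (suc p) = All.universal (λ _ → z≤n) (zeros p) ∷ zeros-inc p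
    pairs-suc : ∀ {l} → AllPairs _≤_ l → AllPairs (λ x y → suc x ≤ suc y) l
    pairs-suc []       = []
    pairs-suc (h ∷ hs) = All.map s≤s h ∷ pairs-suc hs

  rots-++ : ∀ v z → rots (length v) (z ++ v) ≡ map suc v ++ z
  rots-++ []      z = Listₚ.++-identityʳ z
  rots-++ (k ∷ v) z = ≡.trans (≡.cong (λ l → rot (rots (length v) l)) (≡.sym (Listₚ.++-assoc z (k ∷ []) v)))
    (≡.trans (≡.cong rot (≡.trans (rots-++ v (z ++ k ∷ [])) (≡.sym (Listₚ.++-assoc (map suc v) z (k ∷ []))))) (rot-∷ʳ (map suc v ++ z) k))

  split-length : ∀ p m (l : List ℕ) → length l ≡ p ℕ.+ m → ∃ λ z → ∃ λ v → l ≡ z ++ v × length z ≡ p × length v ≡ m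
  split-length zero    m l       e = [] , l , ≡.refl , ≡.refl , e
  split-length (suc p) m (x ∷ l) e with split-length p m l (ℕₚ.suc-injective e)
  ... | z , v , ≡.refl , ez , ev = x ∷ z , v , ≡.refl , ≡.cong suc ez , ev

  lead : ∀ {κ} → Tower κ → K
  lead nil           = 1#
  lead (col p {κ} T) = column 0 (zeros p ++ map suc κ) * lead T

  -- dels v (δ []) κ is a permanent: it counts the permutations that take v to κ.
  E-permanent : ∀ {κ} (T : Tower κ) n e → E (build T n 0 e) (λ v → dels v (δ []) κ) ≈ lead T
  E-permanent nil           _ ≡.refl = refl
  E-permanent (col p {κ} T) n e = begin
    E (build (col p T) n 0 e) φ ≡⟨ E-pad p _ φ ⟩
    E (≡.subst (Build n p) (Listₚ.++-identityʳ (map suc κ)) (cyc κ [] d)) φ ≡⟨ E-subst (Listₚ.++-identityʳ (map suc κ)) (cyc κ [] d) φ ⟩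
    E (cyc κ [] d) φ ≈⟨ E-cyc κ [] d φ (λ k l _ _ → dels-swap k l (δ []) κ̂) (ℕₚ.≤-reflexive (≡.trans (ℕₚ.+-comm (length κ) p) e′)) ⟩
    factor p κ [] * E d (λ l → φ (rots (length κ) l)) ≈⟨ *-cong (factor-column p κ [] (Tower-increasing T) []) (Linear.ext′ (𝔼 d) rotated-φ) ⟩
    column (p ℕ.+ 0) (map suc κ) * E d (λ l → fact p * padded p B l)
      ≈⟨ *-cong (reflexive (≡.cong (λ s → column s (map suc κ)) (ℕₚ.+-identityʳ p))) (Linear.scale (𝔼 d) (fact p) (padded p B)) ⟩
    column p (map suc κ) * (fact p * E d (padded p B)) ≈⟨ *-congˡ (*-congˡ (trans (E-padded T p n e′ B) (E-permanent T (length κ) ≡.refl))) ⟩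
    column p (map suc κ) * (fact p * lead T) ≈⟨ solve 3 (λ c f l → c :* (f :* l) := f :* c :* l) refl _ _ _ ⟩
    fact p * column p (map suc κ) * lead T ≈⟨ *-congʳ (column-zeros p (map suc κ)) ⟨
    lead (col p T) ∎
    where
    κ̂ = zeros p ++ map suc κ
    φ B : Fun
    φ v = dels v (δ []) κ̂
    B v = dels v (δ []) κ
    e′ = ≡.trans (≡.cong (0 ℕ.+_) (≡.sym (length-col p κ))) e
    d = build T n p e′
    -- For l = z ++ v the permanent factors: z has to match the p zeros, in `fact p` ways, and v has
    -- to match κ. The factorial becomes the hook factors 1, ..., p of the p zero entries in
    -- `column-zeros`.
    rotated-φ : ∀ l → length l ≡ n → φ (rots (length κ) l) ≈ fact p * padded p B l
    rotated-φ l el with split-length p (length κ) l (≡.trans el (≡.sym e′))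
    ... | z , v , ≡.refl , ez , ev = begin
      φ (rots (length κ) (z ++ v)) ≡⟨ ≡.cong φ (≡.trans (≡.cong (λ m → rots m (z ++ v)) (≡.sym ev)) (rots-++ v z)) ⟩
      dels (map suc v ++ z) (δ []) κ̂ ≡⟨ ≡.cong (λ f → f κ̂) (dels-++ (map suc v) z (δ [])) ⟩
      dels (map suc v) (dels z (δ [])) κ̂ ≈⟨ dels-split p v (dels z (δ [])) κ ev ⟩
      dels z (δ []) (zeros p) * B v ≈⟨ dels-padded p z v B ez ⟩
      fact p * padded p B (z ++ v) ∎

  E-Shuffle-δ : ∀ {κ} (T : Tower κ) n q e m → m ≡ length κ →
    E (build T n q e) (Shuffle q m (λ l → δ l (zeros q ++ map suc κ))) ≈ lead T
  E-Shuffle-δ {κ} T n q e m ≡.refl = trans (Linear.ext′ (𝔼 (build T n q e)) on) (trans (E-padded T q n e B) (E-permanent T (length κ) ≡.refl))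
    where
    B : Fun
    B v = dels v (δ []) κ
    on : ∀ l → length l ≡ n → Shuffle q m (λ l → δ l (zeros q ++ map suc κ)) l ≈ padded q B l
    on l el with split-length q (length κ) l (≡.trans el (≡.sym e))
    ... | z , v , ≡.refl , ez , ev = trans (Shuffle-δ q m z v (zeros q ++ map suc κ) ez ev (length-col q κ))
      (trans (dels-split q v (δ z) κ ev) (δ-padded q z v B ez))

  -- Monomials as iterates of the operators

  iter : ℕ → ℕ → Fun → Fun
  iter j zero    φ = φ
  iter j (suc a) φ = Y j (iter j a φ)

  -- The bar monomial of the zero exponent is 1, so `mono 0 e φ (zeros n)` is the value of the
  -- linear form φ on y^e.
  mono : ℕ → List ℕ → Fun → Fun
  mono j []      φ = φ
  mono j (a ∷ e) φ = iter j a (mono (suc j) e φ)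

  Agree : ℕ → ℕ → Fun → Fun → Set
  Agree n s φ ψ = ∀ l → length l ≡ n → size l ≤ s → φ l ≈ ψ l

  Y-agree : ∀ {n s φ ψ} j → j < n → Agree n (suc s) φ ψ → Agree n s (Y j φ) (Y j ψ)
  Y-agree {n} j j< h l e sz = +-cong (h (inc j l) (≡.trans (length-inc j l) e) (≡.subst (_≤ _) (≡.sym (size-inc j l j<′)) (s≤s sz)))
    (-‿cong (Ξ-cong j l j<′ (λ l′ e′ s′ → h l′ (≡.trans e′ e) (ℕₚ.≤-trans (ℕₚ.≤-reflexive s′) (ℕₚ.m≤n⇒m≤1+n sz)))))
    where j<′ = ≡.subst (j <_) (≡.sym e) j<

  iter-agree : ∀ {n s φ ψ} j a → j < n → Agree n (a ℕ.+ s) φ ψ → Agree n s (iter j a φ) (iter j a ψ)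
  iter-agree j zero    p h = h
  iter-agree {n} {s} {φ} {ψ} j (suc a) p h = Y-agree j p (iter-agree j a p (≡.subst (λ s → Agree n s φ ψ) (≡.sym (ℕₚ.+-suc a s)) h))

  -- Each application of Y looks one degree further; thus y^e involves only bar monomials of size at
  -- most that of e.
  mono-agree : ∀ {n s φ ψ} j e → j ℕ.+ length e ≤ n → Agree n (size e ℕ.+ s) φ ψ → Agree n s (mono j e φ) (mono j e ψ)
  mono-agree j []      p h = h
  mono-agree {n} {s} {φ} {ψ} j (a ∷ e) p h = iter-agree j a (ℕₚ.≤-trans (s≤s (ℕₚ.m≤m+n j _)) p′)
    (mono-agree (suc j) e p′ (≡.subst (λ s → Agree n s φ ψ) (≡.trans (≡.cong (ℕ._+ s) (ℕₚ.+-comm a (size e))) (ℕₚ.+-assoc (size e) a s)) h))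
    where p′ = ≡.subst (_≤ n) (ℕₚ.+-suc j (length e)) p

  iter-lin : ∀ j a c d φ ψ l → iter j a (λ l → c * φ l + d * ψ l) l ≈ c * iter j a φ l + d * iter j a ψ l
  iter-lin j zero    c d φ ψ l = refl
  iter-lin j (suc a) c d φ ψ l = trans (Y-ext j (iter-lin j a c d φ ψ) l) (Y-lin j c d (iter j a φ) (iter j a ψ) l)

  iter-ext : ∀ j a {φ ψ : Fun} → (∀ l → φ l ≈ ψ l) → ∀ l → iter j a φ l ≈ iter j a ψ l
  iter-ext j zero    h = h
  iter-ext j (suc a) h = Y-ext j (iter-ext j a h)

  mono-lin : ∀ j e c d φ ψ l → mono j e (λ l → c * φ l + d * ψ l) l ≈ c * mono j e φ l + d * mono j e ψ l
  mono-lin j []      c d φ ψ l = refl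
  mono-lin j (a ∷ e) c d φ ψ l = trans (iter-ext j a (mono-lin (suc j) e c d φ ψ) l) (iter-lin j a c d (mono (suc j) e φ) (mono (suc j) e ψ) l)

  pow : K → ℕ → K
  pow x zero    = 1#
  pow x (suc a) = x * pow x a

  power : List K → List ℕ → K
  power (x ∷ p) (a ∷ e) = pow x a * power p e
  power _       _       = 1#

  iter-eigen : ∀ {n} j a x φ → j < n → (∀ l → length l ≡ n → Y j φ l ≈ x * φ l) → ∀ l → length l ≡ n → iter j a φ l ≈ pow x a * φ l
  iter-eigen j zero    x φ p h l e = sym (*-identityˡ _)
  iter-eigen {n} j (suc a) x φ p h l e = begin
    Y j (iter j a φ) l             ≈⟨ Y-cong j l (≡.subst (j <_) (≡.sym e) p) (λ l′ e′ → iter-eigen j a x φ p h l′ (≡.trans e′ e)) ⟩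
    Y j (λ l → pow x a * φ l) l    ≈⟨ Y-* j (pow x a) φ l ⟩
    pow x a * Y j φ l              ≈⟨ *-congˡ (h l e) ⟩
    pow x a * (x * φ l)            ≈⟨ solve 3 (λ p x f → p :* (x :* f) := x :* p :* f) refl _ _ _ ⟩
    x * pow x a * φ l              ∎

  mono-eigen : ∀ {n} j e p φ → length p ≡ length e → j ℕ.+ length e ≤ n →
    (∀ i → i < length e → ∀ l → length l ≡ n → Y (j ℕ.+ i) φ l ≈ pt i p * φ l) →
    ∀ l → length l ≡ n → mono j e φ l ≈ power p e * φ l
  mono-eigen j []      []      φ ep q h l e′ = sym (*-identityˡ _)
  mono-eigen {n} j (a ∷ e) (x ∷ p) φ ep q h l e′ = begin
    iter j a (mono (suc j) e φ) l      ≈⟨ iter-agree {n} {size l} j a j< (λ l e′ _ → mono-eigen (suc j) e p φ (ℕₚ.suc-injective ep) q′ h′ l e′) l e′ ℕₚ.≤-refl ⟩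
    iter j a (λ l → power p e * φ l) l ≈⟨ iter-eigen j a x (λ l → power p e * φ l) j< scaled l e′ ⟩
    pow x a * (power p e * φ l)        ≈⟨ *-assoc _ _ _ ⟨
    pow x a * power p e * φ l          ∎
    where
    q′ = ≡.subst (_≤ n) (ℕₚ.+-suc j (length e)) q
    j< = ℕₚ.≤-trans (s≤s (ℕₚ.m≤m+n j _)) q′
    h′ : ∀ i → i < length e → ∀ l → length l ≡ n → Y (suc j ℕ.+ i) φ l ≈ pt i p * φ l
    h′ i i< l e = ≡.subst (λ k → Y k φ l ≈ pt i p * φ l) (ℕₚ.+-suc j i) (h (suc i) (s≤s i<) l e)
    scaled : ∀ l → length l ≡ n → Y j (λ l → power p e * φ l) l ≈ x * (power p e * φ l)
    scaled l e′ = trans (Y-* j (power p e) φ l) (trans (*-congˡ (≡.subst (λ k → Y k φ l ≈ x * φ l) (ℕₚ.+-identityʳ j) (h 0 (s≤s z≤n) l e′)))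
      (solve 3 (λ p x f → p :* (x :* f) := x :* (p :* f)) refl _ _ _))

  geq : ℕ → ℕ → K
  geq zero    b       = 1#
  geq (suc a) zero    = 0#
  geq (suc a) (suc b) = geq a b

  geq-suc : ∀ a b → geq (suc a) b ≈ geq a b * ind (b ∸ a)
  geq-suc zero    zero    = sym (zeroʳ _)
  geq-suc zero    (suc b) = sym (*-identityʳ _)
  geq-suc (suc a) zero    = sym (zeroˡ _)
  geq-suc (suc a) (suc b) = geq-suc a b

  geqs : List ℕ → List ℕ → K
  geqs (a ∷ e) (b ∷ g) = geq a b * geqs e g
  geqs _       _       = 1#

  monus : List ℕ → List ℕ → List ℕ
  monus (a ∷ e) (b ∷ g) = b ∸ a ∷ monus e g
  monus _       g       = g

  at-mid : ∀ pre b g → at (length pre) (pre ++ b ∷ g) ≡ b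
  at-mid []        b g = ≡.refl
  at-mid (x ∷ pre) b g = at-mid pre b g

  dec-mid : ∀ pre b g → dec (length pre) (pre ++ b ∷ g) ≡ pre ++ pred b ∷ g
  dec-mid []        b g = ≡.refl
  dec-mid (x ∷ pre) b g = ≡.cong (x ∷_) (dec-mid pre b g)

  iter-barCoeff : ∀ {n} pre a b g → length pre < n → ∀ l → length l ≡ n →
    iter (length pre) a (barCoeff (pre ++ b ∷ g)) l ≈ geq a b * barCoeff (pre ++ (b ∸ a) ∷ g) l
  iter-barCoeff pre zero    b g p l e = sym (*-identityˡ _)
  iter-barCoeff {n} pre (suc a) b g p l e = begin
    Y j (iter j a (barCoeff (pre ++ b ∷ g))) l ≈⟨ Y-cong j l j< (λ l′ e′ → iter-barCoeff pre a b g p l′ (≡.trans e′ e)) ⟩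
    Y j (λ l → geq a b * barCoeff f l) l       ≈⟨ Y-* j (geq a b) (barCoeff f) l ⟩
    geq a b * Y j (barCoeff f) l               ≈⟨ *-congˡ (barCoeff-eigen f l j j<) ⟩
    geq a b * (ind (at j f) * barCoeff (dec j f) l) ≈⟨ *-assoc _ _ _ ⟨
    geq a b * ind (at j f) * barCoeff (dec j f) l
      ≈⟨ *-cong (trans (*-congˡ (reflexive (≡.cong ind (at-mid pre (b ∸ a) g)))) (sym (geq-suc a b)))
           (reflexive (≡.cong (λ f → barCoeff f l) (≡.trans (dec-mid pre (b ∸ a) g) (≡.cong (λ c → pre ++ c ∷ g) (ℕₚ.pred[m∸n]≡m∸[1+n] b a))))) ⟩
    geq (suc a) b * barCoeff (pre ++ (b ∸ suc a) ∷ g) l ∎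
    where
    j = length pre
    f = pre ++ (b ∸ a) ∷ g
    j< = ≡.subst (j <_) (≡.sym e) p

  mono-barCoeff : ∀ {n} pre e g → length g ≡ length e → length pre ℕ.+ length e ≤ n → ∀ l → length l ≡ n →
    mono (length pre) e (barCoeff (pre ++ g)) l ≈ geqs e g * barCoeff (pre ++ monus e g) l
  mono-barCoeff pre []      []      _  q l el = sym (*-identityˡ _)
  mono-barCoeff {n} pre (a ∷ e) (b ∷ g) eg q l el = begin
    iter j a (mono (suc j) e (barCoeff (pre ++ b ∷ g))) l
      ≈⟨ iter-agree {n} {size l} j a j< (λ l′ e′ _ → inner l′ e′) l el ℕₚ.≤-refl ⟩
    iter j a (λ l → geqs e g * barCoeff (pre ++ b ∷ monus e g) l) l ≈⟨ iter-ext j a (λ l → sym (pad0 _ _)) l ⟩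
    iter j a (λ l → geqs e g * barCoeff f l + 0# * barCoeff f l) l ≈⟨ iter-lin j a (geqs e g) 0# (barCoeff f) (barCoeff f) l ⟩
    geqs e g * iter j a (barCoeff f) l + 0# * iter j a (barCoeff f) l ≈⟨ pad0 _ _ ⟩
    geqs e g * iter j a (barCoeff f) l ≈⟨ *-congˡ (iter-barCoeff pre a b (monus e g) j< l el) ⟩
    geqs e g * (geq a b * barCoeff (pre ++ (b ∸ a) ∷ monus e g) l) ≈⟨ solve 3 (λ x y z → x :* (y :* z) := y :* x :* z) refl _ _ _ ⟩
    geq a b * geqs e g * barCoeff (pre ++ (b ∸ a) ∷ monus e g) l ∎
    where
    j = length pre
    f = pre ++ b ∷ monus e g
    q′ = ≡.subst (_≤ n) (ℕₚ.+-suc j (length e)) q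
    j< = ℕₚ.≤-trans (s≤s (ℕₚ.m≤m+n j _)) q′
    pad0 : ∀ x y → x * y + 0# * y ≈ x * y
    pad0 = solve 2 (λ x y → x :* y :+ con (+ 0) :* y := x :* y) refl
    inner : ∀ l → length l ≡ n → mono (suc j) e (barCoeff (pre ++ b ∷ g)) l ≈ geqs e g * barCoeff (pre ++ b ∷ monus e g) l
    inner l el = ≡.subst₂ (λ u v → mono (suc j) e (barCoeff u) l ≈ geqs e g * barCoeff v l)
      (Listₚ.++-assoc pre (b ∷ []) g) (Listₚ.++-assoc pre (b ∷ []) (monus e g))
      (≡.subst (λ k → mono k e (barCoeff ((pre ++ b ∷ []) ++ g)) l ≈ geqs e g * barCoeff ((pre ++ b ∷ []) ++ monus e g) l) (length-∷ʳ pre b)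
        (mono-barCoeff (pre ++ b ∷ []) e g (ℕₚ.suc-injective eg) (≡.subst (λ k → k ℕ.+ length e ≤ n) (≡.sym (length-∷ʳ pre b)) q′) l el))

  isZero-+ : ∀ m n → isZero (m ℕ.+ n) ≈ isZero m * isZero n
  isZero-+ zero    n = sym (*-identityˡ _)
  isZero-+ (suc m) n = sym (zeroˡ _)

  geq-isZero : ∀ a b → geq a b * isZero (b ∸ a) ≈ same a b
  geq-isZero zero    zero    = *-identityˡ _
  geq-isZero zero    (suc b) = zeroʳ _
  geq-isZero (suc a) zero    = zeroˡ _
  geq-isZero (suc a) (suc b) = geq-isZero a b

  geqs-isZero : ∀ e f → length f ≡ length e → geqs e f * isZero (size (monus e f)) ≈ δ e f
  geqs-isZero []      []      _  = *-identityˡ _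
  geqs-isZero (a ∷ e) (b ∷ f) ef = trans (*-congˡ (isZero-+ (b ∸ a) (size (monus e f))))
    (trans (solve 4 (λ x y z w → x :* y :* (z :* w) := x :* z :* (y :* w)) refl _ _ _ _) (*-cong (geq-isZero a b) (geqs-isZero e f (ℕₚ.suc-injective ef))))

  mono-coefficient : ∀ n e f → length e ≡ n → length f ≡ n → mono 0 e (barCoeff f) (zeros n) ≈ δ e f
  mono-coefficient n e f le lf = trans (mono-barCoeff {n} [] e f (≡.trans lf (≡.sym le)) (ℕₚ.≤-reflexive le) (zeros n) (Listₚ.length-replicate n))
    (trans (*-congˡ (Co.Ψ-zeros n (monus e f))) (geqs-isZero e f (≡.trans lf (≡.sym le))))

  mono-value : ∀ n p e → length p ≡ n → length e ≡ n → mono 0 e (β p) (zeros n) ≈ power p e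
  mono-value n p e lp le = trans (mono-eigen {n} 0 e p (β p) (≡.trans lp (≡.sym le)) (ℕₚ.≤-reflexive le)
      (λ i i< l el → β-eigen p l i (≡.subst (i <_) (≡.trans le (≡.sym el)) i<)) (zeros n) (Listₚ.length-replicate n))
    (trans (*-congˡ (β-zeros p n)) (*-identityʳ _))

  δ-≡ : ∀ e → δ e e ≈ 1#
  δ-≡ []      = refl
  δ-≡ (x ∷ e) = trans (*-cong (same-≡ x) (δ-≡ e)) (*-identityˡ 1#)
    where
    same-≡ : ∀ x → same x x ≈ 1#
    same-≡ zero    = refl
    same-≡ (suc x) = same-≡ x

  δ-≢ : ∀ e f → e ≢ f → δ e f ≈ 0#
  δ-≢ []      []      ne = ⊥-elim (ne ≡.refl)
  δ-≢ []      (_ ∷ _) ne = refl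
  δ-≢ (_ ∷ _) []      ne = refl
  δ-≢ (x ∷ e) (y ∷ f) ne with x ℕ.≟ y
  ... | yes ≡.refl = trans (*-congˡ (δ-≢ e f (λ h → ne (≡.cong (x ∷_) h)))) (zeroʳ _)
  ... | no x≢y     = trans (*-congʳ (same-≢ x y x≢y)) (zeroˡ _)
    where
    same-≢ : ∀ x y → x ≢ y → same x y ≈ 0#
    same-≢ zero    zero    ne = ⊥-elim (ne ≡.refl)
    same-≢ zero    (suc y) ne = refl
    same-≢ (suc x) zero    ne = refl
    same-≢ (suc x) (suc y) ne = same-≢ x y (λ h → ne (≡.cong suc h))

  -- Lists of terms

  -- Exponents may repeat, and terms may cancel without being zero. Hypotheses are therefore put on
  -- `coef`, and `total-null` carries them over to sums.
  Terms : Set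
  Terms = List (K × List ℕ)

  total : Terms → (List ℕ → K) → K
  total []            W = 0#
  total ((c , e) ∷ Q) W = c * W e + total Q W

  Sized : ℕ → Terms → Set
  Sized n = All (λ t → length (proj₂ t) ≡ n)

  coef : Terms → List ℕ → K
  coef Q f = total Q (λ e → δ e f)

  total-cong : ∀ {n Q} {W W′ : List ℕ → K} → Sized n Q → (∀ e → length e ≡ n → W e ≈ W′ e) → total Q W ≈ total Q W′
  total-cong []       h = refl
  total-cong (e ∷ es) h = +-cong (*-congˡ (h _ e)) (total-cong es h)

  total-lin : ∀ Q c d W W′ → total Q (λ e → c * W e + d * W′ e) ≈ c * total Q W + d * total Q W′
  total-lin []            c d W W′ = solve 2 (λ c d → con (+ 0) := c :* con (+ 0) :+ d :* con (+ 0)) refl c d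
  total-lin ((x , e) ∷ Q) c d W W′ = trans (+-congˡ (total-lin Q c d W W′))
    (solve 7 (λ x c d w w′ t t′ → x :* (c :* w :+ d :* w′) :+ (c :* t :+ d :* t′) := c :* (x :* w :+ t) :+ d :* (x :* w′ :+ t′)) refl x c d _ _ _ _)

  -- Subtracting W e · δ e from W removes the leading term of the sum without changing the others.
  total-null : ∀ {n} Q W → Sized n Q → (∀ f → length f ≡ n → coef Q f ≈ 0# ⊎ W f ≈ 0#) → total Q W ≈ 0#
  total-null []            W []       h = refl
  total-null {n} ((c , e) ∷ Q) W (le ∷ es) h with h e le
  ... | inj₂ We≈0 = trans (+-cong (trans (*-congˡ We≈0) (zeroʳ c)) (total-null Q W es h′)) (+-identityˡ 0#)
    where
    h′ : ∀ f → length f ≡ n → coef Q f ≈ 0# ⊎ W f ≈ 0#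
    h′ f lf with Listₚ.≡-dec ℕ._≟_ e f
    ... | yes ≡.refl = inj₂ We≈0
    ... | no ne with h f lf
    ... | inj₂ w = inj₂ w
    ... | inj₁ z = inj₁ (trans (sym (trans (+-congʳ (trans (*-congˡ (δ-≢ e f ne)) (zeroʳ c))) (+-identityˡ _))) z)
  ... | inj₁ z = begin
    c * W e + total Q W ≈⟨ solve 4 (λ c w t z → c :* w :+ t := w :* (c :+ z) :+ (t :- w :* z)) refl c (W e) (total Q W) (coef Q e) ⟩
    W e * (c + coef Q e) + (total Q W - W e * coef Q e)
      ≈⟨ +-cong (trans (*-congˡ (trans (+-congʳ (sym (trans (*-congˡ (δ-≡ e)) (*-identityʳ c)))) z)) (zeroʳ _))
           (trans (+-cong (sym (*-identityˡ _)) (solve 2 (λ w z → :- (w :* z) := (:- w) :* z) refl (W e) (coef Q e))) (sym (total-lin Q 1# (- W e) W (λ f → δ f e)))) ⟩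
    0# + total Q W′ ≈⟨ +-identityˡ _ ⟩
    total Q W′ ≈⟨ total-null Q W′ es h′ ⟩
    0# ∎
    where
    W′ : List ℕ → K
    W′ f = 1# * W f + - W e * δ f e
    h′ : ∀ f → length f ≡ n → coef Q f ≈ 0# ⊎ W′ f ≈ 0#
    h′ f lf with Listₚ.≡-dec ℕ._≟_ f e
    ... | yes ≡.refl = inj₂ (trans (+-cong (*-identityˡ _) (trans (*-congˡ (δ-≡ f)) (*-identityʳ _))) (-‿inverseʳ _))
    ... | no ne with h f lf
    ... | inj₁ z = inj₁ (trans (sym (trans (+-congʳ (trans (*-congˡ (δ-≢ e f (λ h → ne (≡.sym h)))) (zeroʳ c))) (+-identityˡ _))) z)
    ... | inj₂ w = inj₂ (trans (+-cong (trans (*-identityˡ _) w) (trans (*-congˡ (δ-≢ f e ne)) (zeroʳ _))) (+-identityˡ 0#))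

  swap-list : ∀ {A : Set} (k : ℕ) {n} (l : List A) → length l ≡ n → length (swap k l) ≡ n
  swap-list k l e = ≡.trans (length-swap k l) e

  δ-swap : ∀ k e f → length e ≡ length f → δ (swap k e) f ≈ δ e (swap k f)
  δ-swap k e f l with Listₚ.≡-dec ℕ._≟_ (swap k e) f
  ... | yes ≡.refl = trans (δ-≡ (swap k e)) (sym (trans (reflexive (≡.cong (δ e) (swap-invol k e))) (δ-≡ e)))
  ... | no ne = trans (δ-≢ (swap k e) f ne) (sym (δ-≢ e (swap k f) (λ h → ne (≡.trans (≡.cong (swap k) h) (swap-invol k f)))))

  mapTerms : (List ℕ → List ℕ) → Terms → Terms
  mapTerms τ []            = []
  mapTerms τ ((c , e) ∷ Q) = (c , τ e) ∷ mapTerms τ Q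

  total-map : ∀ τ Q W → total (mapTerms τ Q) W ≈ total Q (λ e → W (τ e))
  total-map τ []            W = refl
  total-map τ ((c , e) ∷ Q) W = +-congˡ (total-map τ Q W)

  negTerms : Terms → Terms
  negTerms []            = []
  negTerms ((c , e) ∷ Q) = (- c , e) ∷ negTerms Q

  total-diff : ∀ P Q W → total (P ++ negTerms Q) W ≈ total P W - total Q W
  total-diff []            []            W = sym (-‿inverseʳ 0#)
  total-diff []            ((c , e) ∷ Q) W = trans (+-congˡ (total-diff [] Q W)) (solve 3 (λ c w t → (:- c) :* w :+ (con (+ 0) :- t) := con (+ 0) :- (c :* w :+ t)) refl c (W e) _)
  total-diff ((c , e) ∷ P) Q             W = trans (+-congˡ (total-diff P Q W)) (sym (+-assoc _ _ _))

  sized-map : ∀ {n} k Q → Sized n Q → Sized n (mapTerms (swap k) Q)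
  sized-map k []            []       = []
  sized-map k ((c , e) ∷ Q) (h ∷ hs) = swap-list k e h ∷ sized-map k Q hs

  sized-neg : ∀ {n} Q → Sized n Q → Sized n (negTerms Q)
  sized-neg []            []       = []
  sized-neg ((c , e) ∷ Q) (h ∷ hs) = h ∷ sized-neg Q hs

  total-swap : ∀ {n} k Q W → Sized n Q → (∀ f → length f ≡ n → coef Q (swap k f) ≈ coef Q f) →
    total Q (λ e → W (swap k e)) ≈ total Q W
  total-swap {n} k Q W sz h = x-y≈0⇒x≈y (trans (+-congʳ (sym (total-map (swap k) Q W))) (trans (sym (total-diff (mapTerms (swap k) Q) Q W))
    (total-null (mapTerms (swap k) Q ++ negTerms Q) W (Allₚ.++⁺ (sized-map k Q sz) (sized-neg Q sz)) (λ f lf → inj₁ (begin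
      coef (mapTerms (swap k) Q ++ negTerms Q) f        ≈⟨ total-diff (mapTerms (swap k) Q) Q (λ e → δ e f) ⟩
      coef (mapTerms (swap k) Q) f - coef Q f           ≈⟨ +-congʳ (trans (total-map (swap k) Q (λ e → δ e f))
        (trans (total-cong sz (λ e le → δ-swap k e f (≡.trans le (≡.sym lf)))) (h f lf))) ⟩
      coef Q f - coef Q f                               ≈⟨ -‿inverseʳ _ ⟩
      0#                                                ∎)))))

  power-swap : ∀ k p e → length p ≡ length e → power (swap k p) e ≈ power p (swap k e)
  power-swap k       []          []          _ = refl
  power-swap zero    (x ∷ [])    (a ∷ [])    _ = refl
  power-swap zero    (x ∷ y ∷ p) (a ∷ b ∷ e) _ = solve 3 (λ x y z → x :* (y :* z) := y :* (x :* z)) refl (pow y a) (pow x b) _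
  power-swap (suc k) (x ∷ p)     (a ∷ e)     l = *-congˡ (power-swap k p e (ℕₚ.suc-injective l))

  -- Uniqueness: the nodes determine a functional of bounded degree

  module Zero (G : Regular) where
    open Regular G

    -- Test functions are split by their first entry: `embed` covers first entry zero with one
    -- variable fewer, `raise` covers a positive one through the rotation, with degree one lower.
    -- The double induction of `zero-functional` follows this split.
    embed : Fun → Fun
    embed ψ []          = 0#
    embed ψ (zero ∷ t)  = ψ t
    embed ψ (suc _ ∷ t) = 0#

    raise : Fun → Fun
    raise χ []          = 0#
    raise χ (zero ∷ t)  = 0#
    raise χ (suc k ∷ t) = χ (t ++ k ∷ [])

    embedded : ∀ {n d} → Linear (suc n) (_≤ d) → Linear n (_≤ d)
    embedded {n} {d} L = record
      { ⟪_⟫ = λ ψ → ⟪ embed ψ ⟫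
      ; ext = λ {φ} {ψ} h → ext {embed φ} {embed ψ} (λ { [] e s → refl ; (zero ∷ t) e s → h t (ℕₚ.suc-injective e) s ; (suc _ ∷ t) e s → refl })
      ; lin = λ x y φ ψ → trans (ext′ (λ { [] e → z x y ; (zero ∷ t) e → refl ; (suc _ ∷ t) e → z x y })) (lin x y (embed φ) (embed ψ))
      }
      where
      open Linear L
      z : ∀ x y → 0# ≈ x * 0# + y * 0#
      z = solve 2 (λ x y → con (+ 0) := x :* con (+ 0) :+ y :* con (+ 0)) refl

    raised : ∀ {n d} → Linear (suc n) (_≤ suc d) → Linear (suc n) (_≤ d)
    raised {n} {d} L = record
      { ⟪_⟫ = λ χ → ⟪ raise χ ⟫
      ; ext = λ {φ} {ψ} h → ext {raise φ} {raise ψ} (λ { [] e s → refl ; (zero ∷ t) e s → refl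
          ; (suc k ∷ t) e s → h (t ++ k ∷ []) (≡.trans (length-∷ʳ t k) e) (≡.subst (_≤ d) (≡.sym (size-∷ʳ t k)) (ℕₚ.≤-pred s)) })
      ; lin = λ x y φ ψ → trans (ext′ (λ { [] e → z x y ; (zero ∷ t) e → z x y ; (suc _ ∷ t) e → refl })) (lin x y (raise φ) (raise ψ))
      }
      where
      open Linear L
      z : ∀ x y → 0# ≈ x * 0# + y * 0#
      z = solve 2 (λ x y → con (+ 0) := x :* con (+ 0) :+ y :* con (+ 0)) refl

    lastOut : Fun → Fun
    lastOut φ l with initLast l
    ... | []       = 0#
    ... | t ∷ʳ′ k = φ (suc k ∷ t)

    lastOut-∷ʳ : ∀ φ t k → lastOut φ (t ++ k ∷ []) ≈ φ (suc k ∷ t)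
    lastOut-∷ʳ φ t k with t ++ k ∷ [] in eq | initLast (t ++ k ∷ [])
    ... | _ | []       = ⊥-elim (ℕₚ.1+n≢0 (≡.trans (≡.sym (length-∷ʳ t k)) (≡.cong length eq)))
    ... | _ | t′ ∷ʳ′ k′ with Listₚ.∷ʳ-injective t t′ eq
    ... | ≡.refl , ≡.refl = refl

    val≉0 : ∀ k c → ¬ (val (suc k) c ≈ 0#)
    val≉0 k c h = nonzero (suc k) c (s≤s z≤n) (trans (solve 1 (λ x → x := :- (:- x)) refl _) (trans (-‿cong h) -0#≈0#))

    Null : ℕ → ℕ → Set
    Null n d = (L : Linear n (_≤ d)) → (∀ ν → length ν ≡ n → size ν ≤ d → Linear.⟪_⟫ L (ev ν) ≈ 0#) → ∀ φ → Linear.⟪_⟫ L φ ≈ 0#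

    embed-null : ∀ {n d} → Null n d → (L : Linear (suc n) (_≤ d)) → (∀ ν → length ν ≡ suc n → size ν ≤ d → Linear.⟪_⟫ L (ev ν) ≈ 0#) →
      ∀ ψ → Linear.⟪_⟫ L (embed ψ) ≈ 0#
    embed-null {n} null L h = null (embedded L) (λ ν e s → trans (Linear.ext′ L (on ν e)) (h (0 ∷ ν) (≡.cong suc e) s))
      where
      on : ∀ ν → length ν ≡ n → ∀ l → length l ≡ suc n → embed (ev ν) l ≈ ev (0 ∷ ν) l
      on ν e (zero ∷ t)  el = sym (ev-0-0 ν t (≡.trans (ℕₚ.suc-injective el) (≡.sym e)))
      on ν e (suc m ∷ t) el = sym (ev-0-suc ν m t (≡.trans (ℕₚ.suc-injective el) (≡.sym e)))

    -- Evaluation at suc k ∷ t is an embedded function plus a nonzero multiple of the raised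
    -- evaluation at t ++ k ∷ []. L is already known to kill embedded functions, so it kills the
    -- raised one.
    raise-null : ∀ {n d} → Null n (suc d) → Null (suc n) d → (L : Linear (suc n) (_≤ suc d)) →
      (∀ ν → length ν ≡ suc n → size ν ≤ suc d → Linear.⟪_⟫ L (ev ν) ≈ 0#) → ∀ χ → Linear.⟪_⟫ L (raise χ) ≈ 0#
    raise-null {n} {d} null₀ null₁ L h = null₁ (raised L) on
      where
      open Linear L
      on : ∀ ν → length ν ≡ suc n → size ν ≤ d → ⟪ raise (ev ν) ⟫ ≈ 0#
      on ν e s with initLast ν
      ... | t ∷ʳ′ k = cancel (val≉0 k (below (suc k) t)) (begin
        x * ⟪ raise ek ⟫ ≈⟨ scale x (raise ek) ⟨
        ⟪ (λ l → x * raise ek l) ⟫ ≈⟨ +-identityˡ _ ⟨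
        0# + ⟪ (λ l → x * raise ek l) ⟫ ≈⟨ +-congʳ (embed-null null₀ L h e0) ⟨
        ⟪ embed e0 ⟫ + ⟪ (λ l → x * raise ek l) ⟫ ≈⟨ add (embed e0) (λ l → x * raise ek l) ⟨
        ⟪ (λ l → embed e0 l + x * raise ek l) ⟫ ≈⟨ ext′ pieces ⟩
        ⟪ ev (suc k ∷ t) ⟫ ≈⟨ h (suc k ∷ t) lt (s≤s (≡.subst (_≤ d) (size-∷ʳ t k) s)) ⟩
        0# ∎)
        where
        x = val (suc k) (below (suc k) t)
        ek e0 : Fun
        ek = ev (t ++ k ∷ [])
        e0 l = ev (suc k ∷ t) (0 ∷ l)
        lt : suc (length t) ≡ suc n
        lt = ≡.trans (≡.sym (length-∷ʳ t k)) e
        pieces : ∀ l → length l ≡ suc n → embed e0 l + x * raise ek l ≈ ev (suc k ∷ t) l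
        pieces (zero ∷ l)  el = trans (+-congˡ (zeroʳ x)) (+-identityʳ _)
        pieces (suc m ∷ l) el = trans (+-identityˡ _) (sym (ev-rot k t m l (ℕₚ.suc-injective (≡.trans el (≡.sym lt)))))

    null-pieces : ∀ {n d} (L : Linear (suc n) (_≤ d)) → (∀ ψ → Linear.⟪_⟫ L (embed ψ) ≈ 0#) → (∀ χ → Linear.⟪_⟫ L (raise χ) ≈ 0#) →
      ∀ φ → Linear.⟪_⟫ L φ ≈ 0#
    null-pieces L h₀ h₁ φ = begin
      ⟪ φ ⟫ ≈⟨ ext′ (λ { [] () ; (zero ∷ t) e → sym (+-identityʳ _) ; (suc k ∷ t) e → trans (sym (lastOut-∷ʳ φ t k)) (sym (+-identityˡ _)) }) ⟩
      ⟪ (λ l → embed (λ t → φ (0 ∷ t)) l + raise (lastOut φ) l) ⟫ ≈⟨ add (embed (λ t → φ (0 ∷ t))) (raise (lastOut φ)) ⟩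
      ⟪ embed (λ t → φ (0 ∷ t)) ⟫ + ⟪ raise (lastOut φ) ⟫ ≈⟨ +-cong (h₀ (λ t → φ (0 ∷ t))) (h₁ (lastOut φ)) ⟩
      0# + 0# ≈⟨ +-identityˡ 0# ⟩
      0# ∎
      where open Linear L

    null-suc : ∀ {n} → (∀ d → Null n d) → ∀ d → Null (suc n) d
    null-suc null zero    L h = null-pieces L (embed-null (null 0) L h)
      (λ χ → trans (Linear.ext L {raise χ} {λ _ → 0#} (λ { [] _ _ → refl ; (zero ∷ t) _ _ → refl ; (suc k ∷ t) _ () })) (Linear.null L))
    null-suc null (suc d) L h = null-pieces L (embed-null (null (suc d)) L h) (raise-null (null (suc d)) (null-suc null d) L h)

    zero-functional : ∀ n d → Null n d
    zero-functional zero d L h φ = trans (ext′ (λ { [] _ → sym (trans (*-congˡ (β-zeros [] 0)) (*-identityʳ _)) }))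
      (trans (scale (φ []) (ev [])) (trans (*-congˡ (h [] ≡.refl z≤n)) (zeroʳ _)))
      where open Linear L
    zero-functional (suc n) d = null-suc (zero-functional n) d

  -- Reduction to increasing nodes

  sorted-unique : ∀ {xs ys} → AllPairs _≤_ xs → AllPairs _≤_ ys → xs ↭ ys → xs ≡ ys
  sorted-unique {[]}     {[]}     _        _        π = ≡.refl
  sorted-unique {[]}     {y ∷ ys} _        _        π = ⊥-elim (ℕₚ.1+n≢0 (≡.sym (↭-length π)))
  sorted-unique {x ∷ xs} {[]}     _        _        π = ⊥-elim (ℕₚ.1+n≢0 (↭-length π))
  sorted-unique {x ∷ xs} {y ∷ ys} (h ∷ hs) (g ∷ gs) π
    with ℕₚ.≤-antisym (All.head (All-resp-↭ π (ℕₚ.≤-refl ∷ h))) (All.head (All-resp-↭ (↭-sym π) (ℕₚ.≤-refl ∷ g)))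
  ... | ≡.refl = ≡.cong (x ∷_) (sorted-unique hs gs (drop-∷ π))

  Closed : (List ℕ → Set) → Set
  Closed X = ∀ k ν → suc k < length ν → at (suc k) ν < at k ν → X (swap k ν) → X ν

  closed-∷ : ∀ {X} → Closed X → ∀ a → Closed (λ l → X (a ∷ l))
  closed-∷ cl a k ν p q x = cl (suc k) (a ∷ ν) (s≤s p) q x

  insert-sorted : ∀ X a l → Closed X → AllPairs _≤_ l → (∀ l′ → l′ ↭ a ∷ l → AllPairs _≤_ l′ → X l′) → X (a ∷ l)
  insert-sorted X a []      cl _        h = h _ ↭-refl ([] ∷ [])
  insert-sorted X a (b ∷ l) cl (g ∷ gs) h with ℕₚ.≤-<-connex a b
  ... | inj₁ a≤b = h _ ↭-refl ((a≤b ∷ All.map (ℕₚ.≤-trans a≤b) g) ∷ (g ∷ gs))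
  ... | inj₂ b<a = cl 0 (a ∷ b ∷ l) (s≤s (s≤s z≤n)) b<a
    (insert-sorted (λ l → X (b ∷ l)) a l (closed-∷ {X} cl b) gs
      (λ l′ π s → h (b ∷ l′) (↭-trans (prep b π) (Perm.swap b a ↭-refl)) (All-resp-↭ (↭-sym π) (ℕₚ.<⇒≤ b<a ∷ g) ∷ s)))

  from-sorted : ∀ (X : List ℕ → Set) → Closed X → (∀ l → AllPairs _≤_ l → X l) → ∀ l → X l
  from-sorted X cl h []      = h [] []
  from-sorted X cl h (a ∷ l) = from-sorted (λ l → X (a ∷ l)) (closed-∷ {X} cl a)
    (λ l s → insert-sorted X a l cl s (λ l′ _ s′ → h l′ s′)) l

  total-eq : ∀ {n} Q W W′ → Sized n Q → (∀ f → length f ≡ n → coef Q f ≈ 0# ⊎ W f ≈ W′ f) → total Q W ≈ total Q W′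
  total-eq {n} Q W W′ sz h = x-y≈0⇒x≈y (begin
    total Q W - total Q W′ ≈⟨ +-cong (sym (*-identityˡ _)) (trans (-‿cong (sym (*-identityˡ _))) (solve 2 (λ o x → :- (o :* x) := (:- o) :* x) refl 1# _)) ⟩
    1# * total Q W + - 1# * total Q W′ ≈⟨ total-lin Q 1# (- 1#) W W′ ⟨
    total Q (λ e → 1# * W e + - 1# * W′ e) ≈⟨ total-null Q _ sz (λ f lf → map₂ (cancel′ (W f) (W′ f)) (h f lf)) ⟩
    0# ∎)
    where
    cancel′ : ∀ x y → x ≈ y → 1# * x + - 1# * y ≈ 0#
    cancel′ x y e = trans (+-congʳ (*-congˡ e)) (solve 2 (λ o y → o :* y :+ (:- o) :* y := con (+ 0)) refl 1# y)

  -- Comparison with the interpolation polynomial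

  module Main (G : Regular) (C : Cone) where
    open Regular G
    open Cone C
    open Vanish G using (E-van)
    open Points G using (gap-desc)
    open ShuffleVanish G using (shuffle-van; grow; grow-↭)
    open Zero G using (zero-functional)
    open EPositive C using (pos-hat; pos-E)
    open Positivity C using (pos-ψ)

    column≉0 : ∀ s l → ¬ (column s l ≈ 0#)
    column≉0 s []      h = nonzero 0 1 (s≤s z≤n) (trans (solve 2 (λ a o → a :* con (+ 0) :+ (o :+ con (+ 0)) := o) refl α 1#) h)
    column≉0 s (x ∷ l) h = column≉0 (suc s) l (cancel (nonzero x (suc s) (ℕₚ.m≤n⇒m≤o+n x (s≤s z≤n))) h)

    lead≉0 : ∀ {κ} (T : Tower κ) → ¬ (lead T ≈ 0#)
    lead≉0 nil             h = column≉0 0 [] h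
    lead≉0 (col p {κ} T)   h = lead≉0 T (cancel (column≉0 0 (zeros p ++ map suc κ)) h)

    module Shape {κ : List ℕ} (T : Tower κ) (q n : ℕ) (e : q ℕ.+ length κ ≡ n) where

      shape : List ℕ
      shape = zeros q ++ map suc κ

      d : ℕ
      d = size shape

      ws = reverse κ

      size-shape : length ws ℕ.+ size κ ≡ d
      size-shape = ≡.trans (≡.cong (ℕ._+ size κ) (Listₚ.length-reverse κ)) (≡.sym (size-col q κ))

      e′ : q ℕ.+ length ws ≡ n
      e′ = ≡.trans (≡.cong (q ℕ.+_) (Listₚ.length-reverse κ)) e

      F₀ : Linear n (λ s → s ℕ.+ length ws ≡ d)
      F₀ = record
        { ⟪_⟫ = E (build T n q e)
        ; ext = λ h → Linear.ext (𝔼 (build T n q e)) (λ l el s → h l el (≡.trans (ℕₚ.+-comm _ (length ws)) (≡.trans (≡.cong (length ws ℕ.+_) s) size-shape)))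
        ; lin = Linear.lin (𝔼 (build T n q e))
        }

      F₁ : Linear n (λ s → s ℕ.+ 0 ≡ d)
      F₁ = shuffle (length ws) q e′ F₀

      F : Linear n (_≤ d)
      F = record
        { ⟪_⟫ = Linear.⟪_⟫ F₁
        ; ext = λ h → Linear.ext F₁ (λ l el s → h l el (ℕₚ.≤-reflexive (≡.trans (≡.sym (ℕₚ.+-identityʳ _)) s)))
        ; lin = Linear.lin F₁
        }

      open Linear F using () renaming (⟪_⟫ to F⟪_⟫)

      F-sym : Symmetric F₁ n
      F-sym = shuffle-sym (length ws) q e′ F₀ (E-sym (build T n q e))

      F-van : ∀ ν → AllPairs _≤_ ν → length ν ≡ n → size ν ≤ d → ν ≢ shape → F⟪ ev ν ⟫ ≈ 0#
      F-van ν inc len sz ne = shuffle-van ws q e′ F₀ (E-sym (build T n q e)) (size κ) (zeros q) (Listₚ.length-replicate q)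
        (λ ν len sz ¬o → E-van (build T n q e) ν len sz (λ eq → ¬o (zeros q , ≡.trans eq (≡.cong (zeros q ++_) (≡.sym (Listₚ.reverse-involutive κ))) , ↭-refl)))
        ν len (≡.subst (size ν ≤_) (≡.sym size-shape) sz)
        (λ π → ne (sorted-unique inc (Tower-increasing (col q T)) (↭-trans π (↭-trans (grow-↭ ws (zeros q))
          (↭-trans (++⁺ʳ (zeros q) (map⁺ suc (↭-reverse κ))) (++-comm (map suc κ) (zeros q)))))))

      -- With F symmetric the exchange relation reads (γ + 1)(x - y) = 0. At a descent γ is α a + r
      -- with natural a and r, so γ + 1 can be cancelled.
      F-swap : ∀ k ν → length ν ≡ n → suc k < n → at (suc k) ν < at k ν → F⟪ ev ν ⟫ ≈ F⟪ ev (swap k ν) ⟫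
      F-swap k ν len p desc = x-y≈0⇒x≈y (cancel γ+1≉0 (begin
        (γ + 1#) * (x - y) ≈⟨ solve 4 (λ γ o x y → (γ :+ o) :* (x :- y) := γ :* x :- ((γ :+ o) :* y :- o :* x)) refl γ 1# x y ⟩
        γ * x - ((γ + 1#) * y - 1# * x) ≈⟨ +-congˡ (-‿cong (+-congˡ (-‿cong (*-identityˡ x)))) ⟩
        γ * x - ((γ + 1#) * y - x) ≈⟨ +-cong (*-congˡ (sym (F-sym k p (ev ν)))) (-‿cong (sym (ev-exchange F k ν len p (λ eq → ℕₚ.<⇒≢ desc (≡.sym eq))))) ⟩
        γ * z - γ * z ≈⟨ -‿inverseʳ _ ⟩
        0# ∎))
        where
        γ = gap k ν
        x = F⟪ ev ν ⟫
        y = F⟪ ev (swap k ν) ⟫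
        z = F⟪ (λ l → ev ν (swap k l)) ⟫
        a = at k ν ∸ at (suc k) ν
        r = at k (rank ν) ∸ at (suc k) (rank ν)
        γ+1≉0 : ¬ (γ + 1# ≈ 0#)
        γ+1≉0 h = nonzero a (suc r) (ℕₚ.m≤n⇒m≤o+n a (s≤s z≤n)) (trans (solve 3 (λ x o y → x :+ (o :+ y) := x :+ y :+ o) refl (α * nat a) 1# (nat r))
          (trans (+-congʳ (sym (gap-desc k ν (≡.subst (suc k <_) (≡.sym len) p) desc))) h))

      -- F₁ sees only exponents of top degree, where `barCoeff` is a Kronecker delta.
      F-lead : F⟪ barCoeff shape ⟫ ≈ lead T
      F-lead = trans (Linear.ext F₁ on) (trans (reflexive (shuffle-Shuffle (length ws) q e′ F₀ (λ l → δ l shape)))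
        (E-Shuffle-δ T n q e (length ws) (Listₚ.length-reverse κ)))
        where
        on : ∀ l → length l ≡ n → size l ℕ.+ 0 ≡ d → barCoeff shape l ≈ δ l shape
        on l el s with Listₚ.≡-dec ℕ._≟_ l shape
        ... | yes ≡.refl = trans (ψ-top≡ (size shape) shape ≡.refl) (sym (δ-≡ shape))
        ... | no ne = trans (ψ-top≢ (size l) l shape ≡.refl (≡.sym (≡.trans (≡.sym (ℕₚ.+-identityʳ _)) s))
                         (≡.trans el (≡.trans (≡.sym e) (≡.sym (length-col q κ)))) ne) (sym (δ-≢ l shape ne))

      F-pos : ∀ f → Pos F⟪ barCoeff f ⟫
      F-pos f = resp (reflexive (≡.sym (shuffle-Shuffle (length ws) q e′ F₀ (barCoeff f))))
        (pos-E (build T n q e) _ (pos-Shuffle q (length ws) (λ l → pos-ψ (size l) l f)))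
        where
        pos-Shuffle : ∀ q m {φ} → (∀ l → Pos (φ l)) → ∀ l → Pos (Shuffle q m φ l)
        pos-Shuffle q zero    h = h
        pos-Shuffle q (suc m) h = pos-hat (suc q) ones _ (λ _ _ → pos-1) (pos-Shuffle (suc q) m h)

      module Coefficients (Q : Terms) (sized : Sized n Q)
        (Q-sym : ∀ k f → suc k < n → length f ≡ n → coef Q (swap k f) ≈ coef Q f)
        (Q-deg : ∀ f → length f ≡ n → d < size f → coef Q f ≈ 0#)
        (Q-van : ∀ ν → AllPairs _≤_ ν → length ν ≡ n → size ν ≤ d → ν ≢ shape → total Q (power (bar ν)) ≈ 0#) where

        -- Q may contain terms of degree above d that cancel each other. Cutting them off makes the
        -- functional ℓ bounded by construction, and by `total-cut` changes no sum.
        cut : List ℕ → K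
        cut f with size f ≤? d
        ... | yes _ = 1#
        ... | no _  = 0#

        total-cut : ∀ W → total Q (λ f → cut f * W f) ≈ total Q W
        total-cut W = total-eq Q (λ f → cut f * W f) W sized on
          where
          on : ∀ f → length f ≡ n → coef Q f ≈ 0# ⊎ cut f * W f ≈ W f
          on f lf with size f ≤? d
          ... | yes _ = inj₂ (*-identityˡ _)
          ... | no p  = inj₁ (Q-deg f lf (ℕₚ.≰⇒> p))

        ℓ : Linear n (_≤ d)
        ℓ = record
          { ⟪_⟫ = λ φ → total Q (λ f → cut f * mono 0 f φ (zeros n))
          ; ext = λ {φ} {ψ} h → total-cong sized (λ f lf → on φ ψ h f lf)
          ; lin = λ x y φ ψ → trans (total-cong sized (λ f _ → trans (*-congˡ (mono-lin 0 f x y φ ψ (zeros n)))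
              (solve 5 (λ c x y u v → c :* (x :* u :+ y :* v) := x :* (c :* u) :+ y :* (c :* v)) refl (cut f) x y _ _)))
              (total-lin Q x y (λ f → cut f * mono 0 f φ (zeros n)) (λ f → cut f * mono 0 f ψ (zeros n)))
          }
          where
          on : ∀ φ ψ → Agree n d φ ψ → ∀ f → length f ≡ n → cut f * mono 0 f φ (zeros n) ≈ cut f * mono 0 f ψ (zeros n)
          on φ ψ h f lf with size f ≤? d
          ... | no _  = trans (zeroˡ _) (sym (zeroˡ _))
          ... | yes p = *-congˡ (mono-agree {n} {0} 0 f (ℕₚ.≤-reflexive lf)
            (λ l el s → h l el (ℕₚ.≤-trans s (≡.subst (_≤ d) (≡.sym (ℕₚ.+-identityʳ (size f))) p)))
            (zeros n) (Listₚ.length-replicate n) (ℕₚ.≤-reflexive (size-zeros n)))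

        open Linear ℓ using () renaming (⟪_⟫ to ℓ⟪_⟫)

        ℓ-value : ∀ ν → length ν ≡ n → ℓ⟪ ev ν ⟫ ≈ total Q (power (bar ν))
        ℓ-value ν len = trans (total-cong sized (λ f lf → *-congˡ (mono-value n (bar ν) f (≡.trans (length-bar ν) len) lf))) (total-cut (power (bar ν)))

        ℓ-coef : ∀ f → length f ≡ n → ℓ⟪ barCoeff f ⟫ ≈ coef Q f
        ℓ-coef f lf = trans (total-cong sized (λ g lg → *-congˡ (mono-coefficient n g f lg lf))) (total-cut (λ g → δ g f))

        ℓ-swap : ∀ k ν → length ν ≡ n → suc k < n → at (suc k) ν < at k ν → ℓ⟪ ev ν ⟫ ≈ ℓ⟪ ev (swap k ν) ⟫
        ℓ-swap k ν len p desc = trans (ℓ-value ν len) (trans (sym (total-swap k Q (power (bar ν)) sized (λ f lf → Q-sym k f p lf)))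
          (trans (total-cong sized (λ f lf → trans (sym (power-swap k (bar ν) f (≡.trans (length-bar ν) (≡.trans len (≡.sym lf)))))
              (reflexive (≡.cong (λ x → power x f) (≡.sym (bar-swap k ν (λ eq → ℕₚ.<⇒≢ desc (≡.sym eq))))))))
            (sym (ℓ-value (swap k ν) (≡.trans (length-swap k ν) len)))))

        f̂ = F⟪ ev shape ⟫
        p̂ = ℓ⟪ ev shape ⟫

        -- Otherwise F would vanish at all nodes, hence identically, against its nonzero leading
        -- coefficient.
        f̂≉0 : ¬ (f̂ ≈ 0#)
        f̂≉0 h = lead≉0 T (trans (sym F-lead) (zero-functional n d F (from-sorted X closed sorted) (barCoeff shape)))
          where
          X : List ℕ → Set
          X ν = length ν ≡ n → size ν ≤ d → F⟪ ev ν ⟫ ≈ 0#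
          closed : Closed X
          closed k ν p desc x len sz = trans (F-swap k ν len (≡.subst (suc k <_) len p) desc)
            (x (≡.trans (length-swap k ν) len) (≡.subst (_≤ d) (≡.sym (size-swap k ν)) sz))
          sorted : ∀ ν → AllPairs _≤_ ν → X ν
          sorted ν inc len sz with Listₚ.≡-dec ℕ._≟_ ν shape
          ... | yes ≡.refl = h
          ... | no ne      = F-van ν inc len sz ne

        -- The cross-multiplied difference vanishes at `shape` by the choice of f̂ and p̂; at every
        -- other increasing node both functionals vanish.
        L : Linear n (_≤ d)
        L = record
          { ⟪_⟫ = λ φ → f̂ * ℓ⟪ φ ⟫ - p̂ * F⟪ φ ⟫
          ; ext = λ h → +-cong (*-congˡ (Linear.ext ℓ h)) (-‿cong (*-congˡ (Linear.ext F h)))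
          ; lin = λ x y φ ψ → trans (+-cong (*-congˡ (Linear.lin ℓ x y φ ψ)) (-‿cong (*-congˡ (Linear.lin F x y φ ψ))))
              (solve 8 (λ f p x y a b u v → f :* (x :* a :+ y :* b) :- p :* (x :* u :+ y :* v) := x :* (f :* a :- p :* u) :+ y :* (f :* b :- p :* v))
                refl f̂ p̂ x y ℓ⟪ φ ⟫ ℓ⟪ ψ ⟫ F⟪ φ ⟫ F⟪ ψ ⟫)
          }

        proportional : ∀ φ → f̂ * ℓ⟪ φ ⟫ ≈ p̂ * F⟪ φ ⟫
        proportional φ = x-y≈0⇒x≈y (zero-functional n d L (from-sorted X closed sorted) φ)
          where
          X : List ℕ → Set
          X ν = length ν ≡ n → size ν ≤ d → Linear.⟪_⟫ L (ev ν) ≈ 0#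
          closed : Closed X
          closed k ν p desc x len sz = trans (+-cong (*-congˡ (ℓ-swap k ν len p′ desc)) (-‿cong (*-congˡ (F-swap k ν len p′ desc))))
            (x (≡.trans (length-swap k ν) len) (≡.subst (_≤ d) (≡.sym (size-swap k ν)) sz))
            where p′ = ≡.subst (suc k <_) len p
          sorted : ∀ ν → AllPairs _≤_ ν → X ν
          sorted ν inc len sz with Listₚ.≡-dec ℕ._≟_ ν shape
          ... | yes ≡.refl = trans (+-congˡ (-‿cong (*-comm p̂ f̂))) (-‿inverseʳ _)
          ... | no ne      = trans (+-cong (trans (*-congˡ (trans (ℓ-value ν len) (Q-van ν inc len sz ne))) (zeroʳ f̂))
                               (trans (-‿cong (trans (*-congˡ (F-van ν inc len sz ne)) (zeroʳ p̂))) -0#≈0#)) (+-identityˡ 0#)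

        -- The unknown ratio of p̂ to f̂ is eliminated by comparing with the coefficient at `shape`,
        -- where F is known from `F-lead`.
        coefficients : ∀ f → length f ≡ n → lead T * coef Q f ≈ coef Q shape * F⟪ barCoeff f ⟫
        coefficients f lf = x-y≈0⇒x≈y (cancel f̂≉0 (begin
          f̂ * (lead T * coef Q f - coef Q shape * Φ f)
            ≈⟨ solve 5 (λ f c q s p → f :* (c :* q :- s :* p) := c :* (f :* q) :- p :* (f :* s)) refl f̂ (lead T) (coef Q f) (coef Q shape) (Φ f) ⟩
          lead T * (f̂ * coef Q f) - Φ f * (f̂ * coef Q shape) ≈⟨ +-cong (*-congˡ (at-coef f lf)) (-‿cong (*-congˡ (trans (at-coef shape l-shape) (*-congˡ F-lead)))) ⟩
          lead T * (p̂ * Φ f) - Φ f * (p̂ * lead T) ≈⟨ solve 3 (λ c p φ → c :* (p :* φ) :- φ :* (p :* c) := con (+ 0)) refl (lead T) p̂ (Φ f) ⟩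
          0# ∎))
          where
          Φ : List ℕ → K
          Φ f = F⟪ barCoeff f ⟫
          l-shape : length shape ≡ n
          l-shape = ≡.trans (length-col q κ) e
          at-coef : ∀ f → length f ≡ n → f̂ * coef Q f ≈ p̂ * Φ f
          at-coef f lf = trans (*-congˡ (sym (ℓ-coef f lf))) (proportional (barCoeff f))

  -- The cone of polynomials in α with natural coefficients

  valueℕ : List ℕ → K
  valueℕ []      = 0#
  valueℕ (c ∷ p) = nat c + α * valueℕ p

  addℕ : List ℕ → List ℕ → List ℕ
  addℕ []      q       = q
  addℕ (a ∷ p) []      = a ∷ p
  addℕ (a ∷ p) (b ∷ q) = a ℕ.+ b ∷ addℕ p q

  valueℕ-add : ∀ p q → valueℕ (addℕ p q) ≈ valueℕ p + valueℕ q
  valueℕ-add []      q       = sym (+-identityˡ _)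
  valueℕ-add (a ∷ p) []      = sym (+-identityʳ _)
  valueℕ-add (a ∷ p) (b ∷ q) = trans (+-cong (nat-+ a b) (*-congˡ (valueℕ-add p q)))
    (solve 5 (λ a b α p q → a :+ b :+ α :* (p :+ q) := a :+ α :* p :+ (b :+ α :* q)) refl (nat a) (nat b) α _ _)

  timesℕ : ℕ → List ℕ → List ℕ
  timesℕ c []      = []
  timesℕ c (b ∷ q) = c ℕ.* b ∷ timesℕ c q

  valueℕ-times : ∀ c q → valueℕ (timesℕ c q) ≈ nat c * valueℕ q
  valueℕ-times c []      = sym (zeroʳ _)
  valueℕ-times c (b ∷ q) = trans (+-cong (nat-* c b) (*-congˡ (valueℕ-times c q)))
    (solve 4 (λ c b α q → c :* b :+ α :* (c :* q) := c :* (b :+ α :* q)) refl (nat c) (nat b) α _)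

  mulℕ : List ℕ → List ℕ → List ℕ
  mulℕ []      q = []
  mulℕ (a ∷ p) q = addℕ (timesℕ a q) (0 ∷ mulℕ p q)

  valueℕ-mul : ∀ p q → valueℕ (mulℕ p q) ≈ valueℕ p * valueℕ q
  valueℕ-mul []      q = sym (zeroˡ _)
  valueℕ-mul (a ∷ p) q = trans (valueℕ-add (timesℕ a q) (0 ∷ mulℕ p q)) (trans (+-cong (valueℕ-times a q) (+-congˡ (*-congˡ (valueℕ-mul p q))))
    (solve 4 (λ a α p q → a :* q :+ (con (+ 0) :+ α :* (p :* q)) := (a :+ α :* p) :* q) refl (nat a) α _ _))

  cone : Cone
  cone = record
    { Pos   = λ x → ∃ λ p → x ≈ valueℕ p
    ; resp  = λ { e (p , h) → p , trans (sym e) h }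
    ; pos-0 = [] , refl
    ; pos-1 = 1 ∷ [] , solve 2 (λ o α → o := o :+ con (+ 0) :+ α :* con (+ 0)) refl 1# α
    ; pos-α = 0 ∷ 1 ∷ [] , trans (sym (*-identityʳ α)) (solve 2 (λ o α → α :* o := con (+ 0) :+ α :* (o :+ con (+ 0) :+ α :* con (+ 0))) refl 1# α)
    ; pos-+ = λ { (p , h) (q , g) → addℕ p q , trans (+-cong h g) (sym (valueℕ-add p q)) }
    ; pos-* = λ { (p , h) (q , g) → mulℕ p q , trans (*-cong h g) (sym (valueℕ-mul p q)) }
    }

  -- Partitions as vectors and the original variables

  module Rescaled (r : K) (αr : α * r ≈ 1#) where

    open import Data.Vec as Vec using (Vec; []; _∷_; lookup; toList)
    import Data.Vec.Properties as Vecₚ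
    open import Data.Fin using (Fin; zero; suc; toℕ)

    increasing-split : ∀ l → AllPairs _≤_ l → ∃ λ q → ∃ λ κ → l ≡ zeros q ++ map suc κ × AllPairs _≤_ κ
    increasing-split []          _        = 0 , [] , ≡.refl , []
    increasing-split (zero ∷ l)  (_ ∷ hs) with increasing-split l hs
    ... | q , κ , ≡.refl , s = suc q , κ , ≡.refl , s
    increasing-split (suc x ∷ l) (h ∷ hs) = 0 , x ∷ map pred l , ≡.cong (suc x ∷_) (unpred h) , lower h ∷ pairs h hs
      where
      unpred : ∀ {l} → All (suc x ≤_) l → l ≡ map suc (map pred l)
      unpred []                     = ≡.refl
      unpred {suc y ∷ l} (_ ∷ hs) = ≡.cong (suc y ∷_) (unpred hs)
      lower : ∀ {x l} → All (suc x ≤_) l → All (x ≤_) (map pred l)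
      lower []                           = []
      lower {l = suc y ∷ l} (s≤s p ∷ hs) = p ∷ lower hs
      pairs : ∀ {l} → All (suc x ≤_) l → AllPairs _≤_ l → AllPairs _≤_ (map pred l)
      pairs []                 []       = []
      pairs {suc y ∷ l} (_ ∷ gs) (h ∷ hs) = lower h ∷ pairs gs hs

    col-shorter : ∀ q κ m d → q ℕ.+ length κ ≡ suc m →
      length (zeros q ++ map suc κ) ℕ.+ size (zeros q ++ map suc κ) ≤ suc d → length κ ℕ.+ size κ ≤ d
    col-shorter q κ m d eq p = ℕₚ.≤-pred (ℕₚ.≤-trans (s≤s (ℕₚ.m≤n+m (length κ ℕ.+ size κ) m))
      (≡.subst (_≤ suc d) (≡.cong₂ ℕ._+_ (≡.trans (length-col q κ) eq) (size-col q κ)) p))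

    -- Splitting off the empty rows and the first column of a nonempty list lowers length plus size:
    -- by `col-shorter` the loss is the number of rows.
    tower : ∀ d l → length l ℕ.+ size l ≤ d → AllPairs _≤_ l → Tower l
    tower zero    []      p s = nil
    tower (suc d) l       p s with increasing-split l s
    ... | zero  , []    , ≡.refl , _  = nil
    ... | zero  , x ∷ κ , ≡.refl , s′ = col 0 (tower d (x ∷ κ) (col-shorter 0 (x ∷ κ) (length κ) d ≡.refl p) s′)
    ... | suc q , κ     , ≡.refl , s′ = col (suc q) (tower d κ (col-shorter (suc q) κ (q ℕ.+ length κ) d ≡.refl p) s′)

    mir : ∀ {n} → Vec ℕ n → List ℕ
    mir e = reverse (toList e)

    mir-∷ : ∀ {n} x (e : Vec ℕ n) → mir (x ∷ e) ≡ mir e ++ x ∷ []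
    mir-∷ x e = Listₚ.unfold-reverse x (toList e)

    length-mir : ∀ {n} (e : Vec ℕ n) → length (mir e) ≡ n
    length-mir e = ≡.trans (Listₚ.length-reverse (toList e)) (Vecₚ.length-toList e)

    size-mir : ∀ {n} (e : Vec ℕ n) → size (mir e) ≡ Vec.sum e
    size-mir []      = ≡.refl
    size-mir (x ∷ e) = ≡.trans (≡.cong size (mir-∷ x e)) (≡.trans (size-∷ʳ (mir e) x) (≡.cong (x ℕ.+_) (size-mir e)))

    mir-injective : ∀ {n} (e f : Vec ℕ n) → mir e ≡ mir f → e ≡ f
    mir-injective []      []      h = ≡.refl
    mir-injective (x ∷ e) (y ∷ f) h with Listₚ.∷ʳ-injective (mir e) (mir f) (≡.trans (≡.sym (mir-∷ x e)) (≡.trans h (mir-∷ y f)))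
    ... | h₁ , ≡.refl = ≡.cong (x ∷_) (mir-injective e f h₁)

    mir-surjective : ∀ n l → length l ≡ n → ∃ λ (e : Vec ℕ n) → mir e ≡ l
    mir-surjective n l ≡.refl = go (reverse l) (Listₚ.length-reverse l) (Listₚ.reverse-involutive l)
      where
      toList-fromList : ∀ l → toList (Vec.fromList l) ≡ l
      toList-fromList []      = ≡.refl
      toList-fromList (x ∷ l) = ≡.cong (x ∷_) (toList-fromList l)
      go : ∀ {n} l′ → length l′ ≡ n → reverse l′ ≡ l → ∃ λ (e : Vec ℕ n) → mir e ≡ l
      go l′ ≡.refl eq = Vec.fromList l′ , ≡.trans (≡.cong reverse (toList-fromList l′)) eq

    all-mir⁺ : ∀ {n} {P : ℕ → Set} (e : Vec ℕ n) → (∀ i → P (lookup e i)) → All P (mir e)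
    all-mir⁺ []      h = []
    all-mir⁺ {P = P} (x ∷ e) h = ≡.subst (All P) (≡.sym (mir-∷ x e)) (Allₚ.++⁺ (all-mir⁺ e (λ i → h (suc i))) (h zero ∷ []))

    all-mir⁻ : ∀ {n} {P : ℕ → Set} (e : Vec ℕ n) → All P (mir e) → ∀ i → P (lookup e i)
    all-mir⁻ {P = P} (x ∷ e) h i with Allₚ.++⁻ (mir e) (≡.subst (All P) (mir-∷ x e) h)
    all-mir⁻ (x ∷ e) h zero    | _ , (hx ∷ []) = hx
    all-mir⁻ (x ∷ e) h (suc i) | he , _        = all-mir⁻ e he i

    Decreasing : ∀ {n} → Vec ℕ n → Set
    Decreasing e = ∀ i j → toℕ i ≤ toℕ j → lookup e j ≤ lookup e i

    increasing-mir : ∀ {n} (e : Vec ℕ n) → Decreasing e → AllPairs _≤_ (mir e)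
    increasing-mir []      h = []
    increasing-mir (x ∷ e) h = ≡.subst (AllPairs _≤_) (≡.sym (mir-∷ x e)) (AllPairsₚ.++⁺ (increasing-mir e (λ i j p → h (suc i) (suc j) (s≤s p)))
      ([] ∷ []) (All.map (λ p → p ∷ []) (all-mir⁺ e (λ i → h zero (suc i) z≤n))))

    decreasing-mir : ∀ {n} (e : Vec ℕ n) → AllPairs _≤_ (mir e) → Decreasing e
    decreasing-mir (x ∷ e) h = on
      where
      unsnoc : ∀ l → AllPairs _≤_ (l ++ x ∷ []) → AllPairs _≤_ l × All (_≤ x) l
      unsnoc []      _        = [] , []
      unsnoc (y ∷ l) (g ∷ gs) with Allₚ.++⁻ l g | unsnoc l gs
      ... | g₁ , (y≤x ∷ []) | s , b = g₁ ∷ s , y≤x ∷ b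
      parts = unsnoc (mir e) (≡.subst (AllPairs _≤_) (mir-∷ x e) h)
      on : Decreasing (x ∷ e)
      on zero    zero    _       = ℕₚ.≤-refl
      on zero    (suc j) _       = all-mir⁻ e (proj₂ parts) j
      on (suc i) (suc j) (s≤s p) = decreasing-mir e (proj₁ parts) i j p

    vswap : ∀ {n} → ℕ → Vec ℕ n → Vec ℕ n
    vswap zero    (x ∷ y ∷ e) = y ∷ x ∷ e
    vswap (suc k) (x ∷ e)     = x ∷ vswap k e
    vswap _       e           = e

    swap-end : ∀ (t : List ℕ) x y → swap (length t) ((t ++ y ∷ []) ++ x ∷ []) ≡ (t ++ x ∷ []) ++ y ∷ []
    swap-end []      x y = ≡.refl
    swap-end (a ∷ t) x y = ≡.cong (a ∷_) (swap-end t x y)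

    -- Mirroring sends the adjacent pair at k to the one at n - 2 - k, which is what the equation
    -- between k, k′ and n encodes.
    swap-mir : ∀ {n} k k′ (e : Vec ℕ n) → suc (suc (k ℕ.+ k′)) ≡ n → swap k (mir e) ≡ mir (vswap k′ e)
    swap-mir k zero (x ∷ y ∷ e) h = begin′
      where
      two : ∀ a b → mir (a ∷ b ∷ e) ≡ (mir e ++ b ∷ []) ++ a ∷ []
      two a b = ≡.trans (mir-∷ a (b ∷ e)) (≡.cong (_++ a ∷ []) (mir-∷ b e))
      k≡ : k ≡ length (mir e)
      k≡ = ≡.trans (≡.sym (ℕₚ.+-identityʳ k)) (≡.trans (ℕₚ.suc-injective (ℕₚ.suc-injective h)) (≡.sym (length-mir e)))
      begin′ = ≡.trans (≡.cong₂ swap k≡ (two x y)) (≡.trans (swap-end (mir e) x y) (≡.sym (two y x)))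
    swap-mir {suc n} k (suc k′) (x ∷ e) h = ≡.trans (≡.cong (swap k) (mir-∷ x e))
      (≡.trans (swap-∷ʳ k (mir e) x (≡.subst (suc k <_) (≡.sym (length-mir e)) k<))
        (≡.trans (≡.cong (_++ x ∷ []) (swap-mir k k′ e h′)) (≡.sym (mir-∷ x (vswap k′ e)))))
      where
      h′ : suc (suc (k ℕ.+ k′)) ≡ n
      h′ = ≡.trans (≡.cong suc (≡.sym (ℕₚ.+-suc k k′))) (ℕₚ.suc-injective h)
      k< : suc k < n
      k< = ≡.subst (suc (suc k) ≤_) h′ (s≤s (s≤s (ℕₚ.m≤m+n k k′)))

    iota : ℕ → ℕ → List ℕ
    iota s zero    = []
    iota s (suc n) = s ∷ iota (suc s) n

    iota-∷ʳ : ∀ s n → iota s (suc n) ≡ iota s n ++ s ℕ.+ n ∷ []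
    iota-∷ʳ s zero    = ≡.cong (_∷ []) (≡.sym (ℕₚ.+-identityʳ s))
    iota-∷ʳ s (suc n) = ≡.cong (s ∷_) (≡.trans (iota-∷ʳ (suc s) n) (≡.cong (λ m → iota (suc s) n ++ m ∷ []) (≡.sym (ℕₚ.+-suc s n))))

    length-iota : ∀ s n → length (iota s n) ≡ n
    length-iota s zero    = ≡.refl
    length-iota s (suc n) = ≡.cong suc (length-iota (suc s) n)

    rank-increasing : ∀ l → AllPairs _≤_ l → rank l ≡ iota 0 (length l)
    rank-increasing []      _        = ≡.refl
    rank-increasing (a ∷ l) (h ∷ hs) = ≡.cong₂ _∷_ (below-all l h) (≡.trans (≡.cong (bump a l) (rank-increasing l hs)) (bump-all 0 l h))
      where
      below-all : ∀ l → All (a ≤_) l → below a l ≡ 0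
      below-all []      _        = ≡.refl
      below-all (x ∷ l) (p ∷ ps) = ≡.cong₂ ℕ._+_ (le-above p) (below-all l ps)
      bump-all : ∀ s l → All (a ≤_) l → bump a l (iota s (length l)) ≡ iota (suc s) (length l)
      bump-all s []      _        = ≡.refl
      bump-all s (x ∷ l) (p ∷ ps) = ≡.cong₂ _∷_ (≡.cong (ℕ._+ s) (le-under p)) (bump-all (suc s) l ps)

    power-∷ʳ : ∀ p x e a → length p ≡ length e → power (p ++ x ∷ []) (e ++ a ∷ []) ≈ power p e * pow x a
    power-∷ʳ []      x []      a h = *-comm _ _
    power-∷ʳ (y ∷ p) x (b ∷ e) a h = trans (*-congˡ (power-∷ʳ p x e a (ℕₚ.suc-injective h))) (sym (*-assoc _ _ _))

    pow-+ : ∀ x a b → pow x (a ℕ.+ b) ≈ pow x a * pow x b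
    pow-+ x zero    b = sym (*-identityˡ _)
    pow-+ x (suc a) b = trans (*-congˡ (pow-+ x a b)) (sym (*-assoc _ _ _))

    pow-* : ∀ x y a → pow (x * y) a ≈ pow x a * pow y a
    pow-* x y zero    = sym (*-identityˡ _)
    pow-* x y (suc a) = trans (*-congˡ (pow-* x y a)) (solve 4 (λ x y p q → x :* y :* (p :* q) := x :* p :* (y :* q)) refl x y _ _)

    pow-cong : ∀ {x y} a → x ≈ y → pow x a ≈ pow y a
    pow-cong zero    h = refl
    pow-cong (suc a) h = *-cong h (pow-cong a h)

    pow-1 : ∀ a → pow 1# a ≈ 1#
    pow-1 zero    = refl
    pow-1 (suc a) = trans (*-identityˡ _) (pow-1 a)

    monomialᴷ : ∀ {n} → (Fin n → K) → Vec ℕ n → K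
    monomialᴷ x []      = 1#
    monomialᴷ x (a ∷ e) = pow (x zero) a * monomialᴷ (λ i → x (suc i)) e

    -- Here α r = 1 rescales the point ν + r·rank to the point bar ν.
    power-mir : ∀ {n} (μ e : Vec ℕ n) (x : Fin n → K) → (∀ i → x i ≈ nat (lookup μ i) + nat (n ∸ suc (toℕ i)) * r) →
      pow (- r) (Vec.sum e) * power (vals (mir μ) (iota 0 n)) (mir e) ≈ monomialᴷ x e
    power-mir []      []      x h = *-identityˡ _
    power-mir {suc n} (m ∷ μ) (a ∷ e) x h = begin
      pow (- r) (a ℕ.+ Vec.sum e) * power (vals (mir (m ∷ μ)) (iota 0 (suc n))) (mir (a ∷ e))
        ≈⟨ *-cong (pow-+ (- r) a (Vec.sum e)) (trans (reflexive (≡.cong₂ power (≡.trans (≡.cong₂ vals (mir-∷ m μ) (iota-∷ʳ 0 n))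
             (vals-∷ʳ (mir μ) (iota 0 n) m n len)) (mir-∷ a e)))
             (power-∷ʳ (vals (mir μ) (iota 0 n)) (val m n) (mir e) a (≡.trans (length-vals (mir μ) (iota 0 n) len) (≡.trans (length-mir μ) (≡.sym (length-mir e)))))) ⟩
      pow (- r) a * pow (- r) (Vec.sum e) * (power (vals (mir μ) (iota 0 n)) (mir e) * pow (val m n) a)
        ≈⟨ solve 4 (λ a b c d → a :* b :* (c :* d) := a :* d :* (b :* c)) refl _ _ _ _ ⟩
      pow (- r) a * pow (val m n) a * (pow (- r) (Vec.sum e) * power (vals (mir μ) (iota 0 n)) (mir e))
        ≈⟨ *-cong (trans (sym (pow-* (- r) (val m n) a)) (pow-cong a scaled)) (power-mir μ e (λ i → x (suc i)) (λ i → h (suc i))) ⟩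
      pow (x zero) a * monomialᴷ (λ i → x (suc i)) e ∎
      where
      len : length (iota 0 n) ≡ length (mir μ)
      len = ≡.trans (length-iota 0 n) (≡.sym (length-mir μ))
      scaled : - r * val m n ≈ x zero
      scaled = begin
        - r * - (α * nat m + nat n) ≈⟨ solve 4 (λ α r m n → :- r :* :- (α :* m :+ n) := α :* r :* m :+ n :* r) refl α r (nat m) (nat n) ⟩
        α * r * nat m + nat n * r   ≈⟨ +-congʳ (trans (*-congʳ αr) (*-identityˡ _)) ⟩
        nat m + nat n * r           ≈⟨ h zero ⟨
        x zero                      ∎

    -- the hook product

    count : ℕ → List ℕ → ℕ
    count j []      = 0
    count j (x ∷ l) = le j x ℕ.+ count j l

    row : ℕ → ℕ → List ℕ → K
    row x zero    l = 1#
    row x (suc t) l = row x t l * (α * nat (x ∸ suc t) + nat (suc (count (suc t) l)))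

    hook : List ℕ → K
    hook []      = 1#
    hook (x ∷ l) = row x x l * hook l

    count-1 : ∀ q l → count 1 (map suc l ++ zeros q) ≡ length l
    count-1 zero    []      = ≡.refl
    count-1 (suc q) []      = count-1 q []
    count-1 q       (x ∷ l) = ≡.cong suc (count-1 q l)

    count-suc : ∀ q j l → count (suc (suc j)) (map suc l ++ zeros q) ≡ count (suc j) l
    count-suc zero    j []      = ≡.refl
    count-suc (suc q) j []      = count-suc q j []
    count-suc q       j (x ∷ l) = ≡.cong (le (suc j) x ℕ.+_) (count-suc q j l)

    row-suc : ∀ q x t l → row (suc x) (suc t) (map suc l ++ zeros q) ≈ (α * nat x + nat (suc (length l))) * row x t l
    row-suc q x zero    l = trans (*-identityˡ _) (trans (+-congˡ (reflexive (≡.cong (λ m → nat (suc m)) (count-1 q l)))) (sym (*-identityʳ _)))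
    row-suc q x (suc t) l = trans (*-cong (row-suc q x t l) (+-congˡ (reflexive (≡.cong (λ m → nat (suc m)) (count-suc q t l))))) (*-assoc _ _ _)

    -- Removing the first column changes neither arm nor leg of the other boxes. The list is
    -- reversed because `column` starts from the shortest row.
    hook-column : ∀ q l → hook (map suc l ++ zeros q) ≈ column 0 (reverse l) * hook l
    hook-column zero    []      = sym (*-identityˡ _)
    hook-column (suc q) []      = trans (*-identityˡ _) (hook-column q [])
    hook-column q       (x ∷ l) = begin
      row (suc x) (suc x) (map suc l ++ zeros q) * hook (map suc l ++ zeros q) ≈⟨ *-cong (row-suc q x x l) (hook-column q l) ⟩
      f * row x x l * (column 0 (reverse l) * hook l) ≈⟨ solve 4 (λ f a b c → f :* a :* (b :* c) := b :* f :* (a :* c)) refl f _ _ _ ⟩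
      column 0 (reverse l) * f * (row x x l * hook l)
        ≈⟨ *-congʳ (trans (reflexive (≡.cong (column 0) (Listₚ.unfold-reverse x l))) (trans (column-∷ʳ 0 (reverse l)) (*-congˡ (+-congˡ (reflexive (≡.cong (λ m → nat (suc m)) (Listₚ.length-reverse l))))))) ⟨
      column 0 (reverse (x ∷ l)) * (row x x l * hook l) ∎
      where
      f = α * nat x + nat (suc (length l))
      column-∷ʳ : ∀ s l → column s (l ++ x ∷ []) ≈ column s l * (α * nat x + nat (suc (s ℕ.+ length l)))
      column-∷ʳ s []      = trans (*-comm _ _) (*-congˡ (+-congˡ (reflexive (≡.cong (λ m → nat (suc m)) (≡.sym (ℕₚ.+-identityʳ s))))))
      column-∷ʳ s (y ∷ l) = trans (*-congˡ (column-∷ʳ (suc s) l)) (trans (sym (*-assoc _ _ _))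
        (*-congˡ (+-congˡ (reflexive (≡.cong (λ m → nat (suc m)) (≡.sym (ℕₚ.+-suc s (length l))))))))

    reverse-zeros : ∀ q → reverse (zeros q) ≡ zeros q
    reverse-zeros zero    = ≡.refl
    reverse-zeros (suc q) = ≡.trans (Listₚ.unfold-reverse 0 (zeros q)) (≡.trans (≡.cong (_++ 0 ∷ []) (reverse-zeros q))
      (≡.trans (zeros-∷ q []) (≡.cong (0 ∷_) (Listₚ.++-identityʳ (zeros q)))))

    reverse-col : ∀ q κ → reverse (zeros q ++ map suc κ) ≡ map suc (reverse κ) ++ zeros q
    reverse-col q κ = ≡.trans (Listₚ.reverse-++ (zeros q) (map suc κ)) (≡.cong₂ _++_ (≡.sym (Listₚ.reverse-map suc κ)) (reverse-zeros q))

    hook-lead : ∀ {κ} (T : Tower κ) q → hook (reverse (zeros q ++ map suc κ)) ≈ lead T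
    hook-lead {κ} T q = trans (reflexive (≡.cong hook (reverse-col q κ))) (trans (hook-column q (reverse κ))
      (trans (*-congʳ (reflexive (≡.cong (column 0) (Listₚ.reverse-involutive κ)))) (go T)))
      where
      go : ∀ {κ} (T : Tower κ) → column 0 κ * hook (reverse κ) ≈ lead T
      go nil         = *-identityˡ _
      go (col p T)   = *-congˡ (hook-lead T p)

    pow-comm-inverse : ∀ k → pow (- α) k * pow (- r) k ≈ 1#
    pow-comm-inverse k = trans (sym (pow-* (- α) (- r) k)) (trans (pow-cong k (trans (solve 2 (λ a r → :- a :* :- r := a :* r) refl α r) αr)) (pow-1 k))

    -- Bookkeeping for the passage between x and y: the sign (-1)^m occurs twice, α^k (-1)^k is
    -- (-α)^k, and (-α)(-r) = 1 removes the powers of -r.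
    normalise : ∀ m k C P Φ → C * (P * pow (- r) m) ≈ pow (- r) (m ℕ.+ k) * Φ →
      pow α k * 1# * (pow (- 1#) (m ℕ.+ k) * C * (pow (- 1#) m * P)) ≈ Φ
    normalise m k C P Φ h = begin
      pow α k * 1# * (pow (- 1#) (m ℕ.+ k) * C * (pow (- 1#) m * P))
        ≈⟨ *-congˡ (*-congʳ (*-congʳ (pow-+ (- 1#) m k))) ⟩
      pow α k * 1# * (σ * pow (- 1#) k * C * (σ * P))
        ≈⟨ solve 6 (λ a o s t C P → a :* o :* (s :* t :* C :* (s :* P)) := s :* s :* (a :* t :* o) :* (C :* P)) refl (pow α k) 1# σ (pow (- 1#) k) C P ⟩
      σ * σ * (pow α k * pow (- 1#) k * 1#) * (C * P)
        ≈⟨ *-congʳ (trans (*-cong (trans (sym (pow-* (- 1#) (- 1#) m)) (trans (pow-cong m square) (pow-1 m)))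
             (trans (*-identityʳ _) (trans (sym (pow-* α (- 1#) k)) (pow-cong k (trans (solve 2 (λ a o → a :* :- o := :- (a :* o)) refl α 1#) (-‿cong (*-identityʳ α))))))) (*-identityˡ _)) ⟩
      pow (- α) k * (C * P) ≈⟨ *-congˡ (trans (sym (*-identityˡ _)) (*-congʳ (sym (pow-comm-inverse m)))) ⟩
      pow (- α) k * (pow (- α) m * pow (- r) m * (C * P))
        ≈⟨ solve 5 (λ a b c C P → a :* (b :* c :* (C :* P)) := a :* b :* (C :* (P :* c))) refl (pow (- α) k) (pow (- α) m) (pow (- r) m) C P ⟩
      pow (- α) k * pow (- α) m * (C * (P * pow (- r) m)) ≈⟨ *-congˡ (trans h (*-congʳ (pow-+ (- r) m k))) ⟩
      pow (- α) k * pow (- α) m * (pow (- r) m * pow (- r) k * Φ)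
        ≈⟨ solve 5 (λ a b c d f → a :* b :* (c :* d :* f) := b :* c :* (a :* d) :* f) refl (pow (- α) k) (pow (- α) m) (pow (- r) m) (pow (- r) k) Φ ⟩
      pow (- α) m * pow (- r) m * (pow (- α) k * pow (- r) k) * Φ ≈⟨ *-congʳ (trans (*-cong (pow-comm-inverse m) (pow-comm-inverse k)) (*-identityˡ 1#)) ⟩
      1# * Φ ≈⟨ *-identityˡ Φ ⟩
      Φ ∎
      where
      σ = pow (- 1#) m
      square : - 1# * - 1# ≈ 1#
      square = trans (solve 1 (λ o → :- o :* :- o := o :* o) refl 1#) (*-identityˡ 1#)

    KPoly : ℕ → Set
    KPoly n = List (K × Vec ℕ n)

    kcoeff : ∀ {n} → KPoly n → Vec ℕ n → K
    kcoeff []             e = 0#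
    kcoeff ((c , e′) ∷ P) e with Vecₚ.≡-dec ℕ._≟_ e′ e
    ... | yes _ = c + kcoeff P e
    ... | no  _ = kcoeff P e

    keval : ∀ {n} → KPoly n → (Fin n → K) → K
    keval []            x = 0#
    keval ((c , e) ∷ P) x = c * monomialᴷ x e + keval P x

    twist : ∀ {n} → (ℕ → K) → KPoly n → KPoly n
    twist f = map (λ t → f (Vec.sum (proj₂ t)) * proj₁ t , proj₂ t)

    kcoeff-twist : ∀ {n} f (P : KPoly n) e → kcoeff (twist f P) e ≈ f (Vec.sum e) * kcoeff P e
    kcoeff-twist f []             e = sym (zeroʳ _)
    kcoeff-twist f ((c , e′) ∷ P) e with Vecₚ.≡-dec ℕ._≟_ e′ e
    ... | yes ≡.refl = trans (+-congˡ (kcoeff-twist f P e)) (sym (distribˡ _ _ _))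
    ... | no  _      = kcoeff-twist f P e

    -- The substitution x = -r y multiplies the coefficient of x^e by the power of -r with exponent
    -- the degree of e.
    terms : ∀ {n} → KPoly n → Terms
    terms []            = []
    terms ((c , e) ∷ P) = (c * pow (- r) (Vec.sum e) , mir e) ∷ terms P

    terms-sized : ∀ {n} (P : KPoly n) → Sized n (terms P)
    terms-sized []            = []
    terms-sized ((c , e) ∷ P) = length-mir e ∷ terms-sized P

    coef-terms : ∀ {n} (P : KPoly n) e → coef (terms P) (mir e) ≈ kcoeff P e * pow (- r) (Vec.sum e)
    coef-terms []             e = sym (zeroˡ _)
    coef-terms ((c , e′) ∷ P) e with Vecₚ.≡-dec ℕ._≟_ e′ e
    ... | yes ≡.refl = trans (+-cong (trans (*-congˡ (δ-≡ (mir e))) (*-identityʳ _)) (coef-terms P e)) (sym (distribʳ _ _ _))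
    ... | no  ne     = trans (+-congʳ (trans (*-congˡ (δ-≢ (mir e′) (mir e) (λ h → ne (mir-injective e′ e h)))) (zeroʳ _))) (trans (+-identityˡ _) (coef-terms P e))

    point : ∀ {n} → Vec ℕ n → Fin n → K
    point {n} μ i = nat (lookup μ i) + nat (n ∸ suc (toℕ i)) * r

    total-terms : ∀ {n} (P : KPoly n) μ → AllPairs _≤_ (mir μ) → total (terms P) (power (bar (mir μ))) ≈ keval P (point μ)
    total-terms []            μ h = refl
    total-terms {n} ((c , e) ∷ P) μ h = +-cong (trans (*-assoc _ _ _) (*-congˡ (trans
      (*-congˡ (reflexive (≡.cong (λ rs → power (vals (mir μ) rs) (mir e)) (≡.trans (rank-increasing (mir μ) h) (≡.cong (iota 0) (length-mir μ))))))
      (power-mir μ e (point μ) (λ i → refl))))) (total-terms P μ h)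

    transfer : Regular → ∀ {n} (λ′ μ : Vec ℕ n) → Decreasing λ′ → (P : KPoly n) →
      (∀ k e → kcoeff P (vswap k e) ≈ kcoeff P e) →
      (∀ e → Vec.sum λ′ < Vec.sum e → kcoeff P e ≈ 0#) →
      (∀ ν → Decreasing ν → ν ≢ λ′ → Vec.sum ν ≤ Vec.sum λ′ → keval P (point ν) ≈ 0#) →
      kcoeff P λ′ ≈ 1# →
      ∃ λ p → pow α (Vec.sum λ′ ∸ Vec.sum μ) * pow r (Vec.sum μ ∸ Vec.sum λ′) *
        kcoeff (twist (λ _ → pow (- 1#) (Vec.sum λ′) * hook (toList λ′)) (twist (pow (- 1#)) P)) μ ≈ valueℕ p
    transfer G {n} λ′ μ dec P P-sym P-deg P-van P-lead with Vec.sum μ ≤? Vec.sum λ′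
    -- Above the degree of P the coefficient vanishes, and the zero polynomial is the witness.
    ... | no m≰d = [] , trans (*-congˡ (trans (kcoeff-twist (λ _ → A) (twist (pow (- 1#)) P) μ) (trans (*-congˡ (trans (kcoeff-twist (pow (- 1#)) P μ)
      (trans (*-congˡ (P-deg μ (ℕₚ.≰⇒> m≰d))) (zeroʳ _)))) (zeroʳ _)))) (zeroʳ _)
      where A = pow (- 1#) (Vec.sum λ′) * hook (toList λ′)
    -- The mirrored λ is zeros q ++ map suc κ. The tower builds κ, and the remaining first column of
    -- λ is added by the symmetrisation in `Shape`.
    ... | yes m≤d with increasing-split (mir λ′) (increasing-mir λ′ dec)
    ... | q , κ , eq , inc = proj₁ positive , trans (reflexive aligned) (trans main (proj₂ positive))
      where
      τ : Tower κ
      τ = tower _ κ ℕₚ.≤-refl inc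
      e : q ℕ.+ length κ ≡ n
      e = ≡.trans (≡.sym (length-col q κ)) (≡.trans (≡.cong length (≡.sym eq)) (length-mir λ′))
      open Main G cone
      open Shape τ q n e using (shape; d; F; F-pos; module Coefficients)
      Q = terms P
      d≡ : d ≡ Vec.sum λ′
      d≡ = ≡.trans (≡.cong size (≡.sym eq)) (size-mir λ′)
      Q-sym : ∀ k f → suc k < n → length f ≡ n → coef Q (swap k f) ≈ coef Q f
      Q-sym k f p lf with mir-surjective n f lf | ℕₚ.m≤n⇒∃[o]m+o≡n p
      ... | v , ≡.refl | k′ , h = begin
        coef Q (swap k (mir v)) ≡⟨ ≡.cong (coef Q) (swap-mir k k′ v h) ⟩
        coef Q (mir (vswap k′ v)) ≈⟨ coef-terms P (vswap k′ v) ⟩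
        kcoeff P (vswap k′ v) * pow (- r) (Vec.sum (vswap k′ v)) ≈⟨ *-cong (P-sym k′ v) (reflexive (≡.cong (pow (- r)) sum≡)) ⟩
        kcoeff P v * pow (- r) (Vec.sum v) ≈⟨ coef-terms P v ⟨
        coef Q (mir v) ∎
        where
        sum≡ : Vec.sum (vswap k′ v) ≡ Vec.sum v
        sum≡ = ≡.trans (≡.sym (size-mir (vswap k′ v))) (≡.trans (≡.cong size (≡.sym (swap-mir k k′ v h))) (≡.trans (size-swap k (mir v)) (size-mir v)))
      Q-deg : ∀ f → length f ≡ n → d < size f → coef Q f ≈ 0#
      Q-deg f lf p with mir-surjective n f lf
      ... | v , ≡.refl = trans (coef-terms P v) (trans (*-congʳ (P-deg v (≡.subst₂ _<_ d≡ (size-mir v) p))) (zeroˡ _))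
      Q-van : ∀ ν → AllPairs _≤_ ν → length ν ≡ n → size ν ≤ d → ν ≢ shape → total Q (power (bar ν)) ≈ 0#
      Q-van ν hν lν sz ne with mir-surjective n ν lν
      ... | v , ≡.refl = trans (total-terms P v hν) (P-van v (decreasing-mir v hν) (λ { ≡.refl → ne eq }) (≡.subst₂ _≤_ (size-mir v) d≡ sz))
      open Coefficients Q (terms-sized P) Q-sym Q-deg Q-van using (coefficients)
      Φ = Linear.⟪_⟫ F (barCoeff (mir μ))
      C = hook (toList λ′)
      m = Vec.sum μ
      k = Vec.sum λ′ ∸ m
      positive = F-pos (mir μ)
      sum≡ : m ℕ.+ k ≡ Vec.sum λ′
      sum≡ = ℕₚ.m+[n∸m]≡n m≤d
      C≈ : C ≈ lead τ
      C≈ = trans (reflexive (≡.cong hook (≡.trans (≡.sym (Listₚ.reverse-involutive (toList λ′))) (≡.cong reverse eq)))) (hook-lead τ q)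
      relation : C * (kcoeff P μ * pow (- r) m) ≈ pow (- r) (m ℕ.+ k) * Φ
      relation = begin
        C * (kcoeff P μ * pow (- r) m) ≈⟨ *-cong C≈ (sym (coef-terms P μ)) ⟩
        lead τ * coef Q (mir μ)        ≈⟨ coefficients (mir μ) (length-mir μ) ⟩
        coef Q shape * Φ               ≈⟨ *-congʳ (trans (reflexive (≡.cong (coef Q) (≡.sym eq))) (trans (coef-terms P λ′) (trans (*-congʳ P-lead) (*-identityˡ _)))) ⟩
        pow (- r) (Vec.sum λ′) * Φ     ≡⟨ ≡.cong (λ s → pow (- r) s * Φ) (≡.sym sum≡) ⟩
        pow (- r) (m ℕ.+ k) * Φ        ∎
      A = pow (- 1#) (Vec.sum λ′) * C
      J = kcoeff (twist (λ _ → A) (twist (pow (- 1#)) P)) μ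
      aligned : pow α k * pow r (m ∸ Vec.sum λ′) * J ≡ pow α k * 1# * J
      aligned = ≡.cong (λ j → pow α k * pow r j * J) (ℕₚ.m≤n⇒m∸n≡0 m≤d)
      main : pow α k * 1# * J ≈ Φ
      main = trans (*-congˡ (trans (kcoeff-twist (λ _ → A) (twist (pow (- 1#)) P) μ)
          (*-cong (*-congʳ (reflexive (≡.cong (pow (- 1#)) (≡.sym sum≡)))) (kcoeff-twist (pow (- 1#)) P μ))))
        (normalise m k C (kcoeff P μ) Φ relation)

    -- Arms, legs and points in their original form

    open import Defs using (arm; leg) renaming (δ to staircase)

    monomialᴷ-cong : ∀ {n} {x y : Fin n → K} → (∀ i → x i ≈ y i) → ∀ e → monomialᴷ x e ≈ monomialᴷ y e
    monomialᴷ-cong h []      = refl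
    monomialᴷ-cong h (a ∷ e) = *-cong (pow-cong a (h zero)) (monomialᴷ-cong (λ i → h (suc i)) e)

    keval-cong : ∀ {n} (P : KPoly n) {x y : Fin n → K} → (∀ i → x i ≈ y i) → keval P x ≈ keval P y
    keval-cong []            h = refl
    keval-cong ((c , e) ∷ P) h = +-cong (*-congˡ (monomialᴷ-cong h e)) (keval-cong P h)

    productᴷ : List K → K
    productᴷ = foldr _*_ 1#

    productᴷ-++ : ∀ xs ys → productᴷ (xs ++ ys) ≈ productᴷ xs * productᴷ ys
    productᴷ-++ []       ys = sym (*-identityˡ _)
    productᴷ-++ (x ∷ xs) ys = trans (*-congˡ (productᴷ-++ xs ys)) (sym (*-assoc _ _ _))

    productFin : ∀ {n} → (Fin n → K) → K
    productFin {zero}  f = 1#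
    productFin {suc n} f = f zero * productFin (λ i → f (suc i))

    productᴷ-concatMap : ∀ {n} {A : Set} (f : A → List K) (g : Fin n → A) →
      productᴷ (concatMap f (tabulate g)) ≈ productFin (λ i → productᴷ (f (g i)))
    productᴷ-concatMap {zero}  f g = refl
    productᴷ-concatMap {suc n} f g = trans (productᴷ-++ (f (g zero)) (concatMap f (tabulate (λ i → g (suc i))))) (*-congˡ (productᴷ-concatMap f (λ i → g (suc i))))

    productFin-cong : ∀ {n} {f g : Fin n → K} → (∀ i → f i ≈ g i) → productFin f ≈ productFin g
    productFin-cong {zero}  h = refl
    productFin-cong {suc n} h = *-cong (h zero) (productFin-cong (λ i → h (suc i)))

    countFin : ∀ {n} → (Fin n → Bool) → ℕ
    countFin {zero}  b = 0
    countFin {suc n} b = (if b zero then 1 else 0) ℕ.+ countFin (λ i → b (suc i))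

    length-filter-tabulate : ∀ {n} {A : Set} {P : A → Set} (P? : Decidable P) (g : Fin n → A) →
      length (filter P? (tabulate g)) ≡ countFin (λ i → does (P? (g i)))
    length-filter-tabulate {zero}  P? g = ≡.refl
    length-filter-tabulate {suc n} P? g with does (P? (g zero))
    ... | true  = ≡.cong suc (length-filter-tabulate P? (λ i → g (suc i)))
    ... | false = length-filter-tabulate P? (λ i → g (suc i))

    le-≤? : ∀ j x → (if does (j ≤? x) then 1 else 0) ≡ le j x
    le-≤? zero          x       = ≡.refl
    le-≤? (suc j)       zero    = ≡.refl
    le-≤? (suc zero)    (suc x) = ≡.refl
    le-≤? (suc (suc j)) (suc x) = le-≤? (suc j) x

    countFin-count : ∀ {n} j (v : Vec ℕ n) → countFin (λ k → does (j ≤? lookup v k)) ≡ count j (toList v)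
    countFin-count j []      = ≡.refl
    countFin-count j (x ∷ v) = ≡.cong₂ ℕ._+_ (le-≤? j x) (countFin-count j v)

    leg-zero : ∀ {n} x (v : Vec ℕ n) j → leg (x ∷ v) zero j ≡ count j (toList v)
    leg-zero x v j = ≡.trans (length-filter-tabulate (λ k → (0 ℕ.<? toℕ k) ×-dec (j ≤? lookup (x ∷ v) k)) id) (countFin-count j v)

    leg-suc : ∀ {n} x (v : Vec ℕ n) i j → leg (x ∷ v) (suc i) j ≡ leg v i j
    leg-suc x v i j = ≡.trans (length-filter-tabulate (λ k → (toℕ (suc i) ℕ.<? toℕ k) ×-dec (j ≤? lookup (x ∷ v) k)) id)
      (≡.sym (length-filter-tabulate (λ k → (toℕ i ℕ.<? toℕ k) ×-dec (j ≤? lookup v k)) id))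

    -- The statement embeds ℕ by constants k / 1, while `nat` iterates addition. A parameter `cast`
    -- keeps products and points in the literal form of the statement.
    module Boxes (cast : ℕ → K) (cast≈nat : ∀ k → cast k ≈ nat k) where

      box : ∀ {n} → Vec ℕ n → Fin n → ℕ → K
      box v i t = α * cast (arm v i (suc t)) + cast (leg v i (suc t)) + 1#

      boxes : ∀ {n} → Vec ℕ n → K
      boxes {n} v = productᴷ (concatMap (λ i → map (box v i) (upTo (lookup v i))) (allFin n))

      nat-cast : ∀ m k → α * cast m + cast k + 1# ≈ α * nat m + nat (suc k)
      nat-cast m k = trans (+-congʳ (+-cong (*-congˡ (cast≈nat m)) (cast≈nat k)))
        (solve 3 (λ a k o → a :+ k :+ o := a :+ (o :+ k)) refl (α * nat m) (nat k) 1#)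

      row-boxes : ∀ x l (f : ℕ → K) → (∀ t → f t ≈ α * nat (x ∸ suc t) + nat (suc (count (suc t) l))) →
        ∀ m → productᴷ (map f (upTo m)) ≈ row x m l
      row-boxes x l f h zero    = refl
      row-boxes x l f h (suc m) = trans (reflexive (≡.cong productᴷ (≡.trans (≡.cong (map f) (≡.sym (Listₚ.upTo-∷ʳ m))) (Listₚ.map-++ f (upTo m) (m ∷ [])))))
        (trans (productᴷ-++ (map f (upTo m)) (f m ∷ [])) (*-cong (row-boxes x l f h m) (trans (*-identityʳ _) (h m))))

      productFin-hook : ∀ {n} (v : Vec ℕ n) → productFin (λ i → productᴷ (map (box v i) (upTo (lookup v i)))) ≈ hook (toList v)
      productFin-hook []      = refl
      productFin-hook (x ∷ v) = *-cong
        (row-boxes x (toList v) (box (x ∷ v) zero) (λ t → trans (nat-cast (x ∸ suc t) (leg (x ∷ v) zero (suc t)))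
          (+-congˡ (reflexive (≡.cong (λ k → nat (suc k)) (leg-zero x v (suc t)))))) x)
        (trans (productFin-cong (λ i → reflexive (≡.cong productᴷ (Listₚ.map-cong (λ t →
          ≡.cong (λ k → α * cast (arm v i (suc t)) + cast k + 1#) (leg-suc x v i (suc t))) (upTo (lookup v i)))))) (productFin-hook v))

      boxes-hook : ∀ {n} (v : Vec ℕ n) → boxes v ≈ hook (toList v)
      boxes-hook v = trans (productᴷ-concatMap (λ i → map (box v i) (upTo (lookup v i))) id) (productFin-hook v)

    clear-denominator : ∀ x y → x + r * y ≈ r * (α * x + y)
    clear-denominator x y = trans (+-congʳ (trans (sym (*-identityˡ x)) (*-congʳ (sym αr))))
      (solve 4 (λ a r p s → a :* r :* p :+ r :* s := r :* (a :* p :+ s)) refl α r x y)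

    module Cast (cast : ℕ → K) (cast≈nat : ∀ k → cast k ≈ nat k)
      (domain : ∀ x y → ¬ (x ≈ 0#) → x * y ≈ 0# → y ≈ 0#)
      (independent : ∀ p s → cast p + r * cast s ≈ 0# → p ≡ 0 × s ≡ 0) where
      open Boxes cast cast≈nat

      regular : Regular
      regular = record { cancel = domain _ _ ; nonzero = nonzero }
        where
        nonzero : ∀ p s → 0 < p ℕ.+ s → ¬ (α * nat p + nat s ≈ 0#)
        nonzero p s 0< h with independent p s (begin
          cast p + r * cast s   ≈⟨ +-cong (cast≈nat p) (*-congˡ (cast≈nat s)) ⟩
          nat p + r * nat s     ≈⟨ clear-denominator (nat p) (nat s) ⟩
          r * (α * nat p + nat s) ≈⟨ *-congˡ h ⟩
          r * 0#                ≈⟨ zeroʳ r ⟩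
          0#                    ∎)
        nonzero p s () h | ≡.refl , ≡.refl

      castPoint : ∀ {n} → Vec ℕ n → Fin n → K
      castPoint {n} μ i = cast (lookup μ i) + cast (lookup (staircase n) i) * r

      castPoint≈ : ∀ {n} (μ : Vec ℕ n) i → castPoint μ i ≈ point μ i
      castPoint≈ {n} μ i = +-cong (cast≈nat _) (*-congʳ (trans (cast≈nat _) (reflexive (≡.cong nat (Vecₚ.lookup∘tabulate (λ i → n ∸ suc (toℕ i)) i)))))

      castValue : List ℕ → K
      castValue []      = 0#
      castValue (c ∷ p) = cast c + α * castValue p

      castValue≈ : ∀ p → castValue p ≈ valueℕ p
      castValue≈ []      = refl
      castValue≈ (c ∷ p) = +-cong (cast≈nat c) (*-congˡ (castValue≈ p))

      conclusion : ∀ {n} (λ′ μ : Vec ℕ n) → Decreasing λ′ → (P : KPoly n) →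
        (∀ k e → kcoeff P (vswap k e) ≈ kcoeff P e) →
        (∀ e → Vec.sum λ′ < Vec.sum e → kcoeff P e ≈ 0#) →
        (∀ ν → Decreasing ν → ν ≢ λ′ → Vec.sum ν ≤ Vec.sum λ′ → keval P (castPoint ν) ≈ 0#) →
        kcoeff P λ′ ≈ 1# →
        ∃ λ p → pow α (Vec.sum λ′ ∸ Vec.sum μ) * pow r (Vec.sum μ ∸ Vec.sum λ′) *
          kcoeff (twist (λ _ → pow (- 1#) (Vec.sum λ′) * boxes λ′) (twist (pow (- 1#)) P)) μ ≈ castValue p
      conclusion λ′ μ dec P P-sym P-deg P-van P-lead = proj₁ result , (begin
        x * kcoeff (twist (λ _ → σ * boxes λ′) Q) μ       ≈⟨ *-congˡ (kcoeff-twist (λ _ → σ * boxes λ′) Q μ) ⟩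
        x * (σ * boxes λ′ * kcoeff Q μ)                   ≈⟨ *-congˡ (*-congʳ (*-congˡ (boxes-hook λ′))) ⟩
        x * (σ * hook (toList λ′) * kcoeff Q μ)           ≈⟨ *-congˡ (kcoeff-twist (λ _ → σ * hook (toList λ′)) Q μ) ⟨
        x * kcoeff (twist (λ _ → σ * hook (toList λ′)) Q) μ ≈⟨ proj₂ result ⟩
        valueℕ (proj₁ result)                            ≈⟨ castValue≈ (proj₁ result) ⟨
        castValue (proj₁ result)                          ∎)
        where
        x = pow α (Vec.sum λ′ ∸ Vec.sum μ) * pow r (Vec.sum μ ∸ Vec.sum λ′)
        σ = pow (- 1#) (Vec.sum λ′)
        Q = twist (pow (- 1#)) P
        result = transfer regular λ′ μ dec P P-sym P-deg
          (λ ν hν ne p → trans (sym (keval-cong P (castPoint≈ ν))) (P-van ν hν ne p)) P-lead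

-- The polynomial ring ℚ[r]

open import Defs
open import Data.Rational as ℚ using (ℚ; 0ℚ; 1ℚ)
import Data.Rational.Properties as ℚₚ
open import Data.Rational.Unnormalised as ℚᵘ using (mkℚᵘ; *≡*)
import Data.Rational.Unnormalised.Properties as ℚᵘₚ

module Polynomials where
  coeff-+ : ∀ p q k → coeffℚ (p +ₚ q) k ≡ coeffℚ p k ℚ.+ coeffℚ q k
  coeff-+ []      q       k       = ≡.sym (ℚₚ.+-identityˡ _)
  coeff-+ (a ∷ p) []      k       = ≡.sym (ℚₚ.+-identityʳ _)
  coeff-+ (a ∷ p) (b ∷ q) zero    = ≡.refl
  coeff-+ (a ∷ p) (b ∷ q) (suc k) = coeff-+ p q k

  coeff-scale : ∀ c p k → coeffℚ (scaleₚ c p) k ≡ c ℚ.* coeffℚ p k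
  coeff-scale c []      k       = ≡.sym (ℚₚ.*-zeroʳ c)
  coeff-scale c (a ∷ p) zero    = ≡.refl
  coeff-scale c (a ∷ p) (suc k) = coeff-scale c p k

  -- Coefficientwise equality is a function type from which p and q cannot be read off by
  -- unification; the record makes them recoverable.
  record _≐_ (p q : Polyℚ) : Set where
    constructor ⟨_⟩
    field at : p ≈ₚ q
  open _≐_ public

  infix 4 _≐_

  ≈-refl : ∀ {p} → p ≐ p
  ≈-refl = ⟨ (λ k → ≡.refl) ⟩

  ≈-sym : ∀ {p q} → p ≐ q → q ≐ p
  ≈-sym h = ⟨ (λ k → ≡.sym (at h k)) ⟩

  ≈-trans : ∀ {p q s} → p ≐ q → q ≐ s → p ≐ s
  ≈-trans h g = ⟨ (λ k → ≡.trans (at h k) (at g k)) ⟩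

  ∷-cong : ∀ {a b p q} → a ≡ b → p ≐ q → (a ∷ p) ≐ (b ∷ q)
  ∷-cong e h = ⟨ (λ { zero → e ; (suc k) → at h k }) ⟩

  0∷[] : (0ℚ ∷ []) ≐ []
  0∷[] = ⟨ (λ { zero → ≡.refl ; (suc k) → ≡.refl }) ⟩

  +-cong : ∀ {p p′ q q′} → p ≐ p′ → q ≐ q′ → (p +ₚ q) ≐ (p′ +ₚ q′)
  +-cong {p} {p′} {q} {q′} h g = ⟨ (λ k → ≡.trans (coeff-+ p q k) (≡.trans (≡.cong₂ ℚ._+_ (at h k) (at g k)) (≡.sym (coeff-+ p′ q′ k)))) ⟩

  +-assoc : ∀ p q s → ((p +ₚ q) +ₚ s) ≐ (p +ₚ (q +ₚ s))
  +-assoc p q s = ⟨ (λ k → ≡.trans (coeff-+ (p +ₚ q) s k) (≡.trans (≡.cong (ℚ._+ coeffℚ s k) (coeff-+ p q k))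
    (≡.trans (ℚₚ.+-assoc (coeffℚ p k) _ _) (≡.sym (≡.trans (coeff-+ p (q +ₚ s) k) (≡.cong (coeffℚ p k ℚ.+_) (coeff-+ q s k))))))) ⟩

  +-comm : ∀ p q → (p +ₚ q) ≐ (q +ₚ p)
  +-comm p q = ⟨ (λ k → ≡.trans (coeff-+ p q k) (≡.trans (ℚₚ.+-comm (coeffℚ p k) _) (≡.sym (coeff-+ q p k)))) ⟩

  +-identityʳ : ∀ p → (p +ₚ []) ≐ p
  +-identityʳ p = ⟨ (λ k → ≡.trans (coeff-+ p [] k) (ℚₚ.+-identityʳ _)) ⟩

  scale-cong : ∀ c {p q} → p ≐ q → scaleₚ c p ≐ scaleₚ c q
  scale-cong c {p} {q} h = ⟨ (λ k → ≡.trans (coeff-scale c p k) (≡.trans (≡.cong (c ℚ.*_) (at h k)) (≡.sym (coeff-scale c q k)))) ⟩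

  inverseʳ : ∀ p → (p +ₚ scaleₚ (ℚ.- 1ℚ) p) ≐ []
  inverseʳ p = ⟨ (λ k → ≡.trans (coeff-+ p _ k) (≡.trans (≡.cong (coeffℚ p k ℚ.+_) (≡.trans (coeff-scale (ℚ.- 1ℚ) p k)
    (≡.trans (≡.sym (ℚₚ.neg-distribˡ-* 1ℚ (coeffℚ p k))) (≡.cong ℚ.-_ (ℚₚ.*-identityˡ _))))) (ℚₚ.+-inverseʳ (coeffℚ p k)))) ⟩

  scale-+ : ∀ c p q → scaleₚ c (p +ₚ q) ≐ (scaleₚ c p +ₚ scaleₚ c q)
  scale-+ c p q = ⟨ (λ k → ≡.trans (coeff-scale c (p +ₚ q) k) (≡.trans (≡.cong (c ℚ.*_) (coeff-+ p q k)) (≡.trans (ℚₚ.*-distribˡ-+ c (coeffℚ p k) _)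
    (≡.sym (≡.trans (coeff-+ (scaleₚ c p) _ k) (≡.cong₂ ℚ._+_ (coeff-scale c p k) (coeff-scale c q k))))))) ⟩

  scale-add : ∀ c d p → scaleₚ (c ℚ.+ d) p ≐ (scaleₚ c p +ₚ scaleₚ d p)
  scale-add c d p = ⟨ (λ k → ≡.trans (coeff-scale (c ℚ.+ d) p k) (≡.trans (ℚₚ.*-distribʳ-+ (coeffℚ p k) c d)
    (≡.sym (≡.trans (coeff-+ (scaleₚ c p) _ k) (≡.cong₂ ℚ._+_ (coeff-scale c p k) (coeff-scale d p k)))))) ⟩

  scale-scale : ∀ c d p → scaleₚ (c ℚ.* d) p ≐ scaleₚ c (scaleₚ d p)
  scale-scale c d p = ⟨ (λ k → ≡.trans (coeff-scale (c ℚ.* d) p k) (≡.trans (ℚₚ.*-assoc c d _)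
    (≡.sym (≡.trans (coeff-scale c (scaleₚ d p) k) (≡.cong (c ℚ.*_) (coeff-scale d p k)))))) ⟩

  scale-0 : ∀ p → scaleₚ 0ℚ p ≐ []
  scale-0 p = ⟨ (λ k → ≡.trans (coeff-scale 0ℚ p k) (ℚₚ.*-zeroˡ (coeffℚ p k))) ⟩

  *-congˡ : ∀ p {q q′} → q ≐ q′ → (p *ₚ q) ≐ (p *ₚ q′)
  *-congˡ []      h = ≈-refl {[]}
  *-congˡ (a ∷ p) {q} {q′} h = +-cong {scaleₚ a q} {scaleₚ a q′} (scale-cong a h) (∷-cong ≡.refl (*-congˡ p h))

  interchange : ∀ p q s t → ((p +ₚ q) +ₚ (s +ₚ t)) ≐ ((p +ₚ s) +ₚ (q +ₚ t))
  interchange p q s t = ≈-trans {_} {p +ₚ (q +ₚ (s +ₚ t))} (+-assoc p q (s +ₚ t))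
    (≈-trans {_} {p +ₚ (s +ₚ (q +ₚ t))} (+-cong {p} {p} {q +ₚ (s +ₚ t)} {s +ₚ (q +ₚ t)} (≈-refl {p})
      (≈-trans {_} {(q +ₚ s) +ₚ t} (≈-sym {(q +ₚ s) +ₚ t} (+-assoc q s t))
        (≈-trans {_} {(s +ₚ q) +ₚ t} (+-cong {q +ₚ s} {s +ₚ q} {t} (+-comm q s) (≈-refl {t})) (+-assoc s q t))))
      (≈-sym {(p +ₚ s) +ₚ (q +ₚ t)} (+-assoc p s (q +ₚ t))))

  distribʳ : ∀ s p q → ((p +ₚ q) *ₚ s) ≐ ((p *ₚ s) +ₚ (q *ₚ s))
  distribʳ s []      q       = ≈-refl {q *ₚ s}
  distribʳ s (a ∷ p) []      = ≈-sym {((a ∷ p) *ₚ s) +ₚ []} (+-identityʳ ((a ∷ p) *ₚ s))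
  distribʳ s (a ∷ p) (b ∷ q) = ≈-trans {_} {(scaleₚ a s +ₚ scaleₚ b s) +ₚ ((0ℚ ∷ (p *ₚ s)) +ₚ (0ℚ ∷ (q *ₚ s)))}
    (+-cong {scaleₚ (a ℚ.+ b) s} {scaleₚ a s +ₚ scaleₚ b s} (scale-add a b s) (∷-cong (≡.sym (ℚₚ.+-identityˡ 0ℚ)) (distribʳ s p q)))
    (interchange (scaleₚ a s) (scaleₚ b s) (0ℚ ∷ (p *ₚ s)) (0ℚ ∷ (q *ₚ s)))

  *-scaleˡ : ∀ c p q → (scaleₚ c p *ₚ q) ≐ scaleₚ c (p *ₚ q)
  *-scaleˡ c []      q = ≈-refl {[]}
  *-scaleˡ c (a ∷ p) q = ≈-trans {_} {scaleₚ c (scaleₚ a q) +ₚ scaleₚ c (0ℚ ∷ (p *ₚ q))}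
    (+-cong {scaleₚ (c ℚ.* a) q} {scaleₚ c (scaleₚ a q)} (scale-scale c a q) (∷-cong (≡.sym (ℚₚ.*-zeroʳ c)) (*-scaleˡ c p q)))
    (≈-sym {scaleₚ c (scaleₚ a q +ₚ (0ℚ ∷ (p *ₚ q)))} (scale-+ c (scaleₚ a q) (0ℚ ∷ (p *ₚ q))))

  shift-*ˡ : ∀ p q → ((0ℚ ∷ p) *ₚ q) ≐ (0ℚ ∷ (p *ₚ q))
  shift-*ˡ p q = +-cong {scaleₚ 0ℚ q} {[]} (scale-0 q) (≈-refl {0ℚ ∷ (p *ₚ q)})

  *-assoc : ∀ p q s → ((p *ₚ q) *ₚ s) ≐ (p *ₚ (q *ₚ s))
  *-assoc []      q s = ≈-refl {[]}
  *-assoc (a ∷ p) q s = ≈-trans {_} {(scaleₚ a q *ₚ s) +ₚ ((0ℚ ∷ (p *ₚ q)) *ₚ s)} (distribʳ s (scaleₚ a q) (0ℚ ∷ (p *ₚ q)))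
    (+-cong {scaleₚ a q *ₚ s} {scaleₚ a (q *ₚ s)} (*-scaleˡ a q s)
      (≈-trans {_} {0ℚ ∷ ((p *ₚ q) *ₚ s)} (shift-*ˡ (p *ₚ q) s) (∷-cong ≡.refl (*-assoc p q s))))

  *-zeroʳ : ∀ p → (p *ₚ []) ≐ []
  *-zeroʳ []      = ≈-refl {[]}
  *-zeroʳ (a ∷ p) = ≈-trans {_} {0ℚ ∷ []} (∷-cong ≡.refl (*-zeroʳ p)) 0∷[]

  *-∷ʳ : ∀ p b q → (p *ₚ (b ∷ q)) ≐ (scaleₚ b p +ₚ (0ℚ ∷ (p *ₚ q)))
  *-∷ʳ []      b q = ≈-sym {0ℚ ∷ []} 0∷[]
  *-∷ʳ (a ∷ p) b q = ∷-cong (≡.cong (ℚ._+ 0ℚ) (ℚₚ.*-comm a b))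
    (≈-trans {_} {scaleₚ a q +ₚ (scaleₚ b p +ₚ (0ℚ ∷ (p *ₚ q)))} (+-cong {scaleₚ a q} {scaleₚ a q} (≈-refl {scaleₚ a q}) (*-∷ʳ p b q))
      (≈-trans {_} {(scaleₚ a q +ₚ scaleₚ b p) +ₚ (0ℚ ∷ (p *ₚ q))} (≈-sym {(scaleₚ a q +ₚ scaleₚ b p) +ₚ (0ℚ ∷ (p *ₚ q))} (+-assoc (scaleₚ a q) (scaleₚ b p) (0ℚ ∷ (p *ₚ q))))
        (≈-trans {_} {(scaleₚ b p +ₚ scaleₚ a q) +ₚ (0ℚ ∷ (p *ₚ q))} (+-cong {scaleₚ a q +ₚ scaleₚ b p} {scaleₚ b p +ₚ scaleₚ a q} (+-comm (scaleₚ a q) (scaleₚ b p)) (≈-refl {0ℚ ∷ (p *ₚ q)}))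
          (+-assoc (scaleₚ b p) (scaleₚ a q) (0ℚ ∷ (p *ₚ q))))))

  *-comm : ∀ p q → (p *ₚ q) ≐ (q *ₚ p)
  *-comm p []      = *-zeroʳ p
  *-comm p (b ∷ q) = ≈-trans {_} {scaleₚ b p +ₚ (0ℚ ∷ (p *ₚ q))} (*-∷ʳ p b q)
    (+-cong {scaleₚ b p} {scaleₚ b p} (≈-refl {scaleₚ b p}) (∷-cong ≡.refl (*-comm p q)))

  *-congʳ : ∀ {p p′} q → p ≐ p′ → (p *ₚ q) ≐ (p′ *ₚ q)
  *-congʳ {p} {p′} q h = ≈-trans {_} {q *ₚ p} (*-comm p q) (≈-trans {_} {q *ₚ p′} (*-congˡ q h) (*-comm q p′))

  *-identityˡ : ∀ p → ((1ℚ ∷ []) *ₚ p) ≐ p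
  *-identityˡ p = ⟨ (λ k → ≡.trans (coeff-+ (scaleₚ 1ℚ p) (0ℚ ∷ []) k) (≡.trans (≡.cong₂ ℚ._+_ (≡.trans (coeff-scale 1ℚ p k) (ℚₚ.*-identityˡ (coeffℚ p k))) (at 0∷[] k)) (ℚₚ.+-identityʳ (coeffℚ p k)))) ⟩

  *-cong : ∀ {p p′ q q′} → p ≐ p′ → q ≐ q′ → (p *ₚ q) ≐ (p′ *ₚ q′)
  *-cong {p} {p′} {q} {q′} h g = ≈-trans {_} {p *ₚ q′} (*-congˡ p g) (*-congʳ q′ h)

  *-identityʳ : ∀ p → (p *ₚ (1ℚ ∷ [])) ≐ p
  *-identityʳ p = ≈-trans {_} {(1ℚ ∷ []) *ₚ p} (*-comm p (1ℚ ∷ [])) (*-identityˡ p)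

  inverseˡ : ∀ p → (scaleₚ (ℚ.- 1ℚ) p +ₚ p) ≐ []
  inverseˡ p = ≈-trans {_} {p +ₚ scaleₚ (ℚ.- 1ℚ) p} (+-comm (scaleₚ (ℚ.- 1ℚ) p) p) (inverseʳ p)

  distribˡ : ∀ s p q → (s *ₚ (p +ₚ q)) ≐ ((s *ₚ p) +ₚ (s *ₚ q))
  distribˡ s p q = ≈-trans {_} {(p +ₚ q) *ₚ s} (*-comm s (p +ₚ q)) (≈-trans {_} {(p *ₚ s) +ₚ (q *ₚ s)} (distribʳ s p q)
    (+-cong {p *ₚ s} {s *ₚ p} {q *ₚ s} {s *ₚ q} (*-comm p s) (*-comm q s)))

  ring : CommutativeRing 0ℓ 0ℓ
  ring = record
    { Carrier = Polyℚ ; _≈_ = _≐_ ; _+_ = _+ₚ_ ; _*_ = _*ₚ_ ; -_ = scaleₚ (ℚ.- 1ℚ) ; 0# = [] ; 1# = 1ℚ ∷ []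
    ; isCommutativeRing = record
      { isRing = record
        { +-isAbelianGroup = record
          { isGroup = record
            { isMonoid = record
              { isSemigroup = record
                { isMagma = record
                  { isEquivalence = record { refl = λ {p} → ≈-refl {p} ; sym = λ {p} {q} → ≈-sym {p} {q} ; trans = λ {p} {q} {s} → ≈-trans {p} {q} {s} }
                  ; ∙-cong = λ {p} {p′} {q} {q′} → +-cong {p} {p′} {q} {q′} }
                ; assoc = +-assoc }
              ; identity = (λ p → ≈-refl {p}) , +-identityʳ }
            ; inverse = inverseˡ , inverseʳ
            ; ⁻¹-cong = λ {p} {q} → scale-cong (ℚ.- 1ℚ) {p} {q} }
          ; comm = +-comm }
        ; *-cong = λ {p} {p′} {q} {q′} → *-cong {p} {p′} {q} {q′}
        ; *-assoc = *-assoc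
        ; *-identity = *-identityˡ , *-identityʳ
        ; distrib = distribˡ , distribʳ
        }
      ; *-comm = *-comm
      }
    }

  ℚ-cancel : ∀ {a b} → ¬ (a ≡ 0ℚ) → a ℚ.* b ≡ 0ℚ → b ≡ 0ℚ
  ℚ-cancel {a} {b} ne h = ≡.trans (≡.sym (ℚₚ.*-identityˡ b)) (≡.trans (≡.cong (ℚ._* b) (≡.sym (ℚₚ.*-inverseˡ a)))
    (≡.trans (ℚₚ.*-assoc (ℚ.1/ a) a b) (≡.trans (≡.cong (ℚ.1/ a ℚ.*_) h) (ℚₚ.*-zeroʳ (ℚ.1/ a)))))
    where instance _ = ℚ.≢-nonZero ne

  -- A nonzero constant term is invertible in ℚ, so the coefficients of q vanish one after another
  -- from the lowest. In `domain` a zero constant term is removed by dividing by r.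
  cancel-head : ∀ a p q → ¬ (a ≡ 0ℚ) → (a ∷ p) *ₚ q ≐ [] → q ≐ []
  cancel-head a p []      ne h = ≈-refl
  cancel-head a p (b ∷ q) ne h = ⟨ (λ { zero → b≡0 ; (suc k) → at (cancel-head a p q ne ⟨ rest ⟩) k }) ⟩
    where
    b≡0 : b ≡ 0ℚ
    b≡0 = ℚ-cancel ne (≡.trans (≡.sym (ℚₚ.+-identityʳ _)) (at h 0))
    rest : ((a ∷ p) *ₚ q) ≈ₚ []
    rest k = ≡.trans (≡.sym (≡.trans (at (*-∷ʳ (a ∷ p) b q) (suc k)) (≡.trans (coeff-+ (scaleₚ b p) ((a ∷ p) *ₚ q) k)
      (≡.trans (≡.cong (ℚ._+ coeffℚ ((a ∷ p) *ₚ q) k) (≡.trans (coeff-scale b p k) (≡.trans (≡.cong (ℚ._* coeffℚ p k) b≡0) (ℚₚ.*-zeroˡ (coeffℚ p k)))))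
        (ℚₚ.+-identityˡ _))))) (at h (suc k))

  domain : ∀ p q → ¬ (p ≐ []) → p *ₚ q ≐ [] → q ≐ []
  domain []      q ne h = ⊥-elim (ne ≈-refl)
  domain (a ∷ p) q ne h with a ℚ.≟ 0ℚ
  ... | no a≢0     = cancel-head a p q a≢0 h
  ... | yes ≡.refl = domain p q (λ p≈0 → ne ⟨ (λ { zero → ≡.refl ; (suc k) → at p≈0 k }) ⟩)
    ⟨ (λ k → ≡.trans (≡.sym (at (shift-*ˡ p q) (suc k))) (at h (suc k))) ⟩

-- The field ℚ(r) and the passage to raw fractions

open import Data.Vec as Vec using (Vec; []; _∷_; lookup; toList)
import Data.Vec.Properties as Vecₚ
open import Data.Fin using (Fin; zero; suc; toℕ)
open import Data.Fin.Permutation as Permutation using (Permutation′; lift₀; transpose; _⟨$⟩ʳ_)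

open Polynomials using (_≐_; ⟨_⟩; at)
module Poly = Polynomials
module ℚ[r] = CommutativeRing Polynomials.ring

1≢0 : ¬ ((1ℚ ∷ []) ≐ [])
1≢0 h with at h 0
... | ()

open Fractions Poly.ring Poly.domain 1≢0 using (Frac; field′; frac-domain)

module F = CommutativeRing field′

r≢0 : ¬ ((0ℚ ∷ 1ℚ ∷ []) ≐ [])
r≢0 h with at h 1
... | ()

α r : Frac
α = αᶠ , r≢0
r = rᶠ , 1≢0

αr : (α F.* r) F.≈ F.1#
αr = Poly.*-assoc (1ℚ ∷ []) (0ℚ ∷ 1ℚ ∷ []) (1ℚ ∷ [])

open Interpolation.Rescaled field′ α r αr using (KPoly; kcoeff; keval; twist; monomialᴷ; vswap; productᴷ; module Boxes; module Cast)
open Interpolation field′ α using (pow)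
open IntegerSolver field′ using (nat)

cast : ℕ → Frac
cast k = fromℕᶠ k , 1≢0

/1-suc : ∀ k → (+ suc k) ℚ./ 1 ≡ 1ℚ ℚ.+ (+ k) ℚ./ 1
/1-suc k = ℚₚ.toℚᵘ-injective (begin
  ℚ.toℚᵘ (ℚ.fromℚᵘ (mkℚᵘ (+ suc k) 0))            ≈⟨ ℚₚ.toℚᵘ-fromℚᵘ (mkℚᵘ (+ suc k) 0) ⟩
  mkℚᵘ (+ suc k) 0                                ≈⟨ *≡* (≡.cong (ℤ._* + 1) (≡.sym (≡.cong (ℤ._+_ (+ 1)) (ℤₚ.*-identityʳ (+ k))))) ⟩
  ℚ.toℚᵘ 1ℚ ℚᵘ.+ mkℚᵘ (+ k) 0                     ≈⟨ ℚᵘₚ.+-congʳ (ℚ.toℚᵘ 1ℚ) (ℚₚ.toℚᵘ-fromℚᵘ (mkℚᵘ (+ k) 0)) ⟨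
  ℚ.toℚᵘ 1ℚ ℚᵘ.+ ℚ.toℚᵘ (ℚ.fromℚᵘ (mkℚᵘ (+ k) 0)) ≈⟨ ℚₚ.toℚᵘ-homo-+ 1ℚ ((+ k) ℚ./ 1) ⟨
  ℚ.toℚᵘ (1ℚ ℚ.+ (+ k) ℚ./ 1)                     ∎)
  where open import Relation.Binary.Reasoning.Setoid ℚᵘₚ.≃-setoid

/1-injective : ∀ k → (+ k) ℚ./ 1 ≡ 0ℚ → k ≡ 0
/1-injective k h with ℚₚ.fromℚᵘ-injective {mkℚᵘ (+ k) 0} {mkℚᵘ (+ 0) 0} h
... | *≡* e = ℤₚ.+-injective (≡.trans (≡.sym (ℤₚ.*-identityʳ (+ k))) e)

cast≈nat : ∀ k → cast k F.≈ nat k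
cast≈nat zero    = ⟨ (λ { zero → ≡.refl ; (suc k) → ≡.refl }) ⟩
cast≈nat (suc k) = F.trans {cast (suc k)} {F.1# F.+ cast k} {nat (suc k)} lhs (F.+-cong {F.1#} {F.1#} {cast k} {nat k} (F.refl {F.1#}) (cast≈nat k))
  where
  open import Relation.Binary.Reasoning.Setoid ℚ[r].setoid
  1ₚ c s : Polyℚ
  1ₚ = 1ℚ ∷ []
  c = (+ k) ℚ./ 1 ∷ []
  s = (+ suc k) ℚ./ 1 ∷ []
  lhs : s *ₚ (1ₚ *ₚ 1ₚ) ≐ ((1ₚ *ₚ 1ₚ) +ₚ (c *ₚ 1ₚ)) *ₚ 1ₚ
  lhs = begin
    s *ₚ (1ₚ *ₚ 1ₚ)              ≈⟨ Poly.*-congˡ s (ℚ[r].*-identityʳ 1ₚ) ⟩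
    s *ₚ 1ₚ                      ≈⟨ ℚ[r].*-identityʳ s ⟩
    s                            ≡⟨ ≡.cong (_∷ []) (/1-suc k) ⟩
    1ₚ +ₚ c                      ≈⟨ ℚ[r].+-cong (ℚ[r].*-identityʳ 1ₚ) (ℚ[r].*-identityʳ c) ⟨
    (1ₚ *ₚ 1ₚ) +ₚ (c *ₚ 1ₚ)          ≈⟨ ℚ[r].*-identityʳ _ ⟨
    ((1ₚ *ₚ 1ₚ) +ₚ (c *ₚ 1ₚ)) *ₚ 1ₚ  ∎

-- Without denominators the hypothesis says that p + s r is the zero polynomial, and its two
-- coefficients are p and s.
linear-independent : ∀ p s → (cast p F.+ r F.* cast s) F.≈ F.0# → p ≡ 0 × s ≡ 0
linear-independent p s h = /1-injective p (≡.trans (≡.sym (ℚₚ.+-identityʳ _)) (at zeroPoly 0)) , /1-injective s (at zeroPoly 1)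
  where
  open import Relation.Binary.Reasoning.Setoid ℚ[r].setoid
  1ₚ X a b : Polyℚ
  1ₚ = 1ℚ ∷ []
  X = 0ℚ ∷ 1ₚ
  a = (+ p) ℚ./ 1 ∷ []
  b = (+ s) ℚ./ 1 ∷ []
  zeroPoly : a +ₚ (0ℚ ∷ b) ≐ []
  zeroPoly = begin
    a +ₚ (0ℚ ∷ b) ≈⟨ ℚ[r].+-cong (ℚ[r].trans (Poly.*-congˡ a (ℚ[r].*-identityʳ 1ₚ)) (ℚ[r].*-identityʳ a))
                      (ℚ[r].trans (ℚ[r].*-identityʳ (X *ₚ b)) (ℚ[r].trans (Poly.shift-*ˡ 1ₚ b) (Poly.∷-cong ≡.refl (ℚ[r].*-identityˡ b)))) ⟨
    (a *ₚ (1ₚ *ₚ 1ₚ)) +ₚ ((X *ₚ b) *ₚ 1ₚ)            ≈⟨ ℚ[r].*-identityʳ _ ⟨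
    ((a *ₚ (1ₚ *ₚ 1ₚ)) +ₚ ((X *ₚ b) *ₚ 1ₚ)) *ₚ 1ₚ    ≈⟨ h ⟩
    [] ∎

open Boxes cast cast≈nat using (box; boxes)
open Cast cast cast≈nat frac-domain linear-independent using (castPoint; castValue; conclusion)

-- Arithmetic on `Frac` projects to the raw arithmetic by computation, so the translation lemmas
-- below are equalities of raw fractions and not mere equivalences.
raw : ∀ {n} → KPoly n → MPoly n
raw = map (λ t → proj₁ (proj₁ t) , proj₂ t)

den-*ˡ : ∀ {a b} → ¬ ((a *ₚ b) ≈ₚ []) → ¬ (a ≐ [])
den-*ˡ {a} {b} h z = h (at (ℚ[r].trans (Poly.*-congʳ b z) (ℚ[r].zeroˡ b)))

den-*ʳ : ∀ {a b} → ¬ ((a *ₚ b) ≈ₚ []) → ¬ (b ≈ₚ [])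
den-*ʳ {a} {b} h z = h (at (ℚ[r].trans (Poly.*-congˡ a ⟨ z ⟩) (ℚ[r].zeroʳ a)))

wellFormed-head : ∀ {n} c (e : Vec ℕ n) P → WellFormed ((c , e) ∷ P) → ¬ (proj₂ c ≐ [])
wellFormed-head c e P h with Vecₚ.≡-dec ℕ._≟_ e e | h e
... | yes _ | nz = den-*ˡ nz
... | no ne | _  = ⊥-elim (ne ≡.refl)

wellFormed-tail : ∀ {n} c (e : Vec ℕ n) P → WellFormed ((c , e) ∷ P) → WellFormed P
wellFormed-tail c e P h f with Vecₚ.≡-dec ℕ._≟_ e f | h f
... | yes _ | nz = den-*ʳ {proj₂ c} nz
... | no _  | nz = nz

-- The denominator of a collected coefficient is the product of the denominators of its terms, so if
-- it is nonzero then each of them is.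
lift : ∀ {n} (P : MPoly n) → WellFormed P → ∃ λ (P̂ : KPoly n) → raw P̂ ≡ P
lift []            h = [] , ≡.refl
lift ((c , e) ∷ P) h with lift P (wellFormed-tail c e P h)
... | P̂ , ≡.refl = ((c , wellFormed-head c e P h) , e) ∷ P̂ , ≡.refl

coeff-raw : ∀ {n} (P : KPoly n) e → coeff (raw P) e ≡ proj₁ (kcoeff P e)
coeff-raw []             e = ≡.refl
coeff-raw ((c , e′) ∷ P) e with Vecₚ.≡-dec ℕ._≟_ e′ e
... | yes _ = ≡.cong (proj₁ c +ᶠ_) (coeff-raw P e)
... | no  _ = coeff-raw P e

pow-raw : ∀ x k → proj₁ (pow x k) ≡ proj₁ x ^ᶠ k
pow-raw x zero    = ≡.refl
pow-raw x (suc k) = ≡.cong (proj₁ x *ᶠ_) (pow-raw x k)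

monomial-raw : ∀ {n} (x : Vec ℚ⟨r⟩ n) (y : Fin n → Frac) → (∀ i → lookup x i ≡ proj₁ (y i)) → ∀ e →
  monomial x e ≡ proj₁ (monomialᴷ y e)
monomial-raw x y h e = ≡.trans (≡.cong prodᶠ (Listₚ.map-tabulate id (λ i → lookup x i ^ᶠ lookup e i))) (go (lookup x) y h e)
  where
  go : ∀ {n} (x : Fin n → ℚ⟨r⟩) (y : Fin n → Frac) → (∀ i → x i ≡ proj₁ (y i)) → ∀ e →
    prodᶠ (tabulate (λ i → x i ^ᶠ lookup e i)) ≡ proj₁ (monomialᴷ y e)
  go x y h []      = ≡.refl
  go x y h (a ∷ e) = ≡.cong₂ _*ᶠ_ (≡.trans (≡.cong (_^ᶠ a) (h zero)) (≡.sym (pow-raw (y zero) a))) (go (x ∘ suc) (y ∘ suc) (h ∘ suc) e)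

eval-raw : ∀ {n} (P : KPoly n) x y → (∀ i → lookup x i ≡ proj₁ (y i)) → eval (raw P) x ≡ proj₁ (keval P y)
eval-raw []            x y h = ≡.refl
eval-raw ((c , e) ∷ P) x y h = ≡.cong₂ (λ m t → proj₁ c *ᶠ m +ᶠ t) (monomial-raw x y h e) (eval-raw P x y h)

-- The adjacent transposition at k, through which the symmetry of P enters `conclusion`; for k out
-- of range it is the identity, as is `vswap`.
swapping : ∀ n → ℕ → Permutation′ n
swapping (suc n)       (suc k) = lift₀ (swapping n k)
swapping (suc (suc n)) zero    = transpose zero (suc zero)
swapping n             _       = Permutation.id

permute-swapping : ∀ {n} k (e : Vec ℕ n) → permute (swapping n k) e ≡ vswap k e
permute-swapping zero    []          = ≡.refl
permute-swapping zero    (x ∷ [])    = ≡.refl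
permute-swapping zero    (x ∷ y ∷ e) = ≡.cong (λ t → y ∷ x ∷ t) (Vecₚ.tabulate∘lookup e)
permute-swapping (suc k) []          = ≡.refl
permute-swapping (suc k) (x ∷ e)     = ≡.cong (x ∷_) (permute-swapping k e)

castValue-raw : ∀ p → proj₁ (castValue p) ≡ ℕ[α]→ℚ⟨r⟩ p
castValue-raw []      = ≡.refl
castValue-raw (c ∷ p) = ≡.cong (λ t → fromℕᶠ c +ᶠ αᶠ *ᶠ t) (castValue-raw p)

boxes-raw : ∀ {n} (v : Vec ℕ n) → proj₁ (boxes v) ≡ cλ v
boxes-raw {n} v = ≡.trans (productᴷ-raw (concatMap rows (allFin n))) (≡.cong prodᶠ (≡.trans (Listₚ.map-concatMap proj₁ rows (allFin n))
  (Listₚ.concatMap-cong (λ i → ≡.sym (Listₚ.map-∘ (upTo (lookup v i)))) (allFin n))))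
  where
  rows : Fin n → List Frac
  rows i = map (box v i) (upTo (lookup v i))
  productᴷ-raw : ∀ xs → proj₁ (productᴷ xs) ≡ prodᶠ (map proj₁ xs)
  productᴷ-raw []       = ≡.refl
  productᴷ-raw (x ∷ xs) = ≡.cong (proj₁ x *ᶠ_) (productᴷ-raw xs)

signs : ∀ k → proj₁ (pow (F.- F.1#) k) ≡ sgnᶠ k
signs = pow-raw (F.- F.1#)

Jpoly-raw : ∀ {n} (v : Vec ℕ n) (P : KPoly n) →
  raw (twist (λ _ → pow (F.- F.1#) ∣ v ∣ F.* boxes v) (twist (pow (F.- F.1#)) P)) ≡ Jpoly v (raw P)
Jpoly-raw v []            = ≡.refl
Jpoly-raw v ((c , e) ∷ P) = ≡.cong₂ _∷_
  (≡.cong (_, e) (≡.cong₂ _*ᶠ_ (≡.cong₂ _*ᶠ_ (signs ∣ v ∣) (boxes-raw v)) (≡.cong (_*ᶠ proj₁ c) (signs ∣ e ∣)))) (Jpoly-raw v P)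

aCoeff-raw : ∀ {n} (v μ : Vec ℕ n) (P : KPoly n) → aCoeff v (raw P) μ ≡
  proj₁ (pow α (∣ v ∣ ∸ ∣ μ ∣) F.* pow r (∣ μ ∣ ∸ ∣ v ∣) F.* kcoeff (twist (λ _ → pow (F.- F.1#) ∣ v ∣ F.* boxes v) (twist (pow (F.- F.1#)) P)) μ)
aCoeff-raw v μ P = ≡.cong₂ _*ᶠ_ (≡.cong₂ _*ᶠ_ (≡.sym (pow-raw α (∣ v ∣ ∸ ∣ μ ∣))) (≡.sym (pow-raw r (∣ μ ∣ ∸ ∣ v ∣))))
  (≡.trans (≡.cong (λ J → coeff J μ) (≡.sym (Jpoly-raw v P)))
    (coeff-raw (twist (λ _ → pow (F.- F.1#) ∣ v ∣ F.* boxes v) (twist (pow (F.- F.1#)) P)) μ))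

module _ {n} (P : KPoly n) where

  coeff-≈ : ∀ e y → coeff (raw P) e ≈ proj₁ y → kcoeff P e F.≈ y
  coeff-≈ e y h = ⟨ ≡.subst (_≈ proj₁ y) (coeff-raw P e) h ⟩

  kcoeff-sym : IsSymmetric (raw P) → ∀ k e → kcoeff P (vswap k e) F.≈ kcoeff P e
  kcoeff-sym h k e = coeff-≈ (vswap k e) (kcoeff P e)
    (≡.subst₂ _≈_ (≡.cong (coeff (raw P)) (permute-swapping k e)) (coeff-raw P e) (h (swapping n k) e))

  keval-0 : ∀ ν → eval (raw P) (shiftPoint ν) ≈ 0ᶠ → keval P (castPoint ν) F.≈ F.0#
  keval-0 ν h = ⟨ ≡.subst (_≈ 0ᶠ) (eval-raw P (shiftPoint ν) (castPoint ν)
    (Vecₚ.lookup∘tabulate (λ i → fromℕᶠ (lookup ν i) +ᶠ fromℕᶠ (lookup (δ n) i) *ᶠ rᶠ))) h ⟩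

  theorem-raw : (λ′ μ : Vec ℕ n) → IsPartition λ′ → IsInterpolationPoly λ′ (raw P) →
    Σ (List ℕ) (λ p → aCoeff λ′ (raw P) μ ≈ ℕ[α]→ℚ⟨r⟩ p)
  theorem-raw λ′ μ dec (_ , P-sym , P-deg , P-van , P-lead) =
    proj₁ result , ≡.subst₂ _≈_ (≡.sym (aCoeff-raw λ′ μ P)) (castValue-raw (proj₁ result)) (at (proj₂ result))
    where
    result = conclusion λ′ μ dec P (kcoeff-sym P-sym) (λ e p → coeff-≈ e F.0# (P-deg e p))
      (λ ν hν ne p → keval-0 ν (P-van ν hν ne p)) (coeff-≈ λ′ F.1# P-lead)

theoremA : (n : ℕ) (λ′ μ : Vec ℕ n) → IsPartition λ′ → IsPartition μ
  → (P : MPoly n) → IsInterpolationPoly λ′ P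
  → Σ (List ℕ) (λ p → aCoeff λ′ P μ ≈ ℕ[α]→ℚ⟨r⟩ p)
theoremA n λ′ μ dec _ P h = ≡.subst (λ P → IsInterpolationPoly λ′ P → Σ (List ℕ) (λ p → aCoeff λ′ P μ ≈ ℕ[α]→ℚ⟨r⟩ p))
  (proj₂ lifted) (theorem-raw (proj₁ lifted) λ′ μ dec) h
  where lifted = lift P (proj₁ h)
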